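{- Let $d,r$ be positive integers with $d\geq 3+r$ and $\gcd(d,r)=1$. Let $n$ be an integer with $n\equiv -r\pmod d$ and $n\geq 2d-r$. Then, modulo $\Phi_n(q)^2$, \[ \sum_{k=0}^{n-1}\frac{(q^{d+r};q^d)_k^{d-r}(q^r;q^d)_k^{r-1}(q^{r-d};q^d)_k\,q^{dk}}{(q^d;q^d)_k^d} \equiv\frac{(1-q^r)^{r}(1-q^{d-r})(q^d;q^d)_{n-1-(n+r)/d}}{ -(-1)^{n-1-(n+r)/d}(q^d;q^d)_{(n+r)/d}^{d-1}}\,q^{A(d,n,r)}, \] where $A(d,n,r)=\dfrac{d(d+n)(n+r)+dn(r-1)-(n+r)^2}{2d}-\dfrac{r(r+1)}{2}$. Moreover, the same congruence also holds when $r=1$ and $d\in\{2,3\}$ (with $n\equiv -1\pmod d$ and $n\ge 2d-1$).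
   Context: For a complex variable $x$ and integer $m\ge 0$, $(x;q)_m=(1-x)(1-xq)\cdots(1-xq^{m-1})$, with $(x;q)_0=1$; $(x;q)_m^e$ denotes its $e$-th power. $\Phi_n(q)$ is the $n$-th cyclotomic polynomial. For rational functions $A(q),B(q)$ and a polynomial $P(q)$, $A\equiv B\pmod{P(q)}$ means that $(A-B)/P$ is a rational function whose denominator is coprime to $P(q)$. -}

module Defs where

open import Data.Nat as ℕ using (ℕ; zero; suc; _∸_)
open import Data.Nat.Divisibility using (_∣?_)
open import Data.Integer as ℤ using (ℤ; +_; 0ℤ; 1ℤ; -1ℤ)
open import Data.Integer.DivMod using (_/ℕ_)
open import Data.List using (List; []; _∷_; _++_; replicate; reverse; map; foldr; upTo; length; zip)
open import Data.List.Relation.Unary.All using (All)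
open import Data.Product using (Σ; _×_; _,_)
open import Relation.Binary.PropositionalEquality using (_≡_; _≢_)
open import Relation.Nullary using (yes; no)

-- Polynomials in q with integer coefficients, little-endian coefficient
-- lists (constant term first).  Trailing zeros are allowed; equality of
-- polynomials is _≈P_ below.

Poly : Set
Poly = List ℤ

infixl 6 _+P_ _-P_
infixl 7 _*P_

_+P_ : Poly → Poly → Poly
[]       +P q        = q
(a ∷ p)  +P []       = a ∷ p
(a ∷ p)  +P (b ∷ q)  = (a ℤ.+ b) ∷ (p +P q)

scaleP : ℤ → Poly → Poly
scaleP c = map (c ℤ.*_)

negP : Poly → Poly
negP = scaleP -1ℤ

_-P_ : Poly → Poly → Poly
p -P q = p +P negP q

_*P_ : Poly → Poly → Poly
[]      *P q = []
(a ∷ p) *P q = scaleP a q +P (0ℤ ∷ (p *P q))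

constP : ℤ → Poly
constP c = c ∷ []

oneP : Poly
oneP = constP 1ℤ

XP : ℕ → Poly
XP m = replicate m 0ℤ ++ (1ℤ ∷ [])

powP : Poly → ℕ → Poly
powP p zero    = oneP
powP p (suc e) = p *P powP p e

IsZeroP : Poly → Set
IsZeroP p = All (_≡ 0ℤ) p

_≈P_ : Poly → Poly → Set
p ≈P q = IsZeroP (p -P q)

normP : Poly → Poly
normP p = reverse (dropZ (reverse p))
  where
  dropZ : List ℤ → List ℤ
  dropZ []            = []
  dropZ (+ zero ∷ xs) = dropZ xs
  dropZ (x ∷ xs)      = x ∷ xs

subFront : List ℤ → List ℤ → List ℤ
subFront xs       []       = xs
subFront []       (y ∷ ys) = []
subFront (x ∷ xs) (y ∷ ys) = (x ℤ.- y) ∷ subFront xs ys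

-- big-endian long division of f by the monic polynomial 1 ∷ gt,
-- with fuel; returns the quotient (big-endian)
divBE : ℕ → List ℤ → List ℤ → List ℤ
divBE zero    f        gt = []
divBE (suc k) []       gt = []
divBE (suc k) (c ∷ fs) gt with length gt ℕ.≤? length fs
... | yes _ = c ∷ divBE k (subFront fs (map (c ℤ.*_) gt)) gt
... | no  _ = []

divMonicP : Poly → Poly → Poly
divMonicP f g with reverse (normP g)
... | []      = []
... | _ ∷ gt  = reverse (divBE (length f) (reverse (normP f)) gt)

-- Cyclotomic polynomials, defined by  q^n - 1 = ∏_{d ∣ n} Φ_d(q),
-- i.e. Φ_n = (q^n - 1) / ∏_{d ∣ n, d < n} Φ_d.

-- the product of Φ_d over the divisors d < m of m, given the list
-- [Φ_1, …, Φ_{m-1}]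
properDivProd : ℕ → List Poly → Poly
properDivProd m tbl = foldr step oneP (zip (upTo (length tbl)) tbl)
  where
  step : ℕ × Poly → Poly → Poly
  step (i , φ) acc with suc i ∣? m
  ... | yes _ = φ *P acc
  ... | no  _ = acc

cycTable : ℕ → List Poly
cycTable zero    = []
cycTable (suc n) = tbl ++ (divMonicP (XP (suc n) -P oneP) (properDivProd (suc n) tbl) ∷ [])
  where tbl = cycTable n

lastOr : Poly → List Poly → Poly
lastOr d []       = d
lastOr d (x ∷ []) = x
lastOr d (_ ∷ y ∷ ys) = lastOr d (y ∷ ys)

-- Φ_n(q) (n ≥ 1; Φ_0 is set to 1 and never used)
Φ : ℕ → Poly
Φ n = lastOr oneP (cycTable n)

record RatF : Set where
  constructor _//_
  field
    num : Poly
    den : Poly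
open RatF public

infixl 6 _+R_ _-R_
infixl 7 _*R_

polyR : Poly → RatF
polyR p = p // oneP

constR : ℤ → RatF
constR c = polyR (constP c)

oneR : RatF
oneR = constR 1ℤ

zeroR : RatF
zeroR = constR 0ℤ

_+R_ : RatF → RatF → RatF
(a // b) +R (c // e) = ((a *P e) +P (c *P b)) // (b *P e)

_*R_ : RatF → RatF → RatF
(a // b) *R (c // e) = (a *P c) // (b *P e)

negR : RatF → RatF
negR (a // b) = negP a // b

_-R_ : RatF → RatF → RatF
x -R y = x +R negR y

invR : RatF → RatF
invR (a // b) = b // a

_/R_ : RatF → RatF → RatF
x /R y = x *R invR y

powR : RatF → ℕ → RatF
powR x zero    = oneR
powR x (suc e) = x *R powR x e

qPow : ℤ → RatF
qPow (+ m)     = polyR (XP m)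
qPow ℤ.-[1+ m ] = oneP // XP (suc m)

poch : ℤ → ℤ → ℕ → RatF
poch a b zero    = oneR
poch a b (suc k) = poch a b k *R (oneR -R qPow (a ℤ.+ b ℤ.* (+ k)))

sumR : ℕ → (ℕ → RatF) → RatF
sumR n f = foldr (λ k acc → f k +R acc) zeroR (upTo n)

-- D and P are coprime in ℚ[q]: U D + V P is a nonzero constant
CoprimeP : Poly → Poly → Set
CoprimeP D P = Σ Poly λ U → Σ Poly λ V → Σ ℤ λ c →
  (c ≢ 0ℤ) × ((U *P D) +P (V *P P)) ≈P constP c

-- A ≡ B (mod P): (A - B)/P = N/D for polynomials N, D with D coprime to P.
-- With A = a/b and B = c/e this is (a e - c b) D = N b e P.
_≡R_[mod_] : RatF → RatF → Poly → Set
A ≡R B [mod P ] = Σ Poly λ N → Σ Poly λ D →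
  CoprimeP D P ×
  (((num A *P den B) -P (num B *P den A)) *P D) ≈P (N *P den A *P den B *P P)

lhsTerm : ℕ → ℕ → ℕ → RatF
lhsTerm d r k =
  (powR (poch (+ (d ℕ.+ r)) (+ d) k) (d ∸ r)
   *R powR (poch (+ r) (+ d) k) (r ∸ 1)
   *R poch (+ r ℤ.- + d) (+ d) k
   *R qPow (+ (d ℕ.* k)))
  /R powR (poch (+ d) (+ d) k) d

-- A(d,n,r) = (d(d+n)(n+r) + dn(r-1) - (n+r)^2)/(2d) - r(r+1)/2
-- (both divisions are exact under the hypotheses of the theorem)
Aexp : ℕ → ℕ → ℕ → ℤ
Aexp zero    n r = 0ℤ
Aexp (suc d') n r =
  ((+ (d ℕ.* (d ℕ.+ n) ℕ.* (n ℕ.+ r)) ℤ.+ (+ (d ℕ.* n)) ℤ.* (+ r ℤ.- 1ℤ)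
     ℤ.- + ((n ℕ.+ r) ℕ.* (n ℕ.+ r))) /ℕ (2 ℕ.* d))
  ℤ.- + ((r ℕ.* (r ℕ.+ 1)) ℕ./ 2)
  where d = suc d'

-- (n+r)/d  (exact under the hypotheses; d = 0 never occurs)
quotNR : ℕ → ℕ → ℕ → ℕ
quotNR zero     n r = 0
quotNR (suc d') n r = (n ℕ.+ r) ℕ./ suc d'

rhs : ℕ → ℕ → ℕ → RatF
rhs d n r =
  (powR (oneR -R qPow (+ r)) r
   *R (oneR -R qPow (+ d ℤ.- + r))
   *R poch (+ d) (+ d) (n ∸ 1 ∸ m))
  /R (negR (powR (constR -1ℤ) (n ∸ 1 ∸ m)) *R powR (poch (+ d) (+ d) m) (d ∸ 1))
  *R qPow (Aexp d n r)
  where m = quotNR d n r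

{-# OPTIONS --safe #-}
module Submission where

-- Put Q = q^d, m = (n+r)/d, N = n-1-m and η = 1 - q^n.  The congruence is an identity in the localization of
-- ℤ[q]/(Φ_n²) at the polynomials coprime to Φ_n.  There η² = 0, so q^{cn} = 1 - cη, and (q^{a+cn};Q)_k is affine in c:
-- multiplying the bases of several factors with the same a by powers of q^n changes nothing if the exponents of
-- these powers sum to 0.  For d ≥ r + 2 one can reach in this way the bases Q^{-N} in one numerator and,
-- in each remaining quotient, a numerator that is a nonnegative power of Q times its denominator, these powers
-- adding up to N.  The resulting sum Σ_k (Q^{-N};Q)_k/(Q;Q)_k Q^k g(Q^k) with deg g = N only sees the leading
-- coefficient of g (the q-Karlsson–Minton sum).  For d = 2 the sum is the mean of two q-Chu–Vandermonde sums.
--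
-- The invertibility of 1 - q^j for n ∤ j is the coprimality of Φ_n and q^j - 1, proved by strong induction
-- together with the exactness of the division that defines Φ_n.

open import Defs
open import Algebra.Bundles using (CommutativeRing; RawRing)
open import Algebra.Morphism.Structures using (module RingMorphisms)
open import Data.Integer as ℤ using (ℤ; +_; -[1+_]; 0ℤ; 1ℤ; -1ℤ)
open import Data.Integer.DivMod using (_/ℕ_; [n/ℕd]*d≤n; n<s[n/ℕd]*d)
import Data.Integer.Properties as ℤₚ
open import Data.Integer.Solver using (module +-*-Solver)
open import Data.List using (List; []; _∷_; _∷ʳ_; length; reverse; map; foldr; zip; upTo; applyUpTo; replicate)
import Data.List.Properties as Listₚ
open import Data.List.Relation.Unary.All using ([]; _∷_)
open import Data.Maybe using (just; nothing)
open import Data.Nat as ℕ using (ℕ; zero; suc; _∸_)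
import Data.Nat.Coprimality as ℕ
import Data.Nat.DivMod as ℕ
open import Data.Nat.Divisibility using (_∣_; _∤_; _∣?_; divides; ∣-trans; ∣-refl; ∣⇒≤; ∣m+n∣m⇒∣n)
open import Data.Nat.GCD using (gcd; gcd[m,n]∣m; gcd[m,n]∣n; gcd-GCD; gcd[m,n]≢0; module Bézout)
open import Data.Nat.Induction using (<-rec)
import Data.Nat.Properties as ℕₚ
open import Data.Nat.Solver using () renaming (module +-*-Solver to ℕ-Solver)
open import Data.Product using (Σ; ∃; _×_; _,_; proj₁; proj₂)
open import Data.Sum using (_⊎_; inj₁; inj₂)
open import Function using (_∘_)
open import Level using (0ℓ)
open import Relation.Binary.Definitions using (WeaklyDecidable)
open import Relation.Binary.PropositionalEquality as ≡ using (_≡_; _≢_)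
open import Relation.Binary.Structures using (IsEquivalence)
open import Relation.Nullary using (yes; no; contradiction)

open +-*-Solver using () renaming
  (solve to ℤsolve; _:=_ to _≜_; _:+_ to _⊕_; _:*_ to _⊗_; _:-_ to _⊝_; :-_ to ⊝_; con to κ)

-- Integer coefficients and units in a commutative ring

module IntegerCoefficients (R : CommutativeRing 0ℓ 0ℓ) where
  open CommutativeRing R
  open import Algebra.Solver.Ring.AlmostCommutativeRing
  open import Algebra.Properties.Ring ring
  open import Algebra.Properties.Semiring.Mult.TCOptimised semiring using (1+×; ×-homo-+; ×1-homo-*) renaming (_×_ to _×ₙ_)
  open import Relation.Binary.Reasoning.Setoid setoid

  -- The unique ring homomorphism from ℤ. It gives the ring solver coefficients with decidable
  -- equality, and it supplies the multiples c of η in the expansion of q^{cn}.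
  fromℤ : ℤ → Carrier
  fromℤ (+ n)     = n ×ₙ 1#
  fromℤ -[1+ n ] = - (suc n ×ₙ 1#)

  private
    cancel-suc : ∀ x y → (1# + x) - (1# + y) ≈ x - y
    cancel-suc x y = begin
      (1# + x) - (1# + y)        ≈⟨ +-congˡ (-‿+-comm 1# y) ⟨
      (1# + x) + (- 1# + - y)    ≈⟨ +-congʳ (+-comm 1# x) ⟩
      (x + 1#) + (- 1# + - y)    ≈⟨ +-assoc _ _ _ ⟩
      x + (1# + (- 1# + - y))    ≈⟨ +-congˡ (+-assoc _ _ _) ⟨
      x + ((1# - 1#) + - y)      ≈⟨ +-congˡ (+-congʳ (-‿inverseʳ 1#)) ⟩
      x + (0# + - y)             ≈⟨ +-congˡ (+-identityˡ _) ⟩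
      x - y                      ∎

    fromℤ-⊖ : ∀ m n → fromℤ (m ℤ.⊖ n) ≈ m ×ₙ 1# - n ×ₙ 1#
    fromℤ-⊖ m zero = sym (trans (+-congˡ -0#≈0#) (+-identityʳ _))
    fromℤ-⊖ zero (suc n) = sym (+-identityˡ _)
    fromℤ-⊖ (suc m) (suc n) = begin
      fromℤ (suc m ℤ.⊖ suc n)     ≡⟨ ≡.cong fromℤ (ℤₚ.[1+m]⊖[1+n]≡m⊖n m n) ⟩
      fromℤ (m ℤ.⊖ n)             ≈⟨ fromℤ-⊖ m n ⟩
      m ×ₙ 1# - n ×ₙ 1#             ≈⟨ cancel-suc _ _ ⟨
      (1# + m ×ₙ 1#) - (1# + n ×ₙ 1#) ≈⟨ +-cong (1+× m 1#) (-‿cong (1+× n 1#)) ⟨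
      suc m ×ₙ 1# - suc n ×ₙ 1#     ∎

  fromℤ-neg : ∀ i → fromℤ (ℤ.- i) ≈ - fromℤ i
  fromℤ-neg (+ zero)  = sym -0#≈0#
  fromℤ-neg (+ suc n) = refl
  fromℤ-neg -[1+ n ]  = sym (-‿involutive _)

  fromℤ-+ : ∀ i j → fromℤ (i ℤ.+ j) ≈ fromℤ i + fromℤ j
  fromℤ-+ (+ m) (+ n)       = ×-homo-+ 1# m n
  fromℤ-+ (+ m) -[1+ n ]    = fromℤ-⊖ m (suc n)
  fromℤ-+ -[1+ m ] (+ n)    = trans (fromℤ-⊖ n (suc m)) (+-comm _ _)
  fromℤ-+ -[1+ m ] -[1+ n ] = begin
    - (suc (suc (m ℕ.+ n)) ×ₙ 1#)        ≡⟨ ≡.cong (λ k → - (k ×ₙ 1#)) (≡.sym (ℕₚ.+-suc (suc m) n)) ⟩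
    - ((suc m ℕ.+ suc n) ×ₙ 1#)          ≈⟨ -‿cong (×-homo-+ 1# (suc m) (suc n)) ⟩
    - (suc m ×ₙ 1# + suc n ×ₙ 1#)         ≈⟨ -‿+-comm _ _ ⟨
    - (suc m ×ₙ 1#) + - (suc n ×ₙ 1#)     ∎

  private
    nonNeg : ∀ m j → fromℤ (+ m ℤ.* j) ≈ m ×ₙ 1# * fromℤ j
    nonNeg m (+ n) = begin
      fromℤ (+ m ℤ.* + n)    ≡⟨ ≡.cong fromℤ (≡.sym (ℤₚ.pos-* m n)) ⟩
      (m ℕ.* n) ×ₙ 1#         ≈⟨ ×1-homo-* m n ⟩
      m ×ₙ 1# * n ×ₙ 1#        ∎
    nonNeg m -[1+ n ] = begin
      fromℤ (+ m ℤ.* ℤ.- (+ suc n))    ≡⟨ ≡.cong fromℤ (≡.sym (ℤₚ.neg-distribʳ-* (+ m) (+ suc n))) ⟩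
      fromℤ (ℤ.- (+ m ℤ.* + suc n))    ≈⟨ fromℤ-neg (+ m ℤ.* + suc n) ⟩
      - fromℤ (+ m ℤ.* + suc n)        ≈⟨ -‿cong (nonNeg m (+ suc n)) ⟩
      - (m ×ₙ 1# * suc n ×ₙ 1#)          ≈⟨ -‿distribʳ-* _ _ ⟩
      m ×ₙ 1# * - (suc n ×ₙ 1#)          ∎

  fromℤ-* : ∀ i j → fromℤ (i ℤ.* j) ≈ fromℤ i * fromℤ j
  fromℤ-* -[1+ m ] j = begin
    fromℤ (ℤ.- (+ suc m) ℤ.* j)      ≡⟨ ≡.cong fromℤ (≡.sym (ℤₚ.neg-distribˡ-* (+ suc m) j)) ⟩
    fromℤ (ℤ.- (+ suc m ℤ.* j))      ≈⟨ fromℤ-neg (+ suc m ℤ.* j) ⟩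
    - fromℤ (+ suc m ℤ.* j)          ≈⟨ -‿cong (nonNeg (suc m) j) ⟩
    - (suc m ×ₙ 1# * fromℤ j)         ≈⟨ -‿distribˡ-* _ _ ⟩
    - (suc m ×ₙ 1#) * fromℤ j         ∎
  fromℤ-* (+ m) j = nonNeg m j

  private
    ℤ-raw : RawRing 0ℓ 0ℓ
    ℤ-raw = CommutativeRing.rawRing ℤₚ.+-*-commutativeRing

    morphism : ℤ-raw -Raw-AlmostCommutative⟶ fromCommutativeRing R
    morphism = record
      { ⟦_⟧    = fromℤ
      ; +-homo = fromℤ-+
      ; *-homo = fromℤ-*
      ; -‿homo = fromℤ-neg
      ; 0-homo = refl
      ; 1-homo = refl
      }

    coeff≟ : WeaklyDecidable (Induced-equivalence morphism)
    coeff≟ i j with i ℤ.≟ j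
    ... | yes i≡j = just (reflexive (≡.cong fromℤ i≡j))
    ... | no  _   = nothing

  open import Algebra.Solver.Ring ℤ-raw (fromCommutativeRing R) morphism coeff≟ public
    using (solve; _:=_; _:+_; _:*_; _:-_; :-_; con)

IsUnit : (R : CommutativeRing 0ℓ 0ℓ) → CommutativeRing.Carrier R → Set
IsUnit R x = ∃ λ y → x * y ≈ 1#
  where open CommutativeRing R

module Units (R : CommutativeRing 0ℓ 0ℓ) where
  open CommutativeRing R hiding (zero)
  open IntegerCoefficients R
  open import Algebra.Properties.CommutativeSemiring.Exp commutativeSemiring using (_^_)
  open import Relation.Binary.Reasoning.Setoid setoid

  IsUnit-cancelˡ : ∀ {u x y} → IsUnit R u → u * x ≈ u * y → x ≈ y
  IsUnit-cancelˡ {u} {x} {y} (v , uv≈1) ux≈uy = begin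
    x            ≈⟨ *-identityˡ x ⟨
    1# * x       ≈⟨ *-congʳ (trans (*-comm v u) uv≈1) ⟨
    v * u * x    ≈⟨ *-assoc v u x ⟩
    v * (u * x)  ≈⟨ *-congˡ ux≈uy ⟩
    v * (u * y)  ≈⟨ *-assoc v u y ⟨
    v * u * y    ≈⟨ *-congʳ (trans (*-comm v u) uv≈1) ⟩
    1# * y       ≈⟨ *-identityˡ y ⟩
    y            ∎

  IsUnit-resp : ∀ {x y} → x ≈ y → IsUnit R x → IsUnit R y
  IsUnit-resp x≈y (u , xu≈1) = u , trans (*-congʳ (sym x≈y)) xu≈1

  IsUnit-* : ∀ {x y} → IsUnit R x → IsUnit R y → IsUnit R (x * y)
  IsUnit-* {x} {y} (u , xu≈1) (v , yv≈1) = u * v , (begin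
    x * y * (u * v)    ≈⟨ solve 4 (λ x y u v → x :* y :* (u :* v) := x :* u :* (y :* v)) refl x y u v ⟩
    x * u * (y * v)    ≈⟨ *-cong xu≈1 yv≈1 ⟩
    1# * 1#            ≈⟨ *-identityˡ 1# ⟩
    1#                 ∎)

  IsUnit-^ : ∀ {x} j → IsUnit R x → IsUnit R (x ^ j)
  IsUnit-^ zero    u = 1# , *-identityˡ 1#
  IsUnit-^ (suc j) u = IsUnit-* u (IsUnit-^ j u)

-- q-series in a commutative ring

-- The sum of the progression b, b + d, ..., with j terms. It is the exponent of q in the leading
-- coefficient of (q^b x; q^d)_j as a polynomial in x.
arithSum : ℤ → ℤ → ℕ → ℤ
arithSum d b zero    = 0ℤ
arithSum d b (suc j) = b ℤ.+ d ℤ.* + j ℤ.+ arithSum d b j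

module QPowers (R : CommutativeRing 0ℓ 0ℓ) (q : CommutativeRing.Carrier R) (q-unit : IsUnit R q) where
  open CommutativeRing R hiding (zero)
  open IntegerCoefficients R public
  open Units R public
  open import Algebra.Properties.Ring ring public using (-0#≈0#)
  open import Algebra.Properties.CommutativeSemiring.Exp commutativeSemiring public
    using (_^_; ^-homo-*; ^-distrib-*; ^-congˡ; ^-congʳ)
  open import Relation.Binary.Reasoning.Setoid setoid

  private
    q⁻¹ : Carrier
    q⁻¹ = proj₁ q-unit

  e : ℤ → Carrier
  e (+ m)    = q ^ m
  e -[1+ m ] = q⁻¹ ^ suc m

  private
    e-⊖ : ∀ m n → e (m ℤ.⊖ n) ≈ q ^ m * q⁻¹ ^ n
    e-⊖ m zero = sym (*-identityʳ _)
    e-⊖ zero (suc n) = sym (*-identityˡ _)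
    e-⊖ (suc m) (suc n) = begin
      e (suc m ℤ.⊖ suc n)                 ≡⟨ ≡.cong e (ℤₚ.[1+m]⊖[1+n]≡m⊖n m n) ⟩
      e (m ℤ.⊖ n)                         ≈⟨ e-⊖ m n ⟩
      q ^ m * q⁻¹ ^ n                     ≈⟨ *-identityˡ _ ⟨
      1# * (q ^ m * q⁻¹ ^ n)              ≈⟨ *-congʳ (proj₂ q-unit) ⟨
      q * q⁻¹ * (q ^ m * q⁻¹ ^ n)
        ≈⟨ solve 4 (λ a b c f → a :* b :* (c :* f) := a :* c :* (b :* f)) refl q q⁻¹ (q ^ m) (q⁻¹ ^ n) ⟩
      q ^ suc m * q⁻¹ ^ suc n             ∎

  e-+ : ∀ i j → e (i ℤ.+ j) ≈ e i * e j
  e-+ (+ m) (+ n)       = ^-homo-* q m n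
  e-+ (+ m) -[1+ n ]    = e-⊖ m (suc n)
  e-+ -[1+ m ] (+ n)    = trans (e-⊖ n (suc m)) (*-comm _ _)
  e-+ -[1+ m ] -[1+ n ] = begin
    q⁻¹ ^ suc (suc (m ℕ.+ n))    ≡⟨ ≡.cong (q⁻¹ ^_) (≡.sym (ℕₚ.+-suc (suc m) n)) ⟩
    q⁻¹ ^ (suc m ℕ.+ suc n)      ≈⟨ ^-homo-* q⁻¹ (suc m) (suc n) ⟩
    q⁻¹ ^ suc m * q⁻¹ ^ suc n    ∎

  e-cong : ∀ {i j} → i ≡ j → e i ≈ e j
  e-cong i≡j = reflexive (≡.cong e i≡j)

  e-+′ : ∀ {i} j k → i ≡ j ℤ.+ k → e i ≈ e j * e k
  e-+′ j k eq = trans (e-cong eq) (e-+ j k)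

  [_] : ℤ → Carrier
  [ z ] = 1# - e z

  []-cong : ∀ {i j} → i ≡ j → [ i ] ≈ [ j ]
  []-cong i≡j = reflexive (≡.cong [_] i≡j)

  []-zero : ∀ {i} → i ≡ 0ℤ → [ i ] ≈ 0#
  []-zero ≡.refl = -‿inverseʳ 1#

  Σ< : ℕ → (ℕ → Carrier) → Carrier
  Σ< zero    f = 0#
  Σ< (suc n) f = f 0 + Σ< n (f ∘ suc)

  Σ<-cong : ∀ n {f g} → (∀ k → k ℕ.< n → f k ≈ g k) → Σ< n f ≈ Σ< n g
  Σ<-cong zero    f≈g = refl
  Σ<-cong (suc n) f≈g = +-cong (f≈g 0 ℕ.z<s) (Σ<-cong n (λ k k<n → f≈g (suc k) (ℕ.s<s k<n)))

  Σ<-distribʳ : ∀ n f c → Σ< n f * c ≈ Σ< n (λ k → f k * c)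
  Σ<-distribʳ zero    f c = zeroˡ c
  Σ<-distribʳ (suc n) f c = trans (distribʳ c _ _) (+-congˡ (Σ<-distribʳ n (f ∘ suc) c))

  Σ<-+ : ∀ n f g → Σ< n (λ k → f k + g k) ≈ Σ< n f + Σ< n g
  Σ<-+ zero    f g = sym (+-identityˡ 0#)
  Σ<-+ (suc n) f g = trans (+-congˡ (Σ<-+ n (f ∘ suc) (g ∘ suc)))
    (solve 4 (λ a b s t → a :+ b :+ (s :+ t) := (a :+ s) :+ (b :+ t)) refl _ _ _ _)

  Σ<-sub-scale : ∀ n f c g → Σ< n (λ k → f k - c * g k) ≈ Σ< n f - c * Σ< n g
  Σ<-sub-scale zero    f c g = solve 1 (λ c → con 0ℤ := con 0ℤ :- c :* con 0ℤ) refl c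
  Σ<-sub-scale (suc n) f c g = trans (+-congˡ (Σ<-sub-scale n (f ∘ suc) c (g ∘ suc)))
    (solve 5 (λ a b c s t → (a :- c :* b) :+ (s :- c :* t) := (a :+ s) :- c :* (b :+ t)) refl _ _ c _ _)

-- q-shifted factorials and the q-Karlsson-Minton and q-Chu-Vandermonde sums

module QPochhammer (R : CommutativeRing 0ℓ 0ℓ) (q : CommutativeRing.Carrier R) (q-unit : IsUnit R q) (d : ℤ) where
  open CommutativeRing R hiding (zero)
  open QPowers R q q-unit public
  open import Relation.Binary.Reasoning.Setoid setoid

  -- (q^a ; q^d)_k
  P : ℤ → ℕ → Carrier
  P a zero    = 1#
  P a (suc k) = P a k * [ a ℤ.+ d ℤ.* + k ]

  P-cong : ∀ {a b} k → a ≡ b → P a k ≈ P b k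
  P-cong k a≡b = reflexive (≡.cong (λ a → P a k) a≡b)

  P-+ : ∀ a j k → P a (j ℕ.+ k) ≈ P a j * P (a ℤ.+ d ℤ.* + j) k
  P-+ a j zero    = trans (reflexive (≡.cong (P a) (ℕₚ.+-identityʳ j))) (sym (*-identityʳ _))
  P-+ a j (suc k) = begin
    P a (j ℕ.+ suc k)                                          ≡⟨ ≡.cong (P a) (ℕₚ.+-suc j k) ⟩
    P a (j ℕ.+ k) * [ a ℤ.+ d ℤ.* + (j ℕ.+ k) ]                ≈⟨ *-cong (P-+ a j k) ([]-cong (ℤsolve 4
      (λ a d j k → a ⊕ d ⊗ (j ⊕ k) ≜ a ⊕ d ⊗ j ⊕ d ⊗ k) ≡.refl a d (+ j) (+ k))) ⟩
    P a j * P (a ℤ.+ d ℤ.* + j) k * [ a ℤ.+ d ℤ.* + j ℤ.+ d ℤ.* + k ]   ≈⟨ *-assoc _ _ _ ⟩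
    P a j * P (a ℤ.+ d ℤ.* + j) (suc k)                        ∎

  -- Both sides are (q^a;Q)_{j+k} with Q = q^d. Read as quotients, (q^a Q^j;Q)_k / (q^a;Q)_k equals
  -- (q^a Q^k;Q)_j / (q^a;Q)_j: a polynomial of degree j in Q^k over a constant.
  P-swap : ∀ a j k → P a j * P (a ℤ.+ d ℤ.* + j) k ≈ P a k * P (a ℤ.+ d ℤ.* + k) j
  P-swap a j k = begin
    P a j * P (a ℤ.+ d ℤ.* + j) k    ≈⟨ P-+ a j k ⟨
    P a (j ℕ.+ k)                    ≡⟨ ≡.cong (P a) (ℕₚ.+-comm j k) ⟩
    P a (k ℕ.+ j)                    ≈⟨ P-+ a k j ⟩
    P a k * P (a ℤ.+ d ℤ.* + k) j    ∎

  P-suc : ∀ a k → P a (suc k) ≈ [ a ] * P (a ℤ.+ d) k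
  P-suc a k = begin
    P a (1 ℕ.+ k)                                                 ≈⟨ P-+ a 1 k ⟩
    1# * [ a ℤ.+ d ℤ.* 0ℤ ] * P (a ℤ.+ d ℤ.* 1ℤ) k
      ≈⟨ *-cong (trans (*-identityˡ _) ([]-cong (≡.trans (≡.cong (λ z → a ℤ.+ z) (ℤₚ.*-zeroʳ d)) (ℤₚ.+-identityʳ a))))
                (P-cong k (≡.cong (λ z → a ℤ.+ z) (ℤₚ.*-identityʳ d))) ⟩
    [ a ] * P (a ℤ.+ d) k                                          ∎

  P-zero : ∀ a j k → a ℤ.+ d ℤ.* + j ≡ 0ℤ → j ℕ.< k → P a k ≈ 0#
  P-zero a j (suc k) eq j<1+k with j ℕ.≟ k
  ... | yes ≡.refl = trans (*-congˡ ([]-zero eq)) (zeroʳ _)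
  ... | no  j≢k    = trans (*-congʳ (P-zero a j k eq (ℕₚ.≤∧≢⇒< (ℕₚ.≤-pred j<1+k) j≢k))) (zeroˡ _)

  -- (Q^{-N} ; Q)_k Q^k / (Q ; Q)_k with Q = q^d, defined by a Pascal rule to avoid division.
  w : ℕ → ℕ → Carrier
  w zero    zero    = 1#
  w zero    (suc k) = 0#
  w (suc N) zero    = w N zero
  w (suc N) (suc k) = w N (suc k) - e (ℤ.- (d ℤ.* + N)) * w N k

  w-closed : ∀ N k → w N k * P d k ≈ P (ℤ.- (d ℤ.* + N)) k * e (d ℤ.* + k)
  w-closed zero    zero    = *-congˡ (e-cong (≡.sym (ℤₚ.*-zeroʳ d)))
  w-closed (suc N) zero    = w-closed N zero
  w-closed zero    (suc k) = trans (zeroˡ _) (sym (trans (*-congʳ (P-zero (ℤ.- (d ℤ.* 0ℤ)) 0 (suc k)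
    (ℤsolve 1 (λ d → ⊝ (d ⊗ κ 0ℤ) ⊕ d ⊗ κ 0ℤ ≜ κ 0ℤ) ≡.refl d) ℕ.z<s)) (zeroˡ _)))
  w-closed (suc N) (suc k) = begin
    (w N (suc k) - x * w N k) * (P d k * [ d ℤ.+ d ℤ.* + k ])
      ≈⟨ solve 5 (λ a x b p u → (a :- x :* b) :* (p :* u) := a :* (p :* u) :- x :* u :* (b :* p)) refl _ x _ _ _ ⟩
    w N (suc k) * P d (suc k) - x * [ d ℤ.+ d ℤ.* + k ] * (w N k * P d k)
      ≈⟨ +-cong (w-closed N (suc k)) (-‿cong (*-congˡ (w-closed N k))) ⟩
    p * [ a ℤ.+ d ℤ.* + k ] * e (d ℤ.* (1ℤ ℤ.+ + k)) - x * [ d ℤ.+ d ℤ.* + k ] * (p * y)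
      ≈⟨ +-cong (*-cong (*-congˡ (+-congˡ (-‿cong (e-+ a _)))) dk) (-‿cong (*-congʳ (*-congˡ (+-congˡ (-‿cong (e-+ d _)))))) ⟩
    p * (1# - x * y) * (e d * y) - x * (1# - e d * y) * (p * y)
      ≈⟨ solve 4 (λ p x y d → p :* (con 1ℤ :- x :* y) :* (d :* y) :- x :* (con 1ℤ :- d :* y) :* (p :* y)
                    := (d :- x) :* p :* y) refl p x y (e d) ⟩
    (e d - x) * p * y
      ≈⟨ *-congʳ (*-congʳ (+-congˡ (-‿cong (e-+′ a′ d (ℤsolve 2 (λ d N → ⊝ (d ⊗ N) ≜
            ⊝ (d ⊗ (κ 1ℤ ⊕ N)) ⊕ d) ≡.refl d (+ N)))))) ⟩
    (e d - e a′ * e d) * p * y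
      ≈⟨ solve 4 (λ d a p y → (d :- a :* d) :* p :* y := (con 1ℤ :- a) :* p :* (d :* y)) refl (e d) (e a′) p y ⟩
    [ a′ ] * p * (e d * y)
      ≈⟨ *-cong (trans (*-congˡ (P-cong k (ℤsolve 2 (λ d N → ⊝ (d ⊗ N) ≜
            ⊝ (d ⊗ (κ 1ℤ ⊕ N)) ⊕ d) ≡.refl d (+ N)))) (sym (P-suc a′ k))) (sym dk) ⟩
    P a′ (suc k) * e (d ℤ.* (1ℤ ℤ.+ + k))  ∎
    where
    a = ℤ.- (d ℤ.* + N)
    a′ = ℤ.- (d ℤ.* (1ℤ ℤ.+ + N))
    x = e a
    y = e (d ℤ.* + k)
    p = P a k
    dk : e (d ℤ.* (1ℤ ℤ.+ + k)) ≈ e d * y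
    dk = e-+′ d (d ℤ.* + k) (≡.trans (ℤₚ.*-distribˡ-+ d 1ℤ (+ k)) (≡.cong (λ z → z ℤ.+ d ℤ.* + k) (ℤₚ.*-identityʳ d)))

  T : ℕ → (ℕ → Carrier) → Carrier
  T zero    f = f 0
  T (suc N) f = T N f - e (ℤ.- (d ℤ.* + N)) * T N (f ∘ suc)

  T-cong : ∀ N {f g} → (∀ k → f k ≈ g k) → T N f ≈ T N g
  T-cong zero    f≈g = f≈g 0
  T-cong (suc N) f≈g = +-cong (T-cong N f≈g) (-‿cong (*-congˡ (T-cong N (f≈g ∘ suc))))

  T-sub-scale : ∀ N f c g → T N (λ k → f k - c * g k) ≈ T N f - c * T N g
  T-sub-scale zero    f c g = refl
  T-sub-scale (suc N) f c g = trans
    (+-cong (T-sub-scale N f c g) (-‿cong (*-congˡ (T-sub-scale N (f ∘ suc) c (g ∘ suc)))))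
    (solve 6 (λ a b c x s t → (a :- c :* b) :- x :* (s :- c :* t) := (a :- x :* s) :- c :* (b :- x :* t)) refl _ _ c _ _ _)

  T-scale : ∀ N c f → T N (λ k → c * f k) ≈ c * T N f
  T-scale zero    c f = refl
  T-scale (suc N) c f = trans
    (+-cong (T-scale N c f) (-‿cong (*-congˡ (T-scale N c (f ∘ suc)))))
    (solve 4 (λ c a x s → c :* a :- x :* (c :* s) := c :* (a :- x :* s)) refl c _ _ _)

  -- The Pascal rule of `w` is the recursion of `T` transposed. Every K > N gives the same value
  -- because `w N k` vanishes for k > N.
  Σ-w : ∀ N K f → N ℕ.< K → Σ< K (λ k → w N k * f k) ≈ T N f
  Σ-w zero (suc K) f _ = trans (+-cong (*-identityˡ _) (vanish K (f ∘ suc))) (+-identityʳ _)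
    where
    vanish : ∀ K (g : ℕ → Carrier) → Σ< K (λ k → 0# * g k) ≈ 0#
    vanish zero    g = refl
    vanish (suc K) g = trans (+-cong (zeroˡ _) (vanish K (g ∘ suc))) (+-identityˡ _)
  Σ-w (suc N) (suc K) f (ℕ.s≤s N<K) = begin
    w N 0 * f 0 + Σ< K (λ k → (w N (suc k) - x * w N k) * f (suc k))
      ≈⟨ +-congˡ (Σ<-cong K {g = λ k → w N (suc k) * f (suc k) - x * (w N k * f (suc k))} (λ k _ → solve 4 (λ a x b f → (a :- x :* b) :* f := a :* f :- x :* (b :* f)) refl _ x _ (f (suc k)))) ⟩
    w N 0 * f 0 + Σ< K (λ k → w N (suc k) * f (suc k) - x * (w N k * f (suc k)))
      ≈⟨ +-congˡ (Σ<-sub-scale K _ x _) ⟩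
    w N 0 * f 0 + (Σ< K (λ k → w N (suc k) * f (suc k)) - x * Σ< K (λ k → w N k * f (suc k)))
      ≈⟨ +-assoc _ _ _ ⟨
    Σ< (suc K) (λ k → w N k * f k) - x * Σ< K (λ k → w N k * f (suc k))
      ≈⟨ +-cong (Σ-w N (suc K) f (ℕ.s≤s (ℕₚ.<⇒≤ N<K))) (-‿cong (*-congˡ (Σ-w N K (f ∘ suc) N<K))) ⟩
    T (suc N) f ∎
    where x = e (ℤ.- (d ℤ.* + N))

  X^ : ℕ → ℕ → Carrier
  X^ s k = e (d ℤ.* (+ k ℤ.* + s))

  T-X^-suc : ∀ N s → T (suc N) (X^ s) ≈ [ d ℤ.* (+ s ℤ.- + N) ] * T N (X^ s)
  T-X^-suc N s = begin
    T N (X^ s) - x * T N (X^ s ∘ suc)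
      ≈⟨ +-congˡ (-‿cong (*-congˡ (trans (T-cong N shift) (T-scale N y (X^ s))))) ⟩
    T N (X^ s) - x * (y * T N (X^ s))
      ≈⟨ solve 3 (λ x y t → t :- x :* (y :* t) := (con 1ℤ :- x :* y) :* t) refl x y _ ⟩
    (1# - x * y) * T N (X^ s)
      ≈⟨ *-congʳ (+-congˡ (-‿cong (e-+′ (ℤ.- (d ℤ.* + N)) (d ℤ.* + s) (ℤsolve 3 (λ d s N → d ⊗ (s ⊝ N) ≜ ⊝ (d ⊗ N) ⊕ d ⊗ s) ≡.refl d (+ s) (+ N))))) ⟨
    [ d ℤ.* (+ s ℤ.- + N) ] * T N (X^ s) ∎
    where
    x = e (ℤ.- (d ℤ.* + N))
    y = e (d ℤ.* + s)
    shift : ∀ k → X^ s (suc k) ≈ y * X^ s k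
    shift k = e-+′ (d ℤ.* + s) (d ℤ.* (+ k ℤ.* + s)) (ℤsolve 3 (λ d s k → d ⊗ ((κ 1ℤ ⊕ k) ⊗ s) ≜ d ⊗ s ⊕ d ⊗ (k ⊗ s)) ≡.refl d (+ s) (+ k))

  T-X^-low : ∀ N s → s ℕ.< N → T N (X^ s) ≈ 0#
  T-X^-low (suc N) s s<1+N with s ℕ.≟ N
  ... | yes ≡.refl = trans (T-X^-suc N N) (trans (*-congʳ ([]-zero
          (≡.trans (≡.cong (λ z → d ℤ.* z) (ℤₚ.+-inverseʳ (+ N))) (ℤₚ.*-zeroʳ d)))) (zeroˡ _))
  ... | no  s≢N    = trans (T-X^-suc N s)
          (trans (*-congˡ (T-X^-low N s (ℕₚ.≤∧≢⇒< (ℕₚ.≤-pred s<1+N) s≢N))) (zeroʳ _))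

  -- The eigenvalues multiply to (1 - Q^{t+1}) ... (1 - Q^{t+N}). The surplus t keeps the exponent N
  -- + t fixed while the induction lowers N; the application has t = 0.
  T-X^-high : ∀ N t → T N (X^ (N ℕ.+ t)) * P d t ≈ P d (N ℕ.+ t)
  T-X^-high zero    t = trans (*-congʳ (e-cong (ℤₚ.*-zeroʳ d))) (*-identityˡ _)
  T-X^-high (suc N) t = begin
    T (suc N) (X^ (suc N ℕ.+ t)) * P d t
      ≈⟨ *-congʳ (T-X^-suc N (suc N ℕ.+ t)) ⟩
    [ d ℤ.* (+ (suc N ℕ.+ t) ℤ.- + N) ] * T N (X^ (suc N ℕ.+ t)) * P d t
      ≈⟨ *-congʳ (*-congʳ ([]-cong (ℤsolve 3 (λ d N t → d ⊗ ((κ 1ℤ ⊕ (N ⊕ t)) ⊝ N) ≜ d ⊕ d ⊗ t) ≡.refl d (+ N) (+ t)))) ⟩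
    [ d ℤ.+ d ℤ.* + t ] * T N (X^ (suc N ℕ.+ t)) * P d t
      ≈⟨ solve 3 (λ a b c → a :* b :* c := b :* (c :* a)) refl _ _ _ ⟩
    T N (X^ (suc N ℕ.+ t)) * P d (suc t)
      ≡⟨ ≡.cong (λ s → T N (X^ s) * P d (suc t)) (≡.sym (ℕₚ.+-suc N t)) ⟩
    T N (X^ (N ℕ.+ suc t)) * P d (suc t)   ≈⟨ T-X^-high N (suc t) ⟩
    P d (N ℕ.+ suc t)                      ≡⟨ ≡.cong (P d) (ℕₚ.+-suc N t) ⟩
    P d (suc N ℕ.+ t)                      ∎

  -- Lin M z g: as a function of x = q^{dk}, g is a product of M factors 1 - q^b x, and z is the sum of the b.
  data Lin : ℕ → ℤ → (ℕ → Carrier) → Set where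
    one    : Lin 0 0ℤ (λ _ → 1#)
    factor : ∀ {M z g} b → Lin M z g → Lin (suc M) (b ℤ.+ z) (λ k → [ b ℤ.+ d ℤ.* + k ] * g k)
    resp   : ∀ {M z g h} → (∀ k → g k ≈ h k) → Lin M z g → Lin M z h

  Lin-cong : ∀ {M M′ z z′ g h} → M ≡ M′ → z ≡ z′ → (∀ k → g k ≈ h k) → Lin M z g → Lin M′ z′ h
  Lin-cong ≡.refl ≡.refl g≈h l = resp g≈h l

  private
    peel : ∀ N s b (g : ℕ → Carrier) → T N (λ k → X^ s k * ([ b ℤ.+ d ℤ.* + k ] * g k)) ≈
                       T N (λ k → X^ s k * g k) - e b * T N (λ k → X^ (suc s) k * g k)
    peel N s b g = trans (T-cong N {g = λ k → X^ s k * g k - e b * (X^ (suc s) k * g k)} (λ k → trans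
        (*-congˡ (*-congʳ (+-congˡ (-‿cong (e-+ b _)))))
        (trans (solve 4 (λ x b y g → x :* ((con 1ℤ :- b :* y) :* g) := x :* g :- b :* (y :* x :* g)) refl _ _ (e (d ℤ.* + k)) (g k))
          (+-congˡ (-‿cong (*-congˡ (*-congʳ (sym (e-+′ (d ℤ.* + k) (d ℤ.* (+ k ℤ.* + s)) (ℤsolve 3 (λ d k s →
             d ⊗ (k ⊗ (κ 1ℤ ⊕ s)) ≜ d ⊗ k ⊕ d ⊗ (k ⊗ s)) ≡.refl d (+ k) (+ s)))))))))))
      (T-sub-scale N (λ k → X^ s k * g k) (e b) (λ k → X^ (suc s) k * g k))

  -- The power `X^ s` collects the monomials already split off, so s + M is the degree in Q^k.
  -- Splitting 1 - q^b Q^k either drops a factor or trades it for one more power, and the degree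
  -- never grows.
  T-Lin-low : ∀ {M z g} N s → Lin M z g → s ℕ.+ M ℕ.< N → T N (λ k → X^ s k * g k) ≈ 0#
  T-Lin-low N s one s+0<N = trans (T-cong N (λ k → *-identityʳ (X^ s k)))
    (T-X^-low N s (≡.subst (ℕ._< N) (ℕₚ.+-identityʳ s) s+0<N))
  T-Lin-low N s (resp g≈h l) lt = trans (T-cong N (λ k → *-congˡ (sym (g≈h k)))) (T-Lin-low N s l lt)
  T-Lin-low {suc M} N s (factor {g = g} b l) lt = trans (peel N s b g) (trans
    (+-cong (T-Lin-low N s l (ℕₚ.<⇒≤ lt′)) (-‿cong (*-congˡ (T-Lin-low N (suc s) l lt′))))
    (solve 1 (λ b → con 0ℤ :- b :* con 0ℤ := con 0ℤ) refl (e b)))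
    where
    lt′ : suc s ℕ.+ M ℕ.< N
    lt′ = ≡.subst (ℕ._< N) (ℕₚ.+-suc s M) lt

  -- Of the two parts of a factor 1 - q^b Q^k, the constant 1 brings the degree below N and
  -- contributes nothing. Only -q^b Q^k survives, and the product of all the -q^b is the sign and
  -- the power of q on the right.
  T-Lin-top : ∀ {M z g} N s → Lin M z g → s ℕ.+ M ≡ N →
              T N (λ k → X^ s k * g k) ≈ (- 1#) ^ M * e z * P d N
  T-Lin-top N s one s+0≡N = trans (T-cong N (λ k → *-identityʳ (X^ s k))) (begin
    T N (X^ s)                  ≡⟨ ≡.cong (λ s → T N (X^ s)) s≡N+0 ⟩
    T N (X^ (N ℕ.+ 0))          ≈⟨ *-identityʳ _ ⟨
    T N (X^ (N ℕ.+ 0)) * P d 0  ≈⟨ T-X^-high N 0 ⟩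
    P d (N ℕ.+ 0)               ≡⟨ ≡.cong (P d) (ℕₚ.+-identityʳ N) ⟩
    P d N                       ≈⟨ *-identityˡ _ ⟨
    1# * P d N                  ≈⟨ *-congʳ (*-identityˡ _) ⟨
    1# * 1# * P d N             ∎)
    where
    s≡N+0 : s ≡ N ℕ.+ 0
    s≡N+0 = ≡.trans (≡.sym (ℕₚ.+-identityʳ s)) (≡.trans s+0≡N (≡.sym (ℕₚ.+-identityʳ N)))
  T-Lin-top N s (resp g≈h l) eq = trans (T-cong N (λ k → *-congˡ (sym (g≈h k)))) (T-Lin-top N s l eq)
  T-Lin-top {suc M} N s (factor {z = z} {g} b l) eq = trans (peel N s b g) (begin
    T N (λ k → X^ s k * g k) - e b * T N (λ k → X^ (suc s) k * g k)
      ≈⟨ +-cong (T-Lin-low N s l (ℕₚ.≤-reflexive eq′)) (-‿cong (*-congˡ (T-Lin-top N (suc s) l eq′))) ⟩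
    0# - e b * ((- 1#) ^ M * e z * P d N)
      ≈⟨ solve 4 (λ b m z p → con 0ℤ :- b :* (m :* z :* p) := (:- con 1ℤ) :* m :* (b :* z) :* p) refl _ _ _ _ ⟩
    - 1# * (- 1#) ^ M * (e b * e z) * P d N
      ≈⟨ *-congʳ (*-congˡ (e-+ b z)) ⟨
    (- 1#) ^ suc M * e (b ℤ.+ z) * P d N ∎)
    where
    eq′ : suc s ℕ.+ M ≡ N
    eq′ = ≡.trans (≡.sym (ℕₚ.+-suc s M)) eq

  karlsson-minton : ∀ {N z g} K → Lin N z g → N ℕ.< K →
                    Σ< K (λ k → w N k * g k) ≈ (- 1#) ^ N * e z * P d N
  karlsson-minton {N} {z} {g} K l N<K = begin
    Σ< K (λ k → w N k * g k)      ≈⟨ Σ-w N K g N<K ⟩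
    T N g                         ≈⟨ T-cong N (λ k → trans (sym (*-identityˡ _)) (*-congʳ (e-cong (≡.sym (≡.trans (≡.cong (λ z → d ℤ.* z) (ℤₚ.*-zeroʳ (+ k))) (ℤₚ.*-zeroʳ d)))))) ⟩
    T N (λ k → X^ 0 k * g k)      ≈⟨ T-Lin-top N 0 l ≡.refl ⟩
    (- 1#) ^ N * e z * P d N      ∎

  Lin-P : ∀ b j {M z h} → Lin M z h → Lin (j ℕ.+ M) (arithSum d b j ℤ.+ z) (λ k → P (b ℤ.+ d ℤ.* + k) j * h k)
  Lin-P b zero    {z = z} l = Lin-cong ≡.refl (≡.sym (ℤₚ.+-identityˡ z)) (λ k → sym (*-identityˡ _)) l
  Lin-P b (suc j) {z = z} {h} l = Lin-cong ≡.refl (≡.sym (ℤₚ.+-assoc (b ℤ.+ d ℤ.* + j) (arithSum d b j) z))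
    (λ k → trans (*-congʳ ([]-cong (ℤsolve 4 (λ b d j k → b ⊕ d ⊗ j ⊕ d ⊗ k ≜ b ⊕ d ⊗ k ⊕ d ⊗ j) ≡.refl b d (+ j) (+ k))))
                 (solve 3 (λ u p h → u :* (p :* h) := p :* u :* h) refl _ _ (h k)))
    (factor (b ℤ.+ d ℤ.* + j) (Lin-P b j l))

  Lin-P^ : ∀ b j i {M z h} → Lin M z h →
           Lin (i ℕ.* j ℕ.+ M) (+ i ℤ.* arithSum d b j ℤ.+ z) (λ k → P (b ℤ.+ d ℤ.* + k) j ^ i * h k)
  Lin-P^ b j zero    {z = z} l = Lin-cong ≡.refl
    (ℤsolve 2 (λ p z → z ≜ κ 0ℤ ⊗ p ⊕ z) ≡.refl (arithSum d b j) z) (λ k → sym (*-identityˡ _)) l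
  Lin-P^ b j (suc i) {M} {z} {h} l = Lin-cong (≡.sym (ℕₚ.+-assoc j (i ℕ.* j) M))
    (ℤsolve 3 (λ p i z → p ⊕ (i ⊗ p ⊕ z) ≜ (κ 1ℤ ⊕ i) ⊗ p ⊕ z) ≡.refl (arithSum d b j) (+ i) z)
    (λ k → sym (*-assoc _ _ (h k))) (Lin-P b j (Lin-P^ b j i l))

  -- The case g(Q^k) = (Q^{k+1};Q)_M of `karlsson-minton`: by `P-swap`, (Q^{M+1};Q)_k / (Q;Q)_k is
  -- g(Q^k) / (Q;Q)_M. The summand is given by an equation instead of a quotient, since the ring has
  -- no division.
  chu-vandermonde : ∀ M K → M ℕ.< K → (∀ k → k ℕ.< K → IsUnit R (P d k)) → ∀ t →
    (∀ k → k ℕ.< K → t k * (P d k * P d k) ≈ P (ℤ.- (d ℤ.* + M)) k * P (d ℤ.+ d ℤ.* + M) k * e (d ℤ.* + k)) →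
    Σ< K t ≈ (- 1#) ^ M * e (arithSum d d M)
  chu-vandermonde M K M<K P-unit t t-def = IsUnit-cancelˡ (P-unit M M<K) (begin
    P d M * Σ< K t                                    ≈⟨ *-comm _ _ ⟩
    Σ< K t * P d M                                    ≈⟨ Σ<-distribʳ K t (P d M) ⟩
    Σ< K (λ k → t k * P d M)                          ≈⟨ Σ<-cong K term ⟩
    Σ< K (λ k → w M k * P (d ℤ.+ d ℤ.* + k) M)        ≈⟨ karlsson-minton K
      (Lin-cong (ℕₚ.+-identityʳ M) (ℤₚ.+-identityʳ (arithSum d d M)) (λ k → *-identityʳ _) (Lin-P d M one)) M<K ⟩
    (- 1#) ^ M * e (arithSum d d M) * P d M           ≈⟨ *-comm _ _ ⟩
    P d M * ((- 1#) ^ M * e (arithSum d d M))         ∎)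
    where
    term : ∀ k → k ℕ.< K → t k * P d M ≈ w M k * P (d ℤ.+ d ℤ.* + k) M
    term k k<K = IsUnit-cancelˡ (P-unit k k<K) (IsUnit-cancelˡ (P-unit k k<K) (begin
      u * (u * (t k * P d M))                  ≈⟨ solve 3 (λ u t p → u :* (u :* (t :* p)) := t :* (u :* u) :* p) refl u (t k) (P d M) ⟩
      t k * (u * u) * P d M                    ≈⟨ *-congʳ (t-def k k<K) ⟩
      a * b * x * P d M                        ≈⟨ solve 4 (λ a b x p → a :* b :* x :* p := (a :* x) :* (p :* b)) refl a b x (P d M) ⟩
      (a * x) * (P d M * b)                    ≈⟨ *-cong (sym (w-closed M k)) (P-swap d M k) ⟩
      w M k * u * (u * P (d ℤ.+ d ℤ.* + k) M)  ≈⟨ solve 3 (λ w u p → w :* u :* (u :* p) := u :* (u :* (w :* p))) refl (w M k) u _ ⟩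
      u * (u * (w M k * P (d ℤ.+ d ℤ.* + k) M))  ∎))
      where
      u = P d k
      a = P (ℤ.- (d ℤ.* + M)) k
      b = P (d ℤ.+ d ℤ.* + M) k
      x = e (d ℤ.* + k)

-- Shifting exponents by multiples of n when (1 - q^n)² = 0

module Perturbation (R : CommutativeRing 0ℓ 0ℓ) (q : CommutativeRing.Carrier R) (q-unit : IsUnit R q) (d : ℤ) (n : ℤ) where
  open CommutativeRing R hiding (zero)
  open QPochhammer R q q-unit d public
  open import Relation.Binary.Reasoning.Setoid setoid

  private
    η : Carrier
    η = [ n ]

  module _ (η*η≈0 : [ n ] * [ n ] ≈ 0#) where

    private
      drop-η² : ∀ x y → x + y * (η * η) ≈ x
      drop-η² x y = trans (+-congˡ (trans (*-congˡ η*η≈0) (zeroʳ y))) (+-identityʳ x)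

      e-multiple⁺ : ∀ c → e (+ c ℤ.* n) ≈ 1# - fromℤ (+ c) * η
      e-multiple⁺ zero = sym (trans (+-congˡ (trans (-‿cong (zeroˡ η)) -0#≈0#)) (+-identityʳ 1#))
      e-multiple⁺ (suc c) = begin
        e (+ suc c ℤ.* n)
          ≈⟨ e-+′ n (+ c ℤ.* n) (ℤsolve 2 (λ c n → (κ 1ℤ ⊕ c) ⊗ n ≜ n ⊕ c ⊗ n) ≡.refl (+ c) n) ⟩
        e n * e (+ c ℤ.* n)
          ≈⟨ *-congˡ (e-multiple⁺ c) ⟩
        e n * (1# - C * η)
          ≈⟨ solve 2 (λ x c → x :* (con 1ℤ :- c :* (con 1ℤ :- x)) :=
               con 1ℤ :- (con 1ℤ :+ c) :* (con 1ℤ :- x) :+ c :* ((con 1ℤ :- x) :* (con 1ℤ :- x))) refl (e n) C ⟩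
        1# - (1# + C) * η + C * (η * η)
          ≈⟨ drop-η² _ C ⟩
        1# - (1# + C) * η
          ≈⟨ +-congˡ (-‿cong (*-congʳ (fromℤ-+ 1ℤ (+ c)))) ⟨
        1# - fromℤ (+ suc c) * η  ∎
        where C = fromℤ (+ c)

      e-multiple : ∀ c → e (c ℤ.* n) ≈ 1# - fromℤ c * η
      e-multiple (+ c)      = e-multiple⁺ c
      e-multiple c@(-[1+ c′ ]) = begin
        e (c ℤ.* n)
          ≈⟨ drop-η² (e (c ℤ.* n)) (- (e (c ℤ.* n) * C * C)) ⟨
        e (c ℤ.* n) + - (e (c ℤ.* n) * C * C) * (η * η)
          ≈⟨ solve 3 (λ x c h → x :+ :- (x :* c :* c) :* (h :* h) := x :* (con 1ℤ :- c :* h) :* (con 1ℤ :+ c :* h)) refl (e (c ℤ.* n)) C η ⟩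
        e (c ℤ.* n) * (1# - C * η) * (1# + C * η)
          ≈⟨ *-congʳ (*-congˡ (e-multiple⁺ (suc c′))) ⟨
        e (c ℤ.* n) * e (+ suc c′ ℤ.* n) * (1# + C * η)
          ≈⟨ *-congʳ (e-+′ (c ℤ.* n) (+ suc c′ ℤ.* n) (ℤsolve 2 (λ c n → κ 0ℤ ≜ ⊝ c ⊗ n ⊕ c ⊗ n) ≡.refl (+ suc c′) n)) ⟨
        1# * (1# + C * η)
          ≈⟨ solve 2 (λ c h → con 1ℤ :* (con 1ℤ :+ c :* h) := con 1ℤ :- :- c :* h) refl C η ⟩
        1# - - C * η  ∎
        where C = fromℤ (+ suc c′)

    -- The coefficient of cη in (q^{a+cn};Q)_k, built by the Leibniz rule from 1 - q^{b+cn} = (1 -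
    -- q^b) + c η q^b.
    slope : ℤ → ℕ → Carrier
    slope a zero    = 0#
    slope a (suc k) = slope a k * [ a ℤ.+ d ℤ.* + k ] + P a k * e (a ℤ.+ d ℤ.* + k)

    P-affine : ∀ a c k → P (a ℤ.+ c ℤ.* n) k ≈ P a k + fromℤ c * (η * slope a k)
    P-affine a c zero    = sym (trans (+-congˡ (trans (*-congˡ (zeroʳ η)) (zeroʳ _))) (+-identityʳ 1#))
    P-affine a c (suc k) = begin
      P (a ℤ.+ c ℤ.* n) k * [ a ℤ.+ c ℤ.* n ℤ.+ d ℤ.* + k ]
        ≈⟨ *-cong (P-affine a c k) (+-congˡ (-‿cong (trans
             (e-+′ (a ℤ.+ d ℤ.* + k) (c ℤ.* n) (ℤsolve 3 (λ a x y → a ⊕ x ⊕ y ≜ a ⊕ y ⊕ x) ≡.refl a (c ℤ.* n) (d ℤ.* + k)))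
             (*-congˡ (e-multiple c))))) ⟩
      (F + C * (η * S)) * (1# - y * (1# - C * η))
        ≈⟨ solve 5 (λ f c h s y → (f :+ c :* (h :* s)) :* (con 1ℤ :- y :* (con 1ℤ :- c :* h)) :=
             f :* (con 1ℤ :- y) :+ c :* (h :* (s :* (con 1ℤ :- y) :+ f :* y)) :+ c :* c :* s :* y :* (h :* h)) refl F C η S y ⟩
      F * (1# - y) + C * (η * (S * (1# - y) + F * y)) + C * C * S * y * (η * η)
        ≈⟨ drop-η² _ _ ⟩
      P a (suc k) + C * (η * slope a (suc k))  ∎
      where
      F = P a k
      S = slope a k
      C = fromℤ c
      y = e (a ℤ.+ d ℤ.* + k)

    P-pair : ∀ a c k → P (a ℤ.+ c ℤ.* n) k * P (a ℤ.+ ℤ.- c ℤ.* n) k ≈ P a k * P a k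
    P-pair a c k = begin
      P (a ℤ.+ c ℤ.* n) k * P (a ℤ.+ ℤ.- c ℤ.* n) k
        ≈⟨ *-cong (P-affine a c k) (trans (P-affine a (ℤ.- c) k) (+-congˡ (*-congʳ (fromℤ-neg c)))) ⟩
      (F + C * (η * S)) * (F + - C * (η * S))
        ≈⟨ solve 4 (λ f c h s → (f :+ c :* (h :* s)) :* (f :+ :- c :* (h :* s)) := f :* f :+ :- (c :* c :* s :* s) :* (h :* h)) refl F C η S ⟩
      F * F + - (C * C * S * S) * (η * η)
        ≈⟨ drop-η² _ _ ⟩
      F * F ∎
      where
      F = P a k
      S = slope a k
      C = fromℤ c

    -- The shift is moved one unit at a time: a base shifted by (c+1)n together with one shifted by
    -- -n is worth an unshifted base together with one shifted by cn.
    P-spread : ∀ a c k → P (a ℤ.+ + c ℤ.* n) k * P (a ℤ.+ -1ℤ ℤ.* n) k ^ c ≈ P a k ^ suc c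
    P-spread a zero    k = *-congʳ (P-cong k (ℤsolve 2 (λ a n → a ⊕ κ 0ℤ ⊗ n ≜ a) ≡.refl a n))
    P-spread a (suc c) k = begin
      P (a ℤ.+ + suc c ℤ.* n) k * (P (a ℤ.+ -1ℤ ℤ.* n) k * P (a ℤ.+ -1ℤ ℤ.* n) k ^ c)
        ≈⟨ *-assoc _ _ _ ⟨
      P (a ℤ.+ + suc c ℤ.* n) k * P (a ℤ.+ -1ℤ ℤ.* n) k * P (a ℤ.+ -1ℤ ℤ.* n) k ^ c
        ≈⟨ *-congʳ step ⟩
      F * P (a ℤ.+ + c ℤ.* n) k * P (a ℤ.+ -1ℤ ℤ.* n) k ^ c
        ≈⟨ *-assoc _ _ _ ⟩
      F * (P (a ℤ.+ + c ℤ.* n) k * P (a ℤ.+ -1ℤ ℤ.* n) k ^ c)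
        ≈⟨ *-congˡ (P-spread a c k) ⟩
      F * F ^ suc c ∎
      where
      F = P a k
      S = slope a k
      C = fromℤ (+ c)
      step : P (a ℤ.+ + suc c ℤ.* n) k * P (a ℤ.+ -1ℤ ℤ.* n) k ≈ F * P (a ℤ.+ + c ℤ.* n) k
      step = begin
        P (a ℤ.+ + suc c ℤ.* n) k * P (a ℤ.+ -1ℤ ℤ.* n) k
          ≈⟨ *-cong (trans (P-affine a (+ suc c) k) (+-congˡ (*-congʳ (fromℤ-+ 1ℤ (+ c))))) (P-affine a -1ℤ k) ⟩
        (F + (1# + C) * (η * S)) * (F + - 1# * (η * S))
          ≈⟨ solve 4 (λ f c h s → (f :+ (con 1ℤ :+ c) :* (h :* s)) :* (f :+ :- con 1ℤ :* (h :* s)) :=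
               f :* (f :+ c :* (h :* s)) :+ :- ((con 1ℤ :+ c) :* s :* s) :* (h :* h)) refl F C η S ⟩
        F * (F + C * (η * S)) + - ((1# + C) * S * S) * (η * η)
          ≈⟨ drop-η² _ _ ⟩
        F * (F + C * (η * S))
          ≈⟨ *-congˡ (P-affine a (+ c) k) ⟨
        F * P (a ℤ.+ + c ℤ.* n) k ∎

    -- The bases a and b have unrelated slopes, so opposite shifts do not cancel within one product.
    -- The terms linear in η cancel only between the two signs.
    P-mean : ∀ a b k → P (a ℤ.+ 1ℤ ℤ.* n) k * P (b ℤ.+ -1ℤ ℤ.* n) k + P (a ℤ.+ -1ℤ ℤ.* n) k * P (b ℤ.+ 1ℤ ℤ.* n) k ≈
                       fromℤ (+ 2) * (P a k * P b k)
    P-mean a b k = begin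
      _ ≈⟨ +-cong (*-cong (P-affine a 1ℤ k) (P-affine b -1ℤ k)) (*-cong (P-affine a -1ℤ k) (P-affine b 1ℤ k)) ⟩
      (F + 1# * (η * S)) * (G + - 1# * (η * U)) + (F + - 1# * (η * S)) * (G + 1# * (η * U))
        ≈⟨ solve 5 (λ f g h s u → (f :+ con 1ℤ :* (h :* s)) :* (g :+ :- con 1ℤ :* (h :* u)) :+ (f :+ :- con 1ℤ :* (h :* s)) :* (g :+ con 1ℤ :* (h :* u)) :=
               con (+ 2) :* (f :* g) :+ :- (con (+ 2) :* (s :* u)) :* (h :* h)) refl F G η S U ⟩
      fromℤ (+ 2) * (F * G) + - (fromℤ (+ 2) * (S * U)) * (η * η)
        ≈⟨ drop-η² _ _ ⟩
      fromℤ (+ 2) * (F * G) ∎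
      where
      F = P a k
      G = P b k
      S = slope a k
      U = slope b k

-- The case d ≥ r + 2

module GenericParameters (r′ s m′ : ℕ) where
  -- In the notation of the theorem, m = (n + r)/d, N = n − 1 − m and c = d − 2.
  r d m N n c : ℕ
  r = suc r′
  d = 3 ℕ.+ (r′ ℕ.+ s)
  m = 2 ℕ.+ m′
  -- Here s = d - r - 2 counts the factors with base q^{d+r} beyond the two that are shifted. N is
  -- spelled as the sum of the degrees of the blocks of the polynomial `g`, ending with the 0 of the
  -- empty product, so that it matches the index of `Lin` definitionally.
  N = m ℕ.+ (s ℕ.* m ℕ.+ (r′ ℕ.* suc m′ ℕ.+ (m′ ℕ.+ 0)))
  n = suc (N ℕ.+ m)
  c = suc (r′ ℕ.+ s)

  n+r≡d*m : n ℕ.+ r ≡ d ℕ.* m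
  n+r≡d*m = solve 3 (λ r s m → let M = con 2 :+ m in
      con 1 :+ (M :+ (s :* M :+ (r :* (con 1 :+ m) :+ (m :+ con 0))) :+ M) :+ (con 1 :+ r) :=
      (con 3 :+ (r :+ s)) :* M) ≡.refl r′ s m′
    where open ℕ-Solver

  +n≡ : + n ≡ (+ 3 ℤ.+ (+ r′ ℤ.+ + s)) ℤ.* (+ 2 ℤ.+ + m′) ℤ.- (1ℤ ℤ.+ + r′)
  +n≡ = ≡.trans (ℤsolve 2 (λ n r → n ≜ n ⊕ r ⊝ r) ≡.refl (+ n) (+ r))
            (≡.cong (λ z → z ℤ.- + r) (≡.trans (≡.cong +_ n+r≡d*m) (ℤₚ.pos-* d m)))

  +N≡ : + N ≡ + n ℤ.- 1ℤ ℤ.- + m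
  +N≡ = ℤsolve 2 (λ N m → N ≜ (κ 1ℤ ⊕ (N ⊕ m)) ⊝ κ 1ℤ ⊝ m) ≡.refl (+ N) (+ m)

  -- One of the d numerator factors is moved to (Q^{-N} ; Q)_k, which leaves d − 1 quotients (q^b Q^j ; Q)_k / (q^b ; Q)_k.
  -- One of them has b = b₁, the others b = b₂.  The multiples of n added to the exponents sum to 0 over the factors
  -- with numerator q^{d+r}, and over the denominators.
  b₁ b₂ : ℤ
  b₁ = + d ℤ.+ + c ℤ.* + n
  b₂ = + d ℤ.+ -1ℤ ℤ.* + n

  b₂+dm : b₂ ℤ.+ + d ℤ.* + m ≡ + (d ℕ.+ r)
  b₂+dm = ≡.trans (≡.cong (λ n → + d ℤ.+ -1ℤ ℤ.* n ℤ.+ + d ℤ.* + m) +n≡)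
      (ℤsolve 3 (λ r s m → let D = κ (+ 3) ⊕ (r ⊕ s) ; M = κ (+ 2) ⊕ m in
        D ⊕ κ -1ℤ ⊗ (D ⊗ M ⊝ (κ 1ℤ ⊕ r)) ⊕ D ⊗ M ≜ D ⊕ (κ 1ℤ ⊕ r)) ≡.refl (+ r′) (+ s) (+ m′))

  b₂+d[m-1] : b₂ ℤ.+ + d ℤ.* + suc m′ ≡ + r
  b₂+d[m-1] = ≡.trans (≡.cong (λ n → + d ℤ.+ -1ℤ ℤ.* n ℤ.+ + d ℤ.* + suc m′) +n≡)
      (ℤsolve 3 (λ r s m → let D = κ (+ 3) ⊕ (r ⊕ s) in
        D ⊕ κ -1ℤ ⊗ (D ⊗ (κ (+ 2) ⊕ m) ⊝ (κ 1ℤ ⊕ r)) ⊕ D ⊗ (κ 1ℤ ⊕ m) ≜ κ 1ℤ ⊕ r) ≡.refl (+ r′) (+ s) (+ m′))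

  b₂+d[m-2] : b₂ ℤ.+ + d ℤ.* + m′ ≡ + r ℤ.- + d
  b₂+d[m-2] = ≡.trans (≡.cong (λ n → + d ℤ.+ -1ℤ ℤ.* n ℤ.+ + d ℤ.* + m′) +n≡)
      (ℤsolve 3 (λ r s m → let D = κ (+ 3) ⊕ (r ⊕ s) in
        D ⊕ κ -1ℤ ⊗ (D ⊗ (κ (+ 2) ⊕ m) ⊝ (κ 1ℤ ⊕ r)) ⊕ D ⊗ m ≜ κ 1ℤ ⊕ r ⊝ D) ≡.refl (+ r′) (+ s) (+ m′))

  b₁+dm : b₁ ℤ.+ + d ℤ.* + m ≡ + (d ℕ.+ r) ℤ.+ + suc c ℤ.* + n
  b₁+dm = ≡.trans (ℤsolve 4 (λ d c m n → d ⊕ c ⊗ n ⊕ d ⊗ m ≜ d ⊕ κ -1ℤ ⊗ n ⊕ d ⊗ m ⊕ (κ 1ℤ ⊕ c) ⊗ n) ≡.refl (+ d) (+ c) (+ m) (+ n))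
      (≡.cong (λ z → z ℤ.+ + suc c ℤ.* + n) b₂+dm)

  -dN : + (d ℕ.+ r) ℤ.+ ℤ.- (+ suc c) ℤ.* + n ≡ ℤ.- (+ d ℤ.* + N)
  -dN = ≡.trans (≡.cong (λ n → + (d ℕ.+ r) ℤ.+ ℤ.- (+ suc c) ℤ.* n) +n≡)
      (≡.trans (ℤsolve 3 (λ r s m → let D = κ (+ 3) ⊕ (r ⊕ s) ; M = κ (+ 2) ⊕ m ; n = D ⊗ M ⊝ (κ 1ℤ ⊕ r) in
          D ⊕ (κ 1ℤ ⊕ r) ⊕ (⊝ (κ (+ 2) ⊕ (r ⊕ s))) ⊗ n ≜ ⊝ (D ⊗ (n ⊝ κ 1ℤ ⊝ M))) ≡.refl (+ r′) (+ s) (+ m′))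
        (≡.cong (λ z → ℤ.- (+ d ℤ.* z)) (≡.sym (≡.trans +N≡ (≡.cong (λ n → n ℤ.- 1ℤ ℤ.- + m) +n≡)))))

  z : ℤ
  z = arithSum (+ d) b₁ m ℤ.+ (+ s ℤ.* arithSum (+ d) b₂ m ℤ.+ (+ r′ ℤ.* arithSum (+ d) b₂ (suc m′) ℤ.+ (arithSum (+ d) b₂ m′ ℤ.+ 0ℤ)))

module GenericCase (R : CommutativeRing 0ℓ 0ℓ) (q : CommutativeRing.Carrier R) (q-unit : IsUnit R q)
                   (r′ s m′ : ℕ) where
  open CommutativeRing R hiding (zero)
  open GenericParameters r′ s m′
  open Perturbation R q q-unit (+ d) (+ n)
  open import Relation.Binary.Reasoning.Setoid setoid

  private
    -- The polynomial in Q^k left by the swaps: a block of degree m from the compensating factor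
    -- with base q^{d+r+(d-1)n}, s blocks of degree m from the other factors with base q^{d+r}, r -
    -- 1 of degree m - 1 from q^r, and one of degree m - 2 from q^{r-d}.
    g : ℕ → Carrier
    g k = P (b₁ ℤ.+ + d ℤ.* + k) m * (P (b₂ ℤ.+ + d ℤ.* + k) m ^ s *
            (P (b₂ ℤ.+ + d ℤ.* + k) (suc m′) ^ r′ * (P (b₂ ℤ.+ + d ℤ.* + k) m′ * 1#)))

    g-Lin : Lin N z g
    g-Lin = Lin-P b₁ m (Lin-P^ b₂ m s (Lin-P^ b₂ (suc m′) r′ (Lin-P b₂ m′ one)))

    -- The constants (q^b;Q)_j that `P-swap` leaves in the denominators, block by block as in `g`.
    C : Carrier
    C = P b₁ m * (P b₂ m ^ s * (P b₂ (suc m′) ^ r′ * P b₂ m′))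

  module _ (η*η≈0 : [ + n ] * [ + n ] ≈ 0#)
           (P-unit : ∀ k → k ℕ.< n → IsUnit R (P (+ d) k))
           (t : ℕ → Carrier)
           (t-def : ∀ k → k ℕ.< n → t k * P (+ d) k ^ d ≈
             P (+ (d ℕ.+ r)) k ^ (2 ℕ.+ s) * P (+ r) k ^ r′ * P (+ r ℤ.- + d) k * e (+ d ℤ.* + k)) where

    private
      U^d : ∀ k → P (+ d) k ^ d ≈ P (+ d) k * (P b₁ k * P b₂ k ^ c)
      U^d k = *-congˡ (sym (P-spread η*η≈0 (+ d) c k))

      swap^ : ∀ j i k x → x ≈ P (b₂ ℤ.+ + d ℤ.* + j) k →
              P b₂ j ^ i * x ^ i ≈ P b₂ k ^ i * P (b₂ ℤ.+ + d ℤ.* + k) j ^ i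
      swap^ j i k x x≈ = begin
        P b₂ j ^ i * x ^ i                                ≈⟨ ^-distrib-* _ _ i ⟨
        (P b₂ j * x) ^ i                                  ≈⟨ ^-congˡ i (trans (*-congˡ x≈) (P-swap b₂ j k)) ⟩
        (P b₂ k * P (b₂ ℤ.+ + d ℤ.* + k) j) ^ i           ≈⟨ ^-distrib-* _ _ i ⟩
        P b₂ k ^ i * P (b₂ ℤ.+ + d ℤ.* + k) j ^ i         ∎

      numerator : ∀ k → P (+ (d ℕ.+ r)) k ^ (2 ℕ.+ s) * P (+ r) k ^ r′ * P (+ r ℤ.- + d) k * e (+ d ℤ.* + k) * C ≈
                        w N k * g k * P (+ d) k ^ d
      numerator k = begin
        A * (A * A ^ s) * B ^ r′ * S * E * C
          ≈⟨ solve 9 (λ a as b s e c₁ c₂ c₃ c₄ → a :* (a :* as) :* b :* s :* e :* (c₁ :* (c₂ :* (c₃ :* c₄))) :=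
                a :* a :* e :* c₁ :* (c₂ :* as) :* (c₃ :* b) :* (c₄ :* s)) refl A (A ^ s) (B ^ r′) S E _ _ _ _ ⟩
        A * A * E * P b₁ m * (P b₂ m ^ s * A ^ s) * (P b₂ (suc m′) ^ r′ * B ^ r′) * (P b₂ m′ * S)
          ≈⟨ *-cong (*-cong (*-cong (*-congʳ (*-congʳ (sym (P-pair η*η≈0 (+ (d ℕ.+ r)) (+ suc c) k))))
                (swap^ m s k A (P-cong k (≡.sym b₂+dm))))
                (swap^ (suc m′) r′ k B (P-cong k (≡.sym b₂+d[m-1]))))
                (trans (*-congˡ (P-cong k (≡.sym b₂+d[m-2]))) (P-swap b₂ m′ k)) ⟩
        A⁺ * A⁻ * E * P b₁ m * (W ^ s * g₂ ^ s) * (W ^ r′ * g₃ ^ r′) * (W * g₄)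
          ≈⟨ solve 10 (λ p m e c ws gs wr gr w g →
                p :* m :* e :* c :* (ws :* gs) :* (wr :* gr) :* (w :* g) :=
                m :* e :* (c :* p) :* (gs :* (gr :* (g :* con 1ℤ))) :* (w :* (wr :* ws)))
               refl A⁺ A⁻ E (P b₁ m) (W ^ s) (g₂ ^ s) (W ^ r′) (g₃ ^ r′) W g₄ ⟩
        A⁻ * E * (P b₁ m * A⁺) * (g₂ ^ s * (g₃ ^ r′ * (g₄ * 1#))) * (W * (W ^ r′ * W ^ s))
          ≈⟨ *-cong (*-congʳ (*-cong (trans (*-congʳ (P-cong k -dN)) (sym (w-closed N k)))
                (trans (*-congˡ (P-cong k (≡.sym b₁+dm))) (P-swap b₁ m k)))) (*-congˡ (sym (^-homo-* W r′ s))) ⟩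
        w N k * P (+ d) k * (P b₁ k * g₁) * (g₂ ^ s * (g₃ ^ r′ * (g₄ * 1#))) * W ^ c
          ≈⟨ solve 6 (λ w u v g h x → w :* u :* (v :* g) :* h :* x := w :* (g :* h) :* (u :* (v :* x)))
               refl (w N k) (P (+ d) k) (P b₁ k) g₁ _ (W ^ c) ⟩
        w N k * g k * (P (+ d) k * (P b₁ k * W ^ c))
          ≈⟨ *-congˡ (U^d k) ⟨
        w N k * g k * P (+ d) k ^ d  ∎
        where
        A = P (+ (d ℕ.+ r)) k
        B = P (+ r) k
        S = P (+ r ℤ.- + d) k
        E = e (+ d ℤ.* + k)
        A⁺ = P (+ (d ℕ.+ r) ℤ.+ + suc c ℤ.* + n) k
        A⁻ = P (+ (d ℕ.+ r) ℤ.+ ℤ.- (+ suc c) ℤ.* + n) k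
        W = P b₂ k
        g₁ = P (b₁ ℤ.+ + d ℤ.* + k) m
        g₂ = P (b₂ ℤ.+ + d ℤ.* + k) m
        g₃ = P (b₂ ℤ.+ + d ℤ.* + k) (suc m′)
        g₄ = P (b₂ ℤ.+ + d ℤ.* + k) m′

      term : ∀ k → k ℕ.< n → t k * C ≈ w N k * g k
      term k k<n = IsUnit-cancelˡ (IsUnit-^ d (P-unit k k<n)) (begin
        P (+ d) k ^ d * (t k * C)      ≈⟨ solve 3 (λ u t c → u :* (t :* c) := t :* u :* c) refl _ (t k) C ⟩
        t k * P (+ d) k ^ d * C        ≈⟨ *-congʳ (t-def k k<n) ⟩
        _                              ≈⟨ numerator k ⟩
        w N k * g k * P (+ d) k ^ d    ≈⟨ *-comm _ _ ⟩
        P (+ d) k ^ d * (w N k * g k)  ∎)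

      sum : Σ< n t * C ≈ (- 1#) ^ N * e z * P (+ d) N
      sum = trans (Σ<-distribʳ n t C) (trans (Σ<-cong n term) (karlsson-minton n g-Lin (ℕ.s≤s (ℕₚ.m≤m+n N m))))

      -- The factors missing from the blocks of length m - 1 and m - 2 in `C` are 1 - q^r and 1 -
      -- q^{r-d}, by the choice of `b₂`. Completed to length m, the blocks recombine by `P-spread`
      -- into the power d - 1 of (Q;Q)_m. This is the origin of (1 - q^r)^r and, up to a unit, of 1
      -- - q^{d-r} in the theorem.
      C*Rs : C * ([ + r ] ^ r * [ + r ℤ.- + d ]) ≈ P (+ d) m ^ suc c
      C*Rs = begin
        P b₁ m * (P b₂ m ^ s * (P b₂ (suc m′) ^ r′ * P b₂ m′)) * ([ + r ] * [ + r ] ^ r′ * [ + r ℤ.- + d ])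
          ≈⟨ solve 7 (λ c₁ c₂ c₃ c₄ x xr y → c₁ :* (c₂ :* (c₃ :* c₄)) :* (x :* xr :* y) :=
                c₁ :* (c₂ :* ((c₃ :* xr) :* (c₄ :* y :* x)))) refl (P b₁ m) (P b₂ m ^ s) (P b₂ (suc m′) ^ r′) (P b₂ m′) [ + r ] ([ + r ] ^ r′) [ + r ℤ.- + d ] ⟩
        P b₁ m * (P b₂ m ^ s * (P b₂ (suc m′) ^ r′ * [ + r ] ^ r′ * (P b₂ m′ * [ + r ℤ.- + d ] * [ + r ])))
          ≈⟨ *-congˡ (*-congˡ (*-cong (trans (sym (^-distrib-* _ _ r′)) (^-congˡ r′ top)) (trans (*-congʳ (*-congˡ ([]-cong (≡.sym b₂+d[m-2])))) top))) ⟩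
        P b₁ m * (P b₂ m ^ s * (P b₂ m ^ r′ * P b₂ m))
          ≈⟨ *-congˡ (solve 3 (λ x y z → x :* (y :* z) := z :* (y :* x)) refl _ _ _) ⟩
        P b₁ m * (P b₂ m * (P b₂ m ^ r′ * P b₂ m ^ s))
          ≈⟨ *-congˡ (*-congˡ (^-homo-* (P b₂ m) r′ s)) ⟨
        P b₁ m * P b₂ m ^ c
          ≈⟨ P-spread η*η≈0 (+ d) c m ⟩
        P (+ d) m ^ suc c ∎
        where
        top : P b₂ (suc m′) * [ + r ] ≈ P b₂ m
        top = *-congˡ ([]-cong (≡.sym b₂+d[m-1]))

    -- Free of division and with 1 - q^{r-d} in place of 1 - q^{d-r}. The quotient -q^{r-d} of the
    -- two is accounted for later, by the minus sign in the denominator and by a summand r - d of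
    -- the exponent.
    generic-congruence : Σ< n t * P (+ d) m ^ suc c ≈
      (- 1#) ^ N * ([ + r ] ^ r * [ + r ℤ.- + d ] * P (+ d) N) * e z
    generic-congruence = begin
      Σ< n t * P (+ d) m ^ suc c                                     ≈⟨ *-congˡ C*Rs ⟨
      Σ< n t * (C * ([ + r ] ^ r * [ + r ℤ.- + d ]))                 ≈⟨ *-assoc _ _ _ ⟨
      Σ< n t * C * ([ + r ] ^ r * [ + r ℤ.- + d ])                   ≈⟨ *-congʳ sum ⟩
      (- 1#) ^ N * e z * P (+ d) N * ([ + r ] ^ r * [ + r ℤ.- + d ])
        ≈⟨ solve 4 (λ a b c x → a :* b :* c :* x := a :* (x :* c) :* b) refl _ _ _ _ ⟩
      (- 1#) ^ N * ([ + r ] ^ r * [ + r ℤ.- + d ] * P (+ d) N) * e z  ∎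

-- The case d = 2, r = 1

module QuadraticCase (R : CommutativeRing 0ℓ 0ℓ) (q : CommutativeRing.Carrier R) (q-unit : IsUnit R q) (m′ : ℕ) where
  open CommutativeRing R hiding (zero)

  private
    m n : ℕ
    m = 2 ℕ.+ m′
    n = suc (m′ ℕ.+ m)

  open Perturbation R q q-unit (+ 2) (+ n)
  open import Relation.Binary.Reasoning.Setoid setoid

  private
    z : ℕ → ℤ
    z = arithSum (+ 2) (+ 2)

  module _ (η*η≈0 : [ + n ] * [ + n ] ≈ 0#)
           (2-unit : IsUnit R (fromℤ (+ 2)))
           (P-unit : ∀ k → k ℕ.< n → IsUnit R (P (+ 2) k))
           (t : ℕ → Carrier)
           (t-def : ∀ k → k ℕ.< n → t k * (P (+ 2) k * P (+ 2) k) ≈ P (+ 3) k * P -1ℤ k * e (+ 2 ℤ.* + k)) where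

    private
      -- The inverse of (Q;Q)_k as a total function of k; the default 0 lies outside the range of
      -- summation.
      I : ℕ → Carrier
      I k with k ℕ.<? n
      ... | yes k<n = proj₁ (P-unit k k<n)
      ... | no  _   = 0#

      P*I≈1 : ∀ k → k ℕ.< n → P (+ 2) k * I k ≈ 1#
      P*I≈1 k k<n with k ℕ.<? n
      ... | yes p  = proj₂ (P-unit k p)
      ... | no k≮n = contradiction k<n k≮n

      -- The sum of the shifted terms is affine in c modulo η², so twice its value at 0 is the sum of
      -- its values at 1 and -1, and both of these are q-Chu–Vandermonde sums.
      shifted : ℤ → ℕ → Carrier
      shifted c k = P (+ 3 ℤ.+ c ℤ.* + n) k * P (-1ℤ ℤ.+ ℤ.- c ℤ.* + n) k * e (+ 2 ℤ.* + k) * (I k * I k)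

      shifted-def : ∀ c k → k ℕ.< n → shifted c k * (P (+ 2) k * P (+ 2) k) ≈
                    P (+ 3 ℤ.+ c ℤ.* + n) k * P (-1ℤ ℤ.+ ℤ.- c ℤ.* + n) k * e (+ 2 ℤ.* + k)
      shifted-def c k k<n = begin
        x * (I k * I k) * (P (+ 2) k * P (+ 2) k)
          ≈⟨ solve 3 (λ x i u → x :* (i :* i) :* (u :* u) := x :* (u :* i) :* (u :* i)) refl x (I k) (P (+ 2) k) ⟩
        x * (P (+ 2) k * I k) * (P (+ 2) k * I k)
          ≈⟨ *-cong (*-congˡ (P*I≈1 k k<n)) (P*I≈1 k k<n) ⟩
        x * 1# * 1#
          ≈⟨ trans (*-identityʳ _) (*-identityʳ _) ⟩
        x ∎
        where x = P (+ 3 ℤ.+ c ℤ.* + n) k * P (-1ℤ ℤ.+ ℤ.- c ℤ.* + n) k * e (+ 2 ℤ.* + k)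

      mean : ∀ k → k ℕ.< n → t k * fromℤ (+ 2) ≈ shifted 1ℤ k + shifted -1ℤ k
      mean k k<n = IsUnit-cancelˡ (P-unit k k<n) (IsUnit-cancelˡ (P-unit k k<n) (begin
        u * (u * (t k * fromℤ (+ 2)))
          ≈⟨ solve 3 (λ u t x → u :* (u :* (t :* x)) := t :* (u :* u) :* x) refl u (t k) (fromℤ (+ 2)) ⟩
        t k * (u * u) * fromℤ (+ 2)
          ≈⟨ *-congʳ (t-def k k<n) ⟩
        P (+ 3) k * P -1ℤ k * x * fromℤ (+ 2)
          ≈⟨ solve 4 (λ a b x y → a :* b :* x :* y := y :* (a :* b) :* x) refl _ _ x (fromℤ (+ 2)) ⟩
        fromℤ (+ 2) * (P (+ 3) k * P -1ℤ k) * x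
          ≈⟨ *-congʳ (P-mean η*η≈0 (+ 3) -1ℤ k) ⟨
        (P (+ 3 ℤ.+ 1ℤ ℤ.* + n) k * P (-1ℤ ℤ.+ -1ℤ ℤ.* + n) k + P (+ 3 ℤ.+ -1ℤ ℤ.* + n) k * P (-1ℤ ℤ.+ 1ℤ ℤ.* + n) k) * x
          ≈⟨ distribʳ x _ _ ⟩
        _ ≈⟨ +-cong (shifted-def 1ℤ k k<n) (shifted-def -1ℤ k k<n) ⟨
        shifted 1ℤ k * (u * u) + shifted -1ℤ k * (u * u)
          ≈⟨ solve 3 (λ a b u → a :* (u :* u) :+ b :* (u :* u) := u :* (u :* (a :+ b))) refl _ _ u ⟩
        u * (u * (shifted 1ℤ k + shifted -1ℤ k))  ∎))
        where
        u = P (+ 2) k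
        x = e (+ 2 ℤ.* + k)

      Σ⁺ : Σ< n (shifted 1ℤ) ≈ (- 1#) ^ m * e (z m)
      Σ⁺ = chu-vandermonde m n (ℕ.s≤s (ℕₚ.m≤n+m m m′)) P-unit (shifted 1ℤ) (λ k k<n → trans (shifted-def 1ℤ k k<n)
        (*-congʳ (trans (*-comm _ _) (*-cong
          (P-cong k (ℤsolve 1 (λ m → κ -1ℤ ⊕ κ -1ℤ ⊗ (κ 1ℤ ⊕ (m ⊕ (κ (+ 2) ⊕ m))) ≜ ⊝ (κ (+ 2) ⊗ (κ (+ 2) ⊕ m))) ≡.refl (+ m′)))
          (P-cong k (ℤsolve 1 (λ m → κ (+ 3) ⊕ κ 1ℤ ⊗ (κ 1ℤ ⊕ (m ⊕ (κ (+ 2) ⊕ m))) ≜ κ (+ 2) ⊕ κ (+ 2) ⊗ (κ (+ 2) ⊕ m)) ≡.refl (+ m′)))))))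

      Σ⁻ : Σ< n (shifted -1ℤ) ≈ (- 1#) ^ m′ * e (z m′)
      Σ⁻ = chu-vandermonde m′ n (ℕ.s≤s (ℕₚ.m≤m+n m′ m)) P-unit (shifted -1ℤ) (λ k k<n → trans (shifted-def -1ℤ k k<n)
        (*-congʳ (*-cong
          (P-cong k (ℤsolve 1 (λ m → κ (+ 3) ⊕ κ -1ℤ ⊗ (κ 1ℤ ⊕ (m ⊕ (κ (+ 2) ⊕ m))) ≜ ⊝ (κ (+ 2) ⊗ m)) ≡.refl (+ m′)))
          (P-cong k (ℤsolve 1 (λ m → κ -1ℤ ⊕ κ 1ℤ ⊗ (κ 1ℤ ⊕ (m ⊕ (κ (+ 2) ⊕ m))) ≜ κ (+ 2) ⊕ κ (+ 2) ⊗ m) ≡.refl (+ m′))))))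

      x = e (+ n)

      drop-η² : ∀ a b → a + b * ((1# - x) * (1# - x)) ≈ a
      drop-η² a b = trans (+-congˡ (trans (*-congˡ η*η≈0) (zeroʳ b))) (+-identityʳ a)

      -- The two sums have the same sign and the ratio x² with x = q^n. Since 1 + x² = 2x + (1 -
      -- x)², twice the sum is 2x times the smaller one.
      sum : Σ< n t ≈ (- 1#) ^ m′ * e (z m′) * x
      sum = IsUnit-cancelˡ 2-unit (begin
        fromℤ (+ 2) * Σ< n t                         ≈⟨ *-comm _ _ ⟩
        Σ< n t * fromℤ (+ 2)                         ≈⟨ Σ<-distribʳ n t _ ⟩
        Σ< n (λ k → t k * fromℤ (+ 2))               ≈⟨ Σ<-cong n mean ⟩
        Σ< n (λ k → shifted 1ℤ k + shifted -1ℤ k)    ≈⟨ Σ<-+ n (shifted 1ℤ) (shifted -1ℤ) ⟩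
        Σ< n (shifted 1ℤ) + Σ< n (shifted -1ℤ)       ≈⟨ +-cong Σ⁺ Σ⁻ ⟩
        - 1# * (- 1# * ε) * e (z m) + ε * e (z m′)
          ≈⟨ +-congʳ (*-congˡ (trans (e-+′ (z m′ ℤ.+ + n) (+ n) (ℤsolve 2 (λ z m →
               κ (+ 2) ⊕ κ (+ 2) ⊗ (κ 1ℤ ⊕ m) ⊕ (κ (+ 2) ⊕ κ (+ 2) ⊗ m ⊕ z) ≜
               z ⊕ (κ 1ℤ ⊕ (m ⊕ (κ (+ 2) ⊕ m))) ⊕ (κ 1ℤ ⊕ (m ⊕ (κ (+ 2) ⊕ m)))) ≡.refl (z m′) (+ m′)))
               (*-congʳ (e-+ (z m′) (+ n))))) ⟩
        - 1# * (- 1# * ε) * (y * x * x) + ε * y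
          ≈⟨ solve 3 (λ s y x → (:- con 1ℤ) :* ((:- con 1ℤ) :* s) :* (y :* x :* x) :+ s :* y :=
               con (+ 2) :* (s :* y :* x) :+ s :* y :* ((con 1ℤ :- x) :* (con 1ℤ :- x))) refl ε y x ⟩
        fromℤ (+ 2) * (ε * y * x) + ε * y * ((1# - x) * (1# - x))
          ≈⟨ drop-η² _ _ ⟩
        fromℤ (+ 2) * (ε * y * x) ∎)
        where
        ε = (- 1#) ^ m′
        y = e (z m′)

    quadratic-congruence : Σ< n t * P (+ 2) m ^ 1 ≈
      (- 1#) ^ m′ * ([ 1ℤ ] ^ 1 * [ -1ℤ ] * P (+ 2) m′) * e (z m′ ℤ.+ + n ℤ.+ + n)
    quadratic-congruence = begin
      Σ< n t * (p * [ + 2 ℤ.+ + 2 ℤ.* + m′ ] * [ + 2 ℤ.+ + 2 ℤ.* + suc m′ ] * 1#)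
        ≈⟨ *-cong sum (*-congʳ (*-cong (*-congˡ (+-congˡ (-‿cong
             (e-+′ (+ n) -1ℤ (ℤsolve 1 (λ m → κ (+ 2) ⊕ κ (+ 2) ⊗ m ≜ (κ 1ℤ ⊕ (m ⊕ (κ (+ 2) ⊕ m))) ⊕ κ -1ℤ) ≡.refl (+ m′))))))
             (+-congˡ (-‿cong
             (e-+′ (+ n) 1ℤ (ℤsolve 1 (λ m → κ (+ 2) ⊕ κ (+ 2) ⊗ (κ 1ℤ ⊕ m) ≜ (κ 1ℤ ⊕ (m ⊕ (κ (+ 2) ⊕ m))) ⊕ κ 1ℤ) ≡.refl (+ m′))))))) ⟩
      ε * y * x * (p * (1# - x * v) * (1# - x * u) * 1#)
        ≈⟨ solve 6 (λ s y x p u v → s :* y :* x :* (p :* (con 1ℤ :- x :* v) :* (con 1ℤ :- x :* u) :* con 1ℤ) :=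
             s :* y :* x :* p :* (con 1ℤ :- x :* v :- x :* u :+ x :* x :* (u :* v))) refl ε y x p u v ⟩
      ε * y * x * p * (1# - x * v - x * u + x * x * (u * v))
        ≈⟨ *-congˡ (+-congˡ (*-congˡ u*v≈1)) ⟩
      ε * y * x * p * (1# - x * v - x * u + x * x * 1#)
        ≈⟨ solve 6 (λ s y x p u v → s :* y :* x :* p :* (con 1ℤ :- x :* v :- x :* u :+ x :* x :* con 1ℤ) :=
             s :* y :* x :* p :* (x :+ x :* con 1ℤ :- x :* v :- x :* u) :+ s :* y :* x :* p :* ((con 1ℤ :- x) :* (con 1ℤ :- x)))
             refl ε y x p u v ⟩
      ε * y * x * p * (x + x * 1# - x * v - x * u) + ε * y * x * p * ((1# - x) * (1# - x))
        ≈⟨ drop-η² _ _ ⟩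
      ε * y * x * p * (x + x * 1# - x * v - x * u)
        ≈⟨ *-congˡ (+-congʳ (+-congʳ (+-congˡ (*-congˡ u*v≈1)))) ⟨
      ε * y * x * p * (x + x * (u * v) - x * v - x * u)
        ≈⟨ solve 6 (λ s y x p u v → s :* y :* x :* p :* (x :+ x :* (u :* v) :- x :* v :- x :* u) :=
             s :* ((con 1ℤ :- u) :* con 1ℤ :* (con 1ℤ :- v) :* p) :* (y :* x :* x)) refl ε y x p u v ⟩
      ε * ([ 1ℤ ] ^ 1 * [ -1ℤ ] * p) * (y * x * x)
        ≈⟨ *-congˡ (trans (e-+ (z m′ ℤ.+ + n) (+ n)) (*-congʳ (e-+ (z m′) (+ n)))) ⟨
      ε * ([ 1ℤ ] ^ 1 * [ -1ℤ ] * p) * e (z m′ ℤ.+ + n ℤ.+ + n)  ∎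
      where
      ε = (- 1#) ^ m′
      y = e (z m′)
      p = P (+ 2) m′
      u = e 1ℤ
      v = e -1ℤ
      u*v≈1 : u * v ≈ 1#
      u*v≈1 = sym (e-+ 1ℤ -1ℤ)

-- The exponent A(d,n,r)

/ℕ-exact : ∀ a m → (a ℤ.* + suc m) /ℕ suc m ≡ a
/ℕ-exact a m = ℤₚ.≤-antisym
  (ℤₚ.*-cancelʳ-≤-pos _ a (+ suc m) ([n/ℕd]*d≤n x (suc m)))
  (≡.subst (a ℤ.≤_) (ℤₚ.pred-suc (x /ℕ suc m)) (ℤₚ.i<j⇒i≤pred[j] (ℤₚ.*-cancelʳ-<-nonNeg {a} {ℤ.suc (x /ℕ suc m)} (+ suc m) (n<s[n/ℕd]*d x (suc m)))))
  where x = a ℤ.* + suc m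

triangular : ℕ → ℕ
triangular zero    = 0
triangular (suc k) = suc k ℕ.+ triangular k

triangular-*2 : ∀ r → r ℕ.* (r ℕ.+ 1) ≡ triangular r ℕ.* 2
triangular-*2 zero    = ≡.refl
triangular-*2 (suc r) = ≡.trans (solve 1 (λ r → (con 1 :+ r) :* (con 1 :+ r :+ con 1) := (con 1 :+ r) :* con 2 :+ r :* (r :+ con 1)) ≡.refl r)
  (≡.trans (≡.cong (suc r ℕ.* 2 ℕ.+_) (triangular-*2 r)) (≡.sym (ℕₚ.*-distribʳ-+ 2 (suc r) (triangular r))))
  where open ℕ-Solver

-- Multiplying A = z + r - d by 2d clears both floor divisions. The number w is a form of 2z without
-- `arithSum`, so that the second hypothesis becomes a polynomial identity within reach of the ring
-- solver.
Aexp≡ : ∀ d′ n r z w → let d = + suc d′ in + 2 ℤ.* z ≡ w →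
  d ℤ.* (d ℤ.+ + n) ℤ.* (+ n ℤ.+ + r) ℤ.+ d ℤ.* + n ℤ.* (+ r ℤ.- 1ℤ) ℤ.- (+ n ℤ.+ + r) ℤ.* (+ n ℤ.+ + r) ≡
    d ℤ.* (w ℤ.+ + 2 ℤ.* (+ r ℤ.- d) ℤ.+ + r ℤ.* (+ r ℤ.+ 1ℤ)) →
  Aexp (suc d′) n r ≡ z ℤ.+ (+ r ℤ.- d)
Aexp≡ d′ n r z w 2z≡w eq = begin
  top /ℕ (2 ℕ.* suc d′) ℤ.- + (r ℕ.* (r ℕ.+ 1) ℕ./ 2)
    ≡⟨ ≡.cong₂ (λ x y → x /ℕ (2 ℕ.* suc d′) ℤ.- + y) top≡ (≡.trans (≡.cong (ℕ._/ 2) (triangular-*2 r)) (ℕ.m*n/n≡m T 2)) ⟩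
  (a ℤ.* + (2 ℕ.* suc d′)) /ℕ (2 ℕ.* suc d′) ℤ.- + T
    ≡⟨ ≡.cong (λ x → x ℤ.- + T) (/ℕ-exact a _) ⟩
  a ℤ.- + T
    ≡⟨ ℤsolve 2 (λ x t → x ⊕ t ⊝ t ≜ x) ≡.refl (z ℤ.+ (+ r ℤ.- d)) (+ T) ⟩
  z ℤ.+ (+ r ℤ.- d)  ∎
  where
  open ≡.≡-Reasoning
  d = + suc d′
  T = triangular r
  a = z ℤ.+ (+ r ℤ.- d) ℤ.+ + T
  top = + (suc d′ ℕ.* (suc d′ ℕ.+ n) ℕ.* (n ℕ.+ r)) ℤ.+ (+ (suc d′ ℕ.* n)) ℤ.* (+ r ℤ.- 1ℤ) ℤ.- + ((n ℕ.+ r) ℕ.* (n ℕ.+ r))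
  top≡ : top ≡ a ℤ.* + (2 ℕ.* suc d′)
  top≡ = begin
    top
      ≡⟨ ≡.cong₂ ℤ._-_ (≡.cong₂ ℤ._+_ (≡.trans (ℤₚ.pos-* (suc d′ ℕ.* (suc d′ ℕ.+ n)) (n ℕ.+ r)) (≡.cong (λ x → x ℤ.* + (n ℕ.+ r)) (ℤₚ.pos-* (suc d′) (suc d′ ℕ.+ n))))
            (≡.cong (λ x → x ℤ.* (+ r ℤ.- 1ℤ)) (ℤₚ.pos-* (suc d′) n))) (ℤₚ.pos-* (n ℕ.+ r) (n ℕ.+ r)) ⟩
    _ ≡⟨ eq ⟩
    d ℤ.* (w ℤ.+ + 2 ℤ.* (+ r ℤ.- d) ℤ.+ + r ℤ.* (+ r ℤ.+ 1ℤ))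
      ≡⟨ ≡.cong₂ (λ w t → d ℤ.* (w ℤ.+ + 2 ℤ.* (+ r ℤ.- d) ℤ.+ t)) (≡.sym 2z≡w)
           (≡.trans (≡.sym (ℤₚ.pos-* r (r ℕ.+ 1))) (≡.trans (≡.cong +_ (triangular-*2 r)) (ℤₚ.pos-* T 2))) ⟩
    d ℤ.* (+ 2 ℤ.* z ℤ.+ + 2 ℤ.* (+ r ℤ.- d) ℤ.+ + T ℤ.* + 2)
      ≡⟨ ℤsolve 4 (λ d z x t → d ⊗ (κ (+ 2) ⊗ z ⊕ κ (+ 2) ⊗ x ⊕ t ⊗ κ (+ 2)) ≜ (z ⊕ x ⊕ t) ⊗ (κ (+ 2) ⊗ d)) ≡.refl d z (+ r ℤ.- d) (+ T) ⟩
    a ℤ.* (+ 2 ℤ.* d)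
      ≡⟨ ≡.cong (λ x → a ℤ.* x) (≡.sym (ℤₚ.pos-* 2 (suc d′))) ⟩
    a ℤ.* + (2 ℕ.* suc d′)  ∎

arithSum-*2 : ∀ d b j → + 2 ℤ.* arithSum d b j ≡ + j ℤ.* (+ 2 ℤ.* b ℤ.+ d ℤ.* (+ j ℤ.- 1ℤ))
arithSum-*2 d b zero    = ≡.refl
arithSum-*2 d b (suc j) = ≡.trans
  (ℤsolve 4 (λ b d j s → κ (+ 2) ⊗ (b ⊕ d ⊗ j ⊕ s) ≜ κ (+ 2) ⊗ (b ⊕ d ⊗ j) ⊕ κ (+ 2) ⊗ s) ≡.refl b d (+ j) (arithSum d b j))
  (≡.trans (≡.cong (λ x → + 2 ℤ.* (b ℤ.+ d ℤ.* + j) ℤ.+ x) (arithSum-*2 d b j))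
    (ℤsolve 3 (λ b d j → κ (+ 2) ⊗ (b ⊕ d ⊗ j) ⊕ j ⊗ (κ (+ 2) ⊗ b ⊕ d ⊗ (j ⊝ κ 1ℤ)) ≜
       (κ 1ℤ ⊕ j) ⊗ (κ (+ 2) ⊗ b ⊕ d ⊗ (κ 1ℤ ⊕ j ⊝ κ 1ℤ))) ≡.refl b d (+ j)))

module _ (r′ s m′ : ℕ) where
  open GenericParameters r′ s m′

  private
    F : ℤ → ℤ → ℕ → ℤ
    F d b j = + j ℤ.* (+ 2 ℤ.* b ℤ.+ d ℤ.* (+ j ℤ.- 1ℤ))

    2z : ℤ → ℤ
    2z n = F (+ d) (+ d ℤ.+ + c ℤ.* n) m ℤ.+ (+ s ℤ.* F (+ d) (+ d ℤ.+ -1ℤ ℤ.* n) m ℤ.+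
             (+ r′ ℤ.* F (+ d) (+ d ℤ.+ -1ℤ ℤ.* n) (suc m′) ℤ.+ F (+ d) (+ d ℤ.+ -1ℤ ℤ.* n) m′))

    2z≡ : + 2 ℤ.* z ≡ 2z (+ n)
    2z≡ = ≡.trans
      (ℤsolve 6 (λ a b c x s r → κ (+ 2) ⊗ (a ⊕ (s ⊗ b ⊕ (r ⊗ c ⊕ (x ⊕ κ 0ℤ)))) ≜
        κ (+ 2) ⊗ a ⊕ (s ⊗ (κ (+ 2) ⊗ b) ⊕ (r ⊗ (κ (+ 2) ⊗ c) ⊕ κ (+ 2) ⊗ x))) ≡.refl
        (arithSum (+ d) b₁ m) (arithSum (+ d) b₂ m) (arithSum (+ d) b₂ (suc m′)) (arithSum (+ d) b₂ m′) (+ s) (+ r′))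
      (≡.cong₂ ℤ._+_ (arithSum-*2 (+ d) b₁ m) (≡.cong₂ (λ x y → + s ℤ.* x ℤ.+ y) (arithSum-*2 (+ d) b₂ m)
        (≡.cong₂ (λ x y → + r′ ℤ.* x ℤ.+ y) (arithSum-*2 (+ d) b₂ (suc m′)) (arithSum-*2 (+ d) b₂ m′))))

  -- With n replaced by dm - r, and `arithSum` by its doubled closed form, this is a polynomial
  -- identity in r - 1, s and m - 2.
  Aexp-generic : Aexp d n r ≡ z ℤ.+ (+ r ℤ.- + d)
  Aexp-generic = Aexp≡ _ n r z (2z (+ n)) 2z≡ (≡.subst (λ n →
      + d ℤ.* (+ d ℤ.+ n) ℤ.* (n ℤ.+ + r) ℤ.+ + d ℤ.* n ℤ.* (+ r ℤ.- 1ℤ) ℤ.- (n ℤ.+ + r) ℤ.* (n ℤ.+ + r) ≡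
      + d ℤ.* (2z n ℤ.+ + 2 ℤ.* (+ r ℤ.- + d) ℤ.+ + r ℤ.* (+ r ℤ.+ 1ℤ))) (≡.sym +n≡)
    (ℤsolve 3 (λ r s m →
       let D = κ (+ 3) ⊕ (r ⊕ s) ; M = κ (+ 2) ⊕ m ; R = κ 1ℤ ⊕ r ; n = D ⊗ M ⊝ R ; C = κ 1ℤ ⊕ (r ⊕ s)
           B = D ⊕ κ -1ℤ ⊗ n
           f = λ b j → j ⊗ (κ (+ 2) ⊗ b ⊕ D ⊗ (j ⊝ κ 1ℤ)) in
       D ⊗ (D ⊕ n) ⊗ (n ⊕ R) ⊕ D ⊗ n ⊗ (R ⊝ κ 1ℤ) ⊝ (n ⊕ R) ⊗ (n ⊕ R) ≜
       D ⊗ (f (D ⊕ C ⊗ n) M ⊕ (s ⊗ f B M ⊕ (r ⊗ f B (κ 1ℤ ⊕ m) ⊕ f B m)) ⊕ κ (+ 2) ⊗ (R ⊝ D) ⊕ R ⊗ (R ⊕ κ 1ℤ)))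
      ≡.refl (+ r′) (+ s) (+ m′)))

Aexp-quadratic : ∀ m′ → let n = suc (m′ ℕ.+ (2 ℕ.+ m′)) in
  Aexp 2 n 1 ≡ arithSum (+ 2) (+ 2) m′ ℤ.+ + n ℤ.+ + n ℤ.+ (1ℤ ℤ.- + 2)
Aexp-quadratic m′ = Aexp≡ 1 n 1 (S ℤ.+ + n ℤ.+ + n) (+ m′ ℤ.* (+ 4 ℤ.+ + 2 ℤ.* (+ m′ ℤ.- 1ℤ)) ℤ.+ + 4 ℤ.* + n)
  (≡.trans (ℤsolve 2 (λ s n → κ (+ 2) ⊗ (s ⊕ n ⊕ n) ≜ κ (+ 2) ⊗ s ⊕ κ (+ 4) ⊗ n) ≡.refl S (+ n))
    (≡.cong (λ x → x ℤ.+ + 4 ℤ.* + n) (arithSum-*2 (+ 2) (+ 2) m′)))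
  (ℤsolve 1 (λ m → let n = κ 1ℤ ⊕ (m ⊕ (κ (+ 2) ⊕ m)) ; d = κ (+ 2) ; r = κ 1ℤ in
     d ⊗ (d ⊕ n) ⊗ (n ⊕ r) ⊕ d ⊗ n ⊗ (r ⊝ κ 1ℤ) ⊝ (n ⊕ r) ⊗ (n ⊕ r) ≜
     d ⊗ (m ⊗ (κ (+ 4) ⊕ κ (+ 2) ⊗ (m ⊝ κ 1ℤ)) ⊕ κ (+ 4) ⊗ n ⊕ κ (+ 2) ⊗ (r ⊝ d) ⊕ r ⊗ (r ⊕ κ 1ℤ))) ≡.refl (+ m′))
  where
  n = suc (m′ ℕ.+ (2 ℕ.+ m′))
  S = arithSum (+ 2) (+ 2) m′

-- The ring ℤ[q]

coeff : Poly → ℕ → ℤ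
coeff []      _       = 0ℤ
coeff (a ∷ p) zero    = a
coeff (a ∷ p) (suc i) = coeff p i

infix 4 _≋_
-- Equality up to trailing zeros, transitive without any comparison of lengths. Being a record type,
-- it keeps p and q visible to unification.
record _≋_ (p q : Poly) : Set where
  constructor coeffwise
  field at : ∀ i → coeff p i ≡ coeff q i
open _≋_

coeff-+ : ∀ p q i → coeff (p +P q) i ≡ coeff p i ℤ.+ coeff q i
coeff-+ []      q       i       = ≡.sym (ℤₚ.+-identityˡ _)
coeff-+ (a ∷ p) []      i       = ≡.sym (ℤₚ.+-identityʳ _)
coeff-+ (a ∷ p) (b ∷ q) zero    = ≡.refl
coeff-+ (a ∷ p) (b ∷ q) (suc i) = coeff-+ p q i

coeff-scale : ∀ c p i → coeff (scaleP c p) i ≡ c ℤ.* coeff p i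
coeff-scale c []      i       = ≡.sym (ℤₚ.*-zeroʳ c)
coeff-scale c (a ∷ p) zero    = ≡.refl
coeff-scale c (a ∷ p) (suc i) = coeff-scale c p i

coeff-neg : ∀ p i → coeff (negP p) i ≡ ℤ.- coeff p i
coeff-neg p i = ≡.trans (coeff-scale -1ℤ p i) (ℤₚ.-1*i≡-i _)

coeff-*-zero : ∀ a p q → coeff ((a ∷ p) *P q) 0 ≡ a ℤ.* coeff q 0
coeff-*-zero a p q = ≡.trans (coeff-+ (scaleP a q) _ 0) (≡.trans (ℤₚ.+-identityʳ _) (coeff-scale a q 0))

coeff-*-suc : ∀ a p q i → coeff ((a ∷ p) *P q) (suc i) ≡ a ℤ.* coeff q (suc i) ℤ.+ coeff (p *P q) i
coeff-*-suc a p q i = ≡.trans (coeff-+ (scaleP a q) _ (suc i)) (≡.cong (ℤ._+ coeff (p *P q) i) (coeff-scale a q (suc i)))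

≋-isEquivalence : IsEquivalence _≋_
≋-isEquivalence = record
  { refl  = coeffwise λ _ → ≡.refl
  ; sym   = λ p≋q → coeffwise λ i → ≡.sym (at p≋q i)
  ; trans = λ p≋q q≋r → coeffwise λ i → ≡.trans (at p≋q i) (at q≋r i)
  }

private
  +-lift : ∀ p q p′ q′ → (∀ i → coeff p i ℤ.+ coeff q i ≡ coeff p′ i ℤ.+ coeff q′ i) → p +P q ≋ p′ +P q′
  +-lift p q p′ q′ h = coeffwise λ i → ≡.trans (coeff-+ p q i) (≡.trans (h i) (≡.sym (coeff-+ p′ q′ i)))

+P-cong : ∀ {p p′ q q′} → p ≋ p′ → q ≋ q′ → p +P q ≋ p′ +P q′
+P-cong {p} {p′} {q} {q′} p≋ q≋ = +-lift p q p′ q′ λ i → ≡.cong₂ ℤ._+_ (at p≋ i) (at q≋ i)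

+P-comm : ∀ p q → p +P q ≋ q +P p
+P-comm p q = +-lift p q q p λ i → ℤₚ.+-comm (coeff p i) (coeff q i)

+P-assoc : ∀ p q r → (p +P q) +P r ≋ p +P (q +P r)
+P-assoc p q r = +-lift (p +P q) r p (q +P r) λ i → ≡.trans (≡.cong (ℤ._+ coeff r i) (coeff-+ p q i))
  (≡.trans (ℤₚ.+-assoc (coeff p i) _ _) (≡.cong (λ z → coeff p i ℤ.+ z) (≡.sym (coeff-+ q r i))))

+P-inverseʳ : ∀ p → p -P p ≋ []
+P-inverseʳ p = coeffwise λ i → ≡.trans (coeff-+ p (negP p) i)
  (≡.trans (≡.cong (λ z → coeff p i ℤ.+ z) (coeff-neg p i)) (ℤₚ.+-inverseʳ (coeff p i)))

negP-cong : ∀ {p q} → p ≋ q → negP p ≋ negP q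
negP-cong {p} {q} p≋q = coeffwise λ i → ≡.trans (coeff-neg p i) (≡.trans (≡.cong ℤ.-_ (at p≋q i)) (≡.sym (coeff-neg q i)))

*P-zeroʳ : ∀ p i → coeff (p *P []) i ≡ 0ℤ
*P-zeroʳ []      i       = ≡.refl
*P-zeroʳ (a ∷ p) zero    = ≡.refl
*P-zeroʳ (a ∷ p) (suc i) = *P-zeroʳ p i

-- `_*P_` recurses on its left argument; this is the matching rule for the right one, and
-- commutativity follows by comparing the two.
*P-∷ʳ : ∀ p b q i → coeff (p *P (b ∷ q)) i ≡ coeff (scaleP b p +P (0ℤ ∷ p *P q)) i
*P-∷ʳ []      b q zero    = ≡.refl
*P-∷ʳ []      b q (suc i) = ≡.refl
*P-∷ʳ (a ∷ p) b q zero    = ≡.trans (coeff-*-zero a p (b ∷ q)) (≡.trans (ℤₚ.*-comm a b) (≡.sym (ℤₚ.+-identityʳ (b ℤ.* a))))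
*P-∷ʳ (a ∷ p) b q (suc i) = begin
  coeff ((a ∷ p) *P (b ∷ q)) (suc i)                                  ≡⟨ coeff-*-suc a p (b ∷ q) i ⟩
  a ℤ.* coeff q i ℤ.+ coeff (p *P (b ∷ q)) i                          ≡⟨ ≡.cong (λ z → a ℤ.* coeff q i ℤ.+ z) (≡.trans (*P-∷ʳ p b q i) (coeff-+ (scaleP b p) _ i)) ⟩
  a ℤ.* coeff q i ℤ.+ (coeff (scaleP b p) i ℤ.+ coeff (0ℤ ∷ p *P q) i)
    ≡⟨ ℤsolve 3 (λ x y z → x ⊕ (y ⊕ z) ≜ y ⊕ (x ⊕ z)) ≡.refl (a ℤ.* coeff q i) (coeff (scaleP b p) i) (coeff (0ℤ ∷ p *P q) i) ⟩
  coeff (scaleP b p) i ℤ.+ (a ℤ.* coeff q i ℤ.+ coeff (0ℤ ∷ p *P q) i)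
    ≡⟨ ≡.cong (λ z → coeff (scaleP b p) i ℤ.+ z) (≡.sym (≡.trans (coeff-+ (scaleP a q) _ i) (≡.cong (ℤ._+ coeff (0ℤ ∷ p *P q) i) (coeff-scale a q i)))) ⟩
  coeff (scaleP b p) i ℤ.+ coeff ((a ∷ p) *P q) i                     ≡⟨ coeff-+ (scaleP b p) _ i ⟨
  coeff (scaleP b p +P ((a ∷ p) *P q)) i                              ∎
  where open ≡.≡-Reasoning

*P-comm′ : ∀ p q i → coeff (p *P q) i ≡ coeff (q *P p) i
*P-comm′ []      q i       = ≡.sym (*P-zeroʳ q i)
*P-comm′ (a ∷ p) q zero    = ≡.trans (coeff-+ (scaleP a q) _ 0) (≡.sym (≡.trans (*P-∷ʳ q a p 0) (coeff-+ (scaleP a q) _ 0)))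
*P-comm′ (a ∷ p) q (suc i) = ≡.trans (coeff-+ (scaleP a q) _ (suc i)) (≡.trans
  (≡.cong (λ z → coeff (scaleP a q) (suc i) ℤ.+ z) (*P-comm′ p q i))
  (≡.sym (≡.trans (*P-∷ʳ q a p (suc i)) (coeff-+ (scaleP a q) _ (suc i)))))

*P-comm : ∀ p q → p *P q ≋ q *P p
*P-comm p q = coeffwise (*P-comm′ p q)

private
  *P-congʳ′ : ∀ p {q q′} → q ≋ q′ → ∀ i → coeff (p *P q) i ≡ coeff (p *P q′) i
  *P-congʳ′ []      q≋ i = ≡.refl
  *P-congʳ′ (a ∷ p) {q} {q′} q≋ zero = ≡.trans (coeff-*-zero a p q)
    (≡.trans (≡.cong (λ z → a ℤ.* z) (at q≋ 0)) (≡.sym (coeff-*-zero a p q′)))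
  *P-congʳ′ (a ∷ p) {q} {q′} q≋ (suc i) = ≡.trans (coeff-*-suc a p q i)
    (≡.trans (≡.cong₂ (λ x y → a ℤ.* x ℤ.+ y) (at q≋ (suc i)) (*P-congʳ′ p q≋ i)) (≡.sym (coeff-*-suc a p q′ i)))

*P-cong : ∀ {p p′ q q′} → p ≋ p′ → q ≋ q′ → p *P q ≋ p′ *P q′
*P-cong {p} {p′} {q} {q′} p≋ q≋ = coeffwise λ i →
  ≡.trans (*P-congʳ′ p q≋ i) (≡.trans (*P-comm′ p q′ i) (≡.trans (*P-congʳ′ q′ p≋ i) (*P-comm′ q′ p′ i)))

private
  distribʳ′ : ∀ r p q i → coeff ((p +P q) *P r) i ≡ coeff (p *P r) i ℤ.+ coeff (q *P r) i
  distribʳ′ r []      q       i = ≡.sym (ℤₚ.+-identityˡ _)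
  distribʳ′ r (a ∷ p) []      i = ≡.sym (ℤₚ.+-identityʳ _)
  distribʳ′ r (a ∷ p) (b ∷ q) zero = ≡.trans (coeff-*-zero (a ℤ.+ b) (p +P q) r) (≡.trans (ℤₚ.*-distribʳ-+ (coeff r 0) a b)
    (≡.sym (≡.cong₂ ℤ._+_ (coeff-*-zero a p r) (coeff-*-zero b q r))))
  distribʳ′ r (a ∷ p) (b ∷ q) (suc i) = ≡.trans (coeff-*-suc (a ℤ.+ b) (p +P q) r i) (≡.trans
    (≡.cong (λ z → (a ℤ.+ b) ℤ.* coeff r (suc i) ℤ.+ z) (distribʳ′ r p q i))
    (≡.trans (ℤsolve 5 (λ a b r x y → (a ⊕ b) ⊗ r ⊕ (x ⊕ y) ≜ (a ⊗ r ⊕ x) ⊕ (b ⊗ r ⊕ y)) ≡.refl a b (coeff r (suc i)) (coeff (p *P r) i) (coeff (q *P r) i))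
      (≡.sym (≡.cong₂ ℤ._+_ (coeff-*-suc a p r i) (coeff-*-suc b q r i)))))

  scale-* : ∀ a q r i → coeff (scaleP a q *P r) i ≡ a ℤ.* coeff (q *P r) i
  scale-* a []      r i       = ≡.sym (ℤₚ.*-zeroʳ a)
  scale-* a (b ∷ q) r zero    = ≡.trans (coeff-*-zero (a ℤ.* b) (scaleP a q) r)
    (≡.trans (ℤₚ.*-assoc a b _) (≡.cong (λ z → a ℤ.* z) (≡.sym (coeff-*-zero b q r))))
  scale-* a (b ∷ q) r (suc i) = ≡.trans (coeff-*-suc (a ℤ.* b) (scaleP a q) r i)
    (≡.trans (≡.cong (λ z → a ℤ.* b ℤ.* coeff r (suc i) ℤ.+ z) (scale-* a q r i))
    (≡.trans (ℤsolve 4 (λ a b r x → a ⊗ b ⊗ r ⊕ a ⊗ x ≜ a ⊗ (b ⊗ r ⊕ x)) ≡.refl a b (coeff r (suc i)) (coeff (q *P r) i))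
      (≡.cong (λ z → a ℤ.* z) (≡.sym (coeff-*-suc b q r i)))))

  *P-assoc′ : ∀ p q r i → coeff ((p *P q) *P r) i ≡ coeff (p *P (q *P r)) i
  *P-assoc′ []      q r i       = ≡.refl
  *P-assoc′ (a ∷ p) q r i = ≡.trans (distribʳ′ r (scaleP a q) (0ℤ ∷ p *P q) i) (≡.trans
    (≡.cong₂ ℤ._+_ (≡.trans (scale-* a q r i) (≡.sym (coeff-scale a (q *P r) i))) (shifted i))
    (≡.sym (coeff-+ (scaleP a (q *P r)) (0ℤ ∷ p *P (q *P r)) i)))
    where
    shifted : ∀ i → coeff ((0ℤ ∷ p *P q) *P r) i ≡ coeff (0ℤ ∷ p *P (q *P r)) i
    shifted zero    = coeff-*-zero 0ℤ (p *P q) r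
    shifted (suc i) = ≡.trans (coeff-*-suc 0ℤ (p *P q) r i) (≡.trans (ℤₚ.+-identityˡ _) (*P-assoc′ p q r i))

*P-assoc : ∀ p q r → (p *P q) *P r ≋ p *P (q *P r)
*P-assoc p q r = coeffwise (*P-assoc′ p q r)

*P-distribʳ-+P : ∀ r p q → (p +P q) *P r ≋ (p *P r) +P (q *P r)
*P-distribʳ-+P r p q = coeffwise λ i → ≡.trans (distribʳ′ r p q i) (≡.sym (coeff-+ (p *P r) (q *P r) i))

constP-* : ∀ c p → constP c *P p ≋ scaleP c p
constP-* c p = coeffwise λ i → ≡.trans (coeff-+ (scaleP c p) (0ℤ ∷ []) i) (≡.trans (≡.cong (λ z → coeff (scaleP c p) i ℤ.+ z) (zeros i)) (ℤₚ.+-identityʳ _))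
  where
  zeros : ∀ i → coeff (0ℤ ∷ []) i ≡ 0ℤ
  zeros zero    = ≡.refl
  zeros (suc i) = ≡.refl

*P-identityˡ : ∀ p → oneP *P p ≋ p
*P-identityˡ p = coeffwise λ i → ≡.trans (at (constP-* 1ℤ p) i) (≡.trans (coeff-scale 1ℤ p i) (ℤₚ.*-identityˡ _))

module ≋ = IsEquivalence ≋-isEquivalence

polyRing : CommutativeRing 0ℓ 0ℓ
polyRing = record
  { Carrier = Poly ; _≈_ = _≋_ ; _+_ = _+P_ ; _*_ = _*P_ ; -_ = negP ; 0# = [] ; 1# = oneP
  ; isCommutativeRing = record
    { isRing = record
      { +-isAbelianGroup = record
        { isGroup = record
          { isMonoid = record
            { isSemigroup = record
              { isMagma = record { isEquivalence = ≋-isEquivalence ; ∙-cong = +P-cong }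
              ; assoc = +P-assoc
              }
            ; identity = (λ _ → ≋.refl) , λ p → +P-comm p []
            }
          ; inverse = (λ p → ≋.trans (+P-comm (negP p) p) (+P-inverseʳ p)) , +P-inverseʳ
          ; ⁻¹-cong = negP-cong
          }
        ; comm = +P-comm
        }
      ; *-cong = *P-cong
      ; *-assoc = *P-assoc
      ; *-identity = *P-identityˡ , λ p → ≋.trans (*P-comm p oneP) (*P-identityˡ p)
      ; distrib = (λ r p q → ≋.trans (*P-comm r (p +P q)) (≋.trans (*P-distribʳ-+P r p q) (+P-cong (*P-comm p r) (*P-comm q r)))) , *P-distribʳ-+P
      }
    ; *-comm = *P-comm
    }
  }

≋⇒≈P : ∀ {p q} → p ≋ q → p ≈P q
≋⇒≈P {p} {q} p≋q = zeros (p -P q) λ i → ≡.trans (coeff-+ p (negP q) i)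
  (≡.trans (≡.cong₂ ℤ._+_ (at p≋q i) (coeff-neg q i)) (ℤₚ.+-inverseʳ (coeff q i)))
  where
  zeros : ∀ p → (∀ i → coeff p i ≡ 0ℤ) → IsZeroP p
  zeros []      h = []
  zeros (a ∷ p) h = h 0 ∷ zeros p (λ i → h (suc i))

module Polys where
  open CommutativeRing polyRing public
    using (setoid; refl; sym; trans; reflexive; +-congˡ; +-congʳ; *-congˡ; *-congʳ; +-cong; *-cong; -‿cong; zeroˡ; zeroʳ; *-identityˡ; *-identityʳ; +-identityʳ; *-comm; +-comm; *-assoc; -‿inverseʳ)
  open IntegerCoefficients polyRing public using (solve; _:=_; _:+_; _:*_; _:-_; :-_; con)

-- Exactness of long division by monic polynomials

module MonicDivision where
  open Polys
  open import Relation.Binary.Reasoning.Setoid setoid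

  length-+P : ∀ p q → length (p +P q) ≡ length p ℕ.⊔ length q
  length-+P []      q       = ≡.refl
  length-+P (a ∷ p) []      = ≡.refl
  length-+P (a ∷ p) (b ∷ q) = ≡.cong suc (length-+P p q)

  length-*P : ∀ a p b q → length ((a ∷ p) *P (b ∷ q)) ≡ suc (length p ℕ.+ length q)
  length-*P a []      b q = ≡.cong suc (≡.trans (length-+P (scaleP a q) []) (≡.trans (ℕₚ.⊔-identityʳ _) (Listₚ.length-map (a ℤ.*_) q)))
  length-*P a (c ∷ p) b q = ≡.cong suc (≡.trans (length-+P (scaleP a q) ((c ∷ p) *P (b ∷ q)))
    (≡.trans (≡.cong₂ ℕ._⊔_ (Listₚ.length-map (a ℤ.*_) q) (length-*P c p b q))
      (ℕₚ.m≤n⇒m⊔n≡n (ℕₚ.m≤n+m (length q) (suc (length p))))))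

  coeff-length : ∀ p i → length p ℕ.≤ i → coeff p i ≡ 0ℤ
  coeff-length []      i       _       = ≡.refl
  coeff-length (a ∷ p) (suc i) (ℕ.s≤s l) = coeff-length p i l

  coeff-∷ʳ : ∀ p c → coeff (p ∷ʳ c) (length p) ≡ c
  coeff-∷ʳ []      c = ≡.refl
  coeff-∷ʳ (a ∷ p) c = coeff-∷ʳ p c

  unsnoc : ∀ p d → length p ≡ suc d → ∃ λ p′ → p ≡ p′ ∷ʳ coeff p d
  unsnoc (a ∷ [])    zero    _  = [] , ≡.refl
  unsnoc (a ∷ b ∷ p) (suc d) eq = let (p′ , eq′) = unsnoc (b ∷ p) d (ℕₚ.suc-injective eq) in a ∷ p′ , ≡.cong (a ∷_) eq′

  -- As a list: the last entry is 1, so there are no trailing zeros.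
  Monic : Poly → Set
  Monic p = ∃ λ p′ → p ≡ p′ ∷ʳ 1ℤ

  private
    coeff-*-top : ∀ p q → coeff ((p ∷ʳ 1ℤ) *P (q ∷ʳ 1ℤ)) (length p ℕ.+ length q) ≡ 1ℤ
    coeff-*-top [] q = ≡.trans (_≋_.at (*P-identityˡ (q ∷ʳ 1ℤ)) (length q)) (coeff-∷ʳ q 1ℤ)
    coeff-*-top (a ∷ p) q = ≡.trans (coeff-*-suc a (p ∷ʳ 1ℤ) (q ∷ʳ 1ℤ) (length p ℕ.+ length q)) (≡.trans
      (≡.cong₂ (λ x y → a ℤ.* x ℤ.+ y)
        (coeff-length (q ∷ʳ 1ℤ) _ (ℕₚ.≤-trans (ℕₚ.≤-reflexive (≡.trans (Listₚ.length-++ q) (ℕₚ.+-comm (length q) 1)))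
          (ℕ.s≤s (ℕₚ.m≤n+m (length q) (length p)))))
        (coeff-*-top p q))
      (≡.cong (ℤ._+ 1ℤ) (ℤₚ.*-zeroʳ a)))

  ∷ʳ-∷ : ∀ p (c : ℤ) → ∃ λ a → ∃ λ p′ → p ∷ʳ c ≡ a ∷ p′ × length p′ ≡ length p
  ∷ʳ-∷ []      c = c , [] , ≡.refl , ≡.refl
  ∷ʳ-∷ (a ∷ p) c = a , p ∷ʳ c , ≡.refl , ≡.trans (Listₚ.length-++ p) (ℕₚ.+-comm (length p) 1)

  Monic-* : ∀ {p q} → Monic p → Monic q → Monic (p *P q)
  Monic-* (p , ≡.refl) (q , ≡.refl) =
    let (r , eq) = unsnoc ((p ∷ʳ 1ℤ) *P (q ∷ʳ 1ℤ)) (length p ℕ.+ length q) len in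
    r , ≡.trans eq (≡.cong (r ∷ʳ_) (coeff-*-top p q))
    where
    len : length ((p ∷ʳ 1ℤ) *P (q ∷ʳ 1ℤ)) ≡ suc (length p ℕ.+ length q)
    len with ∷ʳ-∷ p 1ℤ | ∷ʳ-∷ q 1ℤ
    ... | a , p′ , eqp , lp | b , q′ , eqq , lq rewrite eqp | eqq =
      ≡.trans (length-*P a p′ b q′) (≡.cong₂ (λ x y → suc (x ℕ.+ y)) lp lq)

  private
    *-zero-coeffs : ∀ u g → (∀ i → coeff u i ≡ 0ℤ) → ∀ i → coeff (u *P g) i ≡ 0ℤ
    *-zero-coeffs u g h i = _≋_.at (*P-cong {u} {[]} {g} {g} (coeffwise h) ≋.refl) i

  -- No nonzero multiple of a monic g has degree below deg g. Once the tail of u is known to vanish,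
  -- its remaining entry a appears as a · 1 in degree deg g of the product, so it is 0 as well. This
  -- yields cancellation of g and uniqueness of quotients.
  Monic-vanish : ∀ {g} ((g′ , _) : Monic g) u → (∀ i → length g′ ℕ.≤ i → coeff (u *P g) i ≡ 0ℤ) → u ≋ []
  Monic-vanish {g} (g′ , ≡.refl) u h = coeffwise (vanish u h)
    where
    vanish : ∀ u → (∀ i → length g′ ℕ.≤ i → coeff (u *P g) i ≡ 0ℤ) → ∀ i → coeff u i ≡ 0ℤ
    vanish []      h i = ≡.refl
    vanish (a ∷ u) h = λ { zero → a≡0 (length g′) ≡.refl ; (suc i) → tail i }
      where
      tail : ∀ i → coeff u i ≡ 0ℤ
      tail = vanish u λ i l → ≡.trans (≡.sym (≡.trans
          (≡.cong (λ x → a ℤ.* x ℤ.+ coeff (u *P g) i) (coeff-length g (suc i)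
            (ℕₚ.≤-trans (ℕₚ.≤-reflexive (≡.trans (Listₚ.length-++ g′) (ℕₚ.+-comm (length g′) 1))) (ℕ.s≤s l))))
          (≡.trans (≡.cong (ℤ._+ coeff (u *P g) i) (ℤₚ.*-zeroʳ a)) (ℤₚ.+-identityˡ _))))
        (≡.trans (≡.sym (coeff-*-suc a u g i)) (h (suc i) (ℕₚ.m≤n⇒m≤1+n l)))
      a*top : a ℤ.* coeff g (length g′) ≡ a
      a*top = ≡.trans (≡.cong (λ x → a ℤ.* x) (coeff-∷ʳ g′ 1ℤ)) (ℤₚ.*-identityʳ a)
      a≡0 : ∀ k → k ≡ length g′ → a ≡ 0ℤ
      a≡0 zero    eq = ≡.trans (≡.sym (≡.trans (≡.cong (λ k → a ℤ.* coeff g k) eq) a*top))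
        (≡.trans (≡.sym (coeff-*-zero a u g)) (h 0 (ℕₚ.≤-reflexive (≡.sym eq))))
      a≡0 (suc k) eq = ≡.trans (≡.sym (≡.trans (≡.cong (λ k → a ℤ.* coeff g k) eq) a*top))
        (≡.trans (≡.sym (≡.trans (≡.cong (λ x → a ℤ.* coeff g (suc k) ℤ.+ x) (*-zero-coeffs u g tail k)) (ℤₚ.+-identityʳ _)))
          (≡.trans (≡.sym (coeff-*-suc a u g k)) (h (suc k) (ℕₚ.≤-reflexive (≡.sym eq)))))

  Monic-cancelʳ : ∀ {g} → Monic g → ∀ u v → u *P g ≋ v *P g → u ≋ v
  Monic-cancelʳ {g} mon u v eq = begin
    u                ≈⟨ solve 2 (λ u v → u := u :- v :+ v) refl u v ⟩
    (u -P v) +P v    ≈⟨ +-congʳ (Monic-vanish mon (u -P v) (λ i _ → _≋_.at zero′ i)) ⟩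
    v                ∎
    where
    zero′ : (u -P v) *P g ≋ []
    zero′ = begin
      (u -P v) *P g             ≈⟨ solve 3 (λ u v g → (u :- v) :* g := u :* g :- v :* g) refl u v g ⟩
      (u *P g) -P (v *P g)      ≈⟨ +-congʳ eq ⟩
      (v *P g) -P (v *P g)      ≈⟨ -‿inverseʳ (v *P g) ⟩
      []                        ∎

  XP-+ : ∀ m n → XP (m ℕ.+ n) ≋ XP m *P XP n
  XP-+ zero    n = sym (*-identityˡ (XP n))
  XP-+ (suc m) n = coeffwise λ
    { zero    → ≡.sym (coeff-*-zero 0ℤ (XP m) (XP n))
    ; (suc i) → ≡.trans (_≋_.at (XP-+ m n) i) (≡.sym (≡.trans (coeff-*-suc 0ℤ (XP m) (XP n) i) (ℤₚ.+-identityˡ _))) }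

  constP-+ : ∀ a b → constP (a ℤ.+ b) ≋ constP a +P constP b
  constP-+ a b = refl

  constP-*-hom : ∀ a b → constP (a ℤ.* b) ≋ constP a *P constP b
  constP-*-hom a b = sym (constP-* a (constP b))

  constP-neg : ∀ a → constP (ℤ.- a) ≋ negP (constP a)
  constP-neg a = reflexive (≡.cong constP (≡.sym (ℤₚ.-1*i≡-i a)))

  bigEndian : List ℤ → Poly
  bigEndian []       = []
  bigEndian (c ∷ fs) = (constP c *P XP (length fs)) +P bigEndian fs

  private
    ∷ʳ-value : ∀ p c → p ∷ʳ c ≋ p +P (constP c *P XP (length p))
    ∷ʳ-value p c = trans (direct p) (+-congˡ {p} (sym (constP-* c (XP (length p)))))
      where
      direct : ∀ p → p ∷ʳ c ≋ p +P scaleP c (XP (length p))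
      direct []      = reflexive (≡.cong constP (≡.sym (ℤₚ.*-identityʳ c)))
      direct (a ∷ p) = coeffwise λ
        { zero    → ≡.sym (≡.trans (≡.cong (λ z → a ℤ.+ z) (ℤₚ.*-zeroʳ c)) (ℤₚ.+-identityʳ a))
        ; (suc i) → _≋_.at (direct p) i }

  reverse-value : ∀ xs → reverse xs ≋ bigEndian xs
  reverse-value []       = refl
  reverse-value (c ∷ fs) = begin
    reverse (c ∷ fs)                                              ≡⟨ Listₚ.unfold-reverse c fs ⟩
    reverse fs ∷ʳ c                                               ≈⟨ ∷ʳ-value (reverse fs) c ⟩
    reverse fs +P (constP c *P XP (length (reverse fs)))          ≡⟨ ≡.cong (λ l → reverse fs +P (constP c *P XP l)) (Listₚ.length-reverse fs) ⟩
    reverse fs +P (constP c *P XP (length fs))                    ≈⟨ +-congʳ (reverse-value fs) ⟩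
    bigEndian fs +P (constP c *P XP (length fs))                  ≈⟨ +-comm (bigEndian fs) _ ⟩
    bigEndian (c ∷ fs)                                            ∎

  private
    length-subFront : ∀ xs ys → length ys ℕ.≤ length xs → length (subFront xs ys) ≡ length xs
    length-subFront xs       []       _         = ≡.refl
    length-subFront (x ∷ xs) (y ∷ ys) (ℕ.s≤s l) = ≡.cong suc (length-subFront xs ys l)

    subFront-value : ∀ xs ys e → length ys ℕ.+ e ≡ length xs →
                     bigEndian (subFront xs ys) ≋ bigEndian xs -P (bigEndian ys *P XP e)
    subFront-value xs []       e eq = solve 1 (λ x → x := x :- con 0ℤ) refl (bigEndian xs)
    subFront-value (x ∷ xs) (y ∷ ys) e eq = begin
      (constP (x ℤ.- y) *P XP (length (subFront xs ys))) +P bigEndian (subFront xs ys)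
        ≈⟨ +-cong (*-congˡ {constP (x ℤ.- y)} (reflexive (≡.cong XP (≡.trans (length-subFront xs ys le) (≡.sym eq′))))) (subFront-value xs ys e eq′) ⟩
      (constP (x ℤ.- y) *P XP (length ys ℕ.+ e)) +P (bigEndian xs -P (bigEndian ys *P XP e))
        ≈⟨ +-congʳ {bigEndian xs -P (bigEndian ys *P XP e)} (*-cong (trans (constP-+ x (ℤ.- y)) (+-congˡ {constP x} (constP-neg y))) (XP-+ (length ys) e)) ⟩
      ((constP x -P constP y) *P (XP (length ys) *P XP e)) +P (bigEndian xs -P (bigEndian ys *P XP e))
        ≈⟨ solve 6 (λ x y l e p q → (x :- y) :* (l :* e) :+ (p :- q :* e) := x :* (l :* e) :+ p :- (y :* l :+ q) :* e) refl
             (constP x) (constP y) (XP (length ys)) (XP e) (bigEndian xs) (bigEndian ys) ⟩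
      ((constP x *P (XP (length ys) *P XP e)) +P bigEndian xs) -P (bigEndian (y ∷ ys) *P XP e)
        ≈⟨ +-congʳ {negP (bigEndian (y ∷ ys) *P XP e)} (+-congʳ {bigEndian xs} (*-congˡ {constP x} (trans (sym (XP-+ (length ys) e)) (reflexive (≡.cong XP eq′))))) ⟩
      bigEndian (x ∷ xs) -P (bigEndian (y ∷ ys) *P XP e)  ∎
      where
      eq′ : length ys ℕ.+ e ≡ length xs
      eq′ = ℕₚ.suc-injective eq
      le : length ys ℕ.≤ length xs
      le = ℕₚ.≤-trans (ℕₚ.m≤m+n (length ys) e) (ℕₚ.≤-reflexive eq′)

    scale-value : ∀ c ys → bigEndian (map (c ℤ.*_) ys) ≋ constP c *P bigEndian ys
    scale-value c []       = sym (zeroʳ (constP c))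
    scale-value c (y ∷ ys) = begin
      (constP (c ℤ.* y) *P XP (length (map (c ℤ.*_) ys))) +P bigEndian (map (c ℤ.*_) ys)
        ≈⟨ +-cong (*-cong (constP-*-hom c y) (reflexive (≡.cong XP (Listₚ.length-map (c ℤ.*_) ys)))) (scale-value c ys) ⟩
      (constP c *P constP y *P XP (length ys)) +P (constP c *P bigEndian ys)
        ≈⟨ solve 4 (λ c y l p → c :* y :* l :+ c :* p := c :* (y :* l :+ p)) refl (constP c) (constP y) (XP (length ys)) (bigEndian ys) ⟩
      constP c *P bigEndian (y ∷ ys)  ∎

    coeff-bigEndian : ∀ xs i → length xs ℕ.≤ i → coeff (bigEndian xs) i ≡ 0ℤ
    coeff-bigEndian xs i l = ≡.trans (≡.sym (_≋_.at (reverse-value xs) i))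
      (coeff-length (reverse xs) i (ℕₚ.≤-trans (ℕₚ.≤-reflexive (Listₚ.length-reverse xs)) l))

  -- In a big-endian list the weight of an entry is set by the number of entries after it, so the
  -- length of the quotient has to be carried through the induction together with the division
  -- identity.
  divBE-correct : ∀ k f gt → length f ℕ.≤ k →
    length (divBE k f gt) ≡ length f ∸ length gt ×
    ∃ λ ρ → (∀ i → length gt ℕ.≤ i → coeff ρ i ≡ 0ℤ) ×
            bigEndian f ≋ (bigEndian (1ℤ ∷ gt) *P bigEndian (divBE k f gt)) +P ρ
  divBE-correct zero    []       gt _ = ≡.sym (ℕₚ.0∸n≡0 (length gt)) , [] , (λ _ _ → ≡.refl) ,
    solve 1 (λ g → con 0ℤ := g :* con 0ℤ :+ con 0ℤ) refl (bigEndian (1ℤ ∷ gt))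
  divBE-correct (suc k) []       gt _ = ≡.sym (ℕₚ.0∸n≡0 (length gt)) , [] , (λ _ _ → ≡.refl) ,
    solve 1 (λ g → con 0ℤ := g :* con 0ℤ :+ con 0ℤ) refl (bigEndian (1ℤ ∷ gt))
  divBE-correct (suc k) (c ∷ fs) gt (ℕ.s≤s l) with length gt ℕ.≤? length fs
  ... | no  gt≰fs = ≡.sym (ℕₚ.m≤n⇒m∸n≡0 (ℕₚ.≰⇒> gt≰fs)) , bigEndian (c ∷ fs) ,
    (λ i l → coeff-bigEndian (c ∷ fs) i (ℕₚ.≤-trans (ℕₚ.≰⇒> gt≰fs) l)) ,
    solve 2 (λ f g → f := g :* con 0ℤ :+ f) refl (bigEndian (c ∷ fs)) (bigEndian (1ℤ ∷ gt))
  ... | yes gt≤fs with divBE-correct k (subFront fs (map (c ℤ.*_) gt)) gt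
                         (ℕₚ.≤-trans (ℕₚ.≤-reflexive (length-subFront fs (map (c ℤ.*_) gt) (ℕₚ.≤-trans (ℕₚ.≤-reflexive (Listₚ.length-map (c ℤ.*_) gt)) gt≤fs))) l)
  ... | len , ρ , small , value =
    ≡.trans (≡.cong suc len′) (≡.sym (ℕₚ.+-∸-assoc 1 gt≤fs)) , ρ , small , (begin
      (constP c *P XP (length fs)) +P bigEndian fs
        ≈⟨ +-congʳ {bigEndian fs} (*-congˡ {constP c} (trans (reflexive (≡.cong XP (≡.sym (ℕₚ.m+[n∸m]≡n gt≤fs)))) (XP-+ (length gt) e))) ⟩
      (constP c *P (XP (length gt) *P XP e)) +P bigEndian fs
        ≈⟨ solve 5 (λ c x e f g → c :* (x :* e) :+ f := (con 1ℤ :* x :+ g) :* (c :* e) :+ (f :- c :* g :* e)) refl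
             (constP c) (XP (length gt)) (XP e) (bigEndian fs) (bigEndian gt) ⟩
      (G *P (constP c *P XP e)) +P (bigEndian fs -P (constP c *P bigEndian gt *P XP e))
        ≈⟨ +-congˡ {G *P (constP c *P XP e)} (+-congˡ {bigEndian fs} (-‿cong (*-congʳ (scale-value c gt)))) ⟨
      (G *P (constP c *P XP e)) +P (bigEndian fs -P (bigEndian (map (c ℤ.*_) gt) *P XP e))
        ≈⟨ +-congˡ {G *P (constP c *P XP e)} (subFront-value fs (map (c ℤ.*_) gt) e (≡.trans (≡.cong (ℕ._+ e) (Listₚ.length-map (c ℤ.*_) gt)) (ℕₚ.m+[n∸m]≡n gt≤fs))) ⟨
      (G *P (constP c *P XP e)) +P bigEndian (subFront fs (map (c ℤ.*_) gt))
        ≈⟨ +-cong (*-congˡ {G} (*-congˡ {constP c} (reflexive (≡.cong XP (≡.sym len′))))) value ⟩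
      (G *P (constP c *P XP (length Q))) +P ((G *P bigEndian Q) +P ρ)
        ≈⟨ solve 4 (λ g x q r → g :* x :+ (g :* q :+ r) := g :* (x :+ q) :+ r) refl G (constP c *P XP (length Q)) (bigEndian Q) ρ ⟩
      (G *P bigEndian (c ∷ Q)) +P ρ  ∎)
    where
    e = length fs ∸ length gt
    G = bigEndian (1ℤ ∷ gt)
    Q = divBE k (subFront fs (map (c ℤ.*_) gt)) gt
    len′ : length Q ≡ e
    len′ = ≡.trans len (≡.cong (_∸ length gt) (length-subFront fs (map (c ℤ.*_) gt)
      (ℕₚ.≤-trans (ℕₚ.≤-reflexive (Listₚ.length-map (c ℤ.*_) gt)) gt≤fs)))

  private
    reverse-Monic : ∀ p → reverse (p ∷ʳ 1ℤ) ≡ 1ℤ ∷ reverse p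
    reverse-Monic p = Listₚ.reverse-++ p (1ℤ ∷ [])

    normP-Monic : ∀ {p} → Monic p → normP p ≡ p
    normP-Monic (p , ≡.refl) rewrite reverse-Monic p =
      ≡.trans (≡.cong reverse (≡.sym (reverse-Monic p))) (Listₚ.reverse-involutive (p ∷ʳ 1ℤ))

    divMonicP-Monic : ∀ f g → Monic f →
      divMonicP f (g ∷ʳ 1ℤ) ≡ reverse (divBE (length f) (reverse f) (reverse g))
    divMonicP-Monic f g mf rewrite normP-Monic {g ∷ʳ 1ℤ} (g , ≡.refl) | reverse-Monic g | normP-Monic mf = ≡.refl

  constP-torsion-free : ∀ {c} → c ≢ 0ℤ → ∀ p → constP c *P p ≋ [] → p ≋ []
  constP-torsion-free {c} c≢0 p eq = coeffwise λ i →
    ℤₚ.*-cancelˡ-≡ c (coeff p i) 0ℤ {{ℤ.≢-nonZero c≢0}} (≡.trans (≡.sym (coeff-scale c p i))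
      (≡.trans (≡.sym (_≋_.at (constP-* c p) i)) (≡.trans (_≋_.at eq i) (≡.sym (ℤₚ.*-zeroʳ c)))))

  -- Divisibility of f by g is available only up to a nonzero integer c. Comparing g K = c f with f
  -- = g · quotient + ρ gives (K - c · quotient) g = c ρ, of degree below deg g. Hence both sides
  -- vanish, and ρ = 0 because ℤ[q] is torsion-free.
  divMonicP-exact : ∀ {f g} → Monic f → Monic g → ∀ {c} → c ≢ 0ℤ → ∀ K → g *P K ≋ constP c *P f →
                    Monic (divMonicP f g) × divMonicP f g *P g ≋ f
  divMonicP-exact {f} {g} mf@(f′ , eqf) mg@(g′ , ≡.refl) {c} c≢0 K gK≋cf
    rewrite divMonicP-Monic f g′ mf = quotient-Monic , (begin
      reverse Q *P g               ≈⟨ solve 3 (λ q g r → q :* g := g :* q :+ con 0ℤ) refl (reverse Q) g [] ⟩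
      (g *P reverse Q) +P []       ≈⟨ +-congˡ {g *P reverse Q} ρ≋0 ⟨
      (g *P reverse Q) +P ρ        ≈⟨ f≋ ⟨
      f                            ∎)
    where
    Q = divBE (length f) (reverse f) (reverse g′)
    correct = divBE-correct (length f) (reverse f) (reverse g′) (ℕₚ.≤-reflexive (Listₚ.length-reverse f))
    ρ = proj₁ (proj₂ correct)

    f≋ : f ≋ (g *P reverse Q) +P ρ
    f≋ = begin
      f                                                                ≡⟨ Listₚ.reverse-involutive f ⟨
      reverse (reverse f)                                              ≈⟨ reverse-value (reverse f) ⟩
      bigEndian (reverse f)                                            ≈⟨ proj₂ (proj₂ (proj₂ correct)) ⟩
      (bigEndian (1ℤ ∷ reverse g′) *P bigEndian Q) +P ρ                ≈⟨ +-congʳ (*-cong (reverse-value (1ℤ ∷ reverse g′)) (reverse-value Q)) ⟨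
      (reverse (1ℤ ∷ reverse g′) *P reverse Q) +P ρ
        ≡⟨ ≡.cong (λ h → (h *P reverse Q) +P ρ) (≡.trans (≡.cong reverse (≡.sym (reverse-Monic g′))) (Listₚ.reverse-involutive g)) ⟩
      (g *P reverse Q) +P ρ                                            ∎

    difference : (K -P (constP c *P reverse Q)) *P g ≋ constP c *P ρ
    difference = begin
      (K -P (constP c *P reverse Q)) *P g
        ≈⟨ solve 4 (λ k c q g → (k :- c :* q) :* g := g :* k :- c :* (g :* q)) refl K (constP c) (reverse Q) g ⟩
      (g *P K) -P (constP c *P (g *P reverse Q))
        ≈⟨ +-congʳ {negP (constP c *P (g *P reverse Q))} (trans gK≋cf (*-congˡ {constP c} f≋)) ⟩
      (constP c *P ((g *P reverse Q) +P ρ)) -P (constP c *P (g *P reverse Q))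
        ≈⟨ solve 3 (λ c x r → c :* (x :+ r) :- c :* x := c :* r) refl (constP c) (g *P reverse Q) ρ ⟩
      constP c *P ρ  ∎

    K≋cQ : K -P (constP c *P reverse Q) ≋ []
    K≋cQ = Monic-vanish mg _ λ i l → ≡.trans (_≋_.at difference i) (≡.trans (_≋_.at (constP-* c ρ) i)
      (≡.trans (coeff-scale c ρ i) (≡.trans (≡.cong (λ z → c ℤ.* z)
        (proj₁ (proj₂ (proj₂ correct)) i (ℕₚ.≤-trans (ℕₚ.≤-reflexive (Listₚ.length-reverse g′)) l))) (ℤₚ.*-zeroʳ c))))

    ρ≋0 : ρ ≋ []
    ρ≋0 = constP-torsion-free c≢0 ρ (trans (sym difference) (trans (*-congʳ K≋cQ) (zeroˡ g)))

    quotient-Monic : Monic (reverse Q)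
    quotient-Monic with Q in eqQ
    ... | []     = contradiction (≡.trans (≡.sym (coeff-∷ʳ f′ 1ℤ)) (≡.trans (≡.cong (λ p → coeff p (length f′)) (≡.sym eqf))
                     (_≋_.at f≋0 (length f′)))) λ ()
      where
      f≋0 : f ≋ []
      f≋0 = trans f≋ (trans (+-cong (*-congˡ {g} (reflexive (≡.cong reverse eqQ))) ρ≋0) (trans (+-identityʳ (g *P [])) (zeroʳ g)))
    ... | x ∷ Q′ = reverse Q′ , ≡.trans (Listₚ.unfold-reverse x Q′) (≡.cong (reverse Q′ ∷ʳ_) (head≡1 (length f) (reverse f) (≡.trans (≡.cong reverse eqf) (reverse-Monic f′)) eqQ))
      where
      head≡1 : ∀ k ys {ys′} → ys ≡ 1ℤ ∷ ys′ → divBE k ys (reverse g′) ≡ x ∷ Q′ → x ≡ 1ℤ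
      head≡1 (suc k) .(1ℤ ∷ ys′) {ys′} ≡.refl eq with length (reverse g′) ℕ.≤? length ys′
      head≡1 (suc k) .(1ℤ ∷ ys′) {ys′} ≡.refl ≡.refl | yes _ = ≡.refl

open MonicDivision

-- Cyclotomic polynomials

module Cyclotomic where
  open Polys
  open import Relation.Binary.Reasoning.Setoid setoid

  divisorStep : ℕ → ℕ × Poly → Poly → Poly
  divisorStep m (i , φ) acc with suc i ∣? m
  ... | yes _ = φ *P acc
  ... | no  _ = acc

  step≡ : ∀ m tbl x acc → _ ≡ divisorStep m x acc

  -- This equation is what determines the unnamed function in the type of step≡: the local step of properDivProd.
  properDivProd≡ : ∀ m tbl → properDivProd m tbl ≡ foldr (divisorStep m) oneP (zip (upTo (length tbl)) tbl)
  properDivProd≡ m tbl = Listₚ.foldr-cong (step≡ m tbl) ≡.refl (zip (upTo (length tbl)) tbl)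

  step≡ m tbl (i , φ) acc with suc i ∣? m
  ... | yes _ = ≡.refl
  ... | no  _ = ≡.refl

  -- The product of Φ_i over the divisors i ≤ k of m, with one new index per step of k, as the
  -- inductions on k need it.
  ΦProd : ℕ → ℕ → Poly
  ΦProd m zero    = oneP
  ΦProd m (suc k) = divisorStep m (k , Φ (suc k)) (ΦProd m k)

  private
    lastOr-∷ʳ : ∀ d xs x → lastOr d (xs ∷ʳ x) ≡ x
    lastOr-∷ʳ d []           x = ≡.refl
    lastOr-∷ʳ d (y ∷ [])     x = ≡.refl
    lastOr-∷ʳ d (y ∷ z ∷ xs) x = lastOr-∷ʳ d (z ∷ xs) x

    Φ-suc : ∀ n → Φ (suc n) ≡ divMonicP (XP (suc n) -P oneP) (properDivProd (suc n) (cycTable n))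
    Φ-suc n = lastOr-∷ʳ oneP (cycTable n) _

    cycTable≡ : ∀ n → cycTable n ≡ map (Φ ∘ suc) (upTo n)
    cycTable≡ zero    = ≡.refl
    cycTable≡ (suc n) = ≡.trans (≡.cong₂ _∷ʳ_ (cycTable≡ n) (≡.sym (Φ-suc n)))
      (≡.trans (≡.sym (Listₚ.map-++ (Φ ∘ suc) (upTo n) (n ∷ []))) (≡.cong (map (Φ ∘ suc)) (Listₚ.upTo-∷ʳ n)))

    entry : ℕ → ℕ × Poly
    entry i = i , Φ (suc i)

    zip-map-self : ∀ xs → zip xs (map (Φ ∘ suc) xs) ≡ map entry xs
    zip-map-self []       = ≡.refl
    zip-map-self (x ∷ xs) = ≡.cong (entry x ∷_) (zip-map-self xs)

    table≡ : ∀ n → zip (upTo (length (cycTable n))) (cycTable n) ≡ map entry (upTo n)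
    table≡ n = ≡.trans (≡.cong₂ (λ l t → zip (upTo l) t)
        (≡.trans (≡.cong length (cycTable≡ n)) (≡.trans (Listₚ.length-map (Φ ∘ suc) (upTo n)) (Listₚ.length-upTo n)))
        (cycTable≡ n))
      (zip-map-self (upTo n))

    divisorStep-* : ∀ m x p q → p *P divisorStep m x q ≋ divisorStep m x p *P q
    divisorStep-* m (i , φ) p q with suc i ∣? m
    ... | yes _ = solve 3 (λ p f q → p :* (f :* q) := f :* p :* q) refl p φ q
    ... | no  _ = refl

    divisorStep-Monic : ∀ m k {p} → Monic (Φ (suc k)) → Monic p → Monic (divisorStep m (entry k) p)
    divisorStep-Monic m k mφ mp with suc k ∣? m
    ... | yes _ = Monic-* mφ mp
    ... | no  _ = mp

    fold : ℕ → ℕ → Poly → Poly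
    fold m k acc = foldr (divisorStep m) acc (map entry (upTo k))

    fold-suc : ∀ m k acc → fold m (suc k) acc ≡ fold m k (divisorStep m (entry k) acc)
    fold-suc m k acc = ≡.trans (≡.cong (foldr (divisorStep m) acc)
        (≡.trans (≡.cong (map entry) (≡.sym (Listₚ.upTo-∷ʳ k))) (Listₚ.map-++ entry (upTo k) (k ∷ []))))
      (Listₚ.foldr-∷ʳ (divisorStep m) acc (entry k) (map entry (upTo k)))

    fold-value : ∀ m k acc → fold m k acc ≋ ΦProd m k *P acc
    fold-value m zero    acc = sym (*-identityˡ acc)
    fold-value m (suc k) acc = begin
      fold m (suc k) acc                               ≡⟨ fold-suc m k acc ⟩
      fold m k (divisorStep m (entry k) acc)           ≈⟨ fold-value m k _ ⟩
      ΦProd m k *P divisorStep m (entry k) acc         ≈⟨ divisorStep-* m (entry k) (ΦProd m k) acc ⟩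
      ΦProd m (suc k) *P acc                           ∎

    fold-Monic : ∀ m k acc → (∀ i → i ℕ.< k → Monic (Φ (suc i))) → Monic acc → Monic (fold m k acc)
    fold-Monic m zero    acc mΦ ma = ma
    fold-Monic m (suc k) acc mΦ ma = ≡.subst Monic (≡.sym (fold-suc m k acc))
      (fold-Monic m k _ (λ i i<k → mΦ i (ℕₚ.m<n⇒m<1+n i<k)) (divisorStep-Monic m k (mΦ k ℕₚ.≤-refl) ma))

    properDivProd-fold : ∀ m n → properDivProd m (cycTable n) ≡ fold m n oneP
    properDivProd-fold m n = ≡.trans (properDivProd≡ m (cycTable n)) (≡.cong (foldr (divisorStep m) oneP) (table≡ n))

  infix 4 _∣P_
  _∣P_ : Poly → Poly → Set
  p ∣P q = ∃ λ w → q ≋ p *P w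

  ∣P-trans : ∀ {p q r} → p ∣P q → q ∣P r → p ∣P r
  ∣P-trans {p} {q} {r} (v , q≋) (w , r≋) = v *P w , trans r≋ (trans (*-congʳ {w} q≋) (*-assoc p v w))

  ∣P-resp : ∀ {p p′ q q′} → p ≋ p′ → q ≋ q′ → p ∣P q → p′ ∣P q′
  ∣P-resp p≋ q≋ (w , eq) = w , trans (sym q≋) (trans eq (*-congʳ {w} p≋))

  Xⁿ−1 : ℕ → Poly
  Xⁿ−1 n = XP n -P oneP

  Monic-X^-1 : ∀ n → Monic (Xⁿ−1 (suc n))
  Monic-X^-1 n = -1ℤ ∷ replicate n 0ℤ , ≡.cong (-1ℤ ∷_) (tail n)
    where
    tail : ∀ n → XP n +P [] ≡ XP n
    tail zero    = ≡.refl
    tail (suc n) = ≡.refl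

  -- The quotient (q^{tg} - 1)/(q^g - 1), a sum of t powers of q^g. Modulo q^g - 1 each of them is
  -- 1, so it is congruent to t.
  geometric : ℕ → ℕ → Poly
  geometric g zero    = []
  geometric g (suc t) = oneP +P (XP g *P geometric g t)

  geometric-* : ∀ g t → (Xⁿ−1 (t ℕ.* g)) ≋ (Xⁿ−1 g) *P geometric g t
  geometric-* g zero    = trans (-‿inverseʳ oneP) (sym (zeroʳ (Xⁿ−1 g)))
  geometric-* g (suc t) = begin
    XP (g ℕ.+ t ℕ.* g) -P oneP                        ≈⟨ +-congʳ {negP oneP} (XP-+ g (t ℕ.* g)) ⟩
    (XP g *P XP (t ℕ.* g)) -P oneP
      ≈⟨ solve 2 (λ x y → x :* y :- con 1ℤ := (x :- con 1ℤ) :+ x :* (y :- con 1ℤ)) refl (XP g) (XP (t ℕ.* g)) ⟩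
    (Xⁿ−1 g) +P (XP g *P (Xⁿ−1 (t ℕ.* g)))                ≈⟨ +-congˡ {(Xⁿ−1 g)} (*-congˡ {XP g} (geometric-* g t)) ⟩
    (Xⁿ−1 g) +P (XP g *P ((Xⁿ−1 g) *P geometric g t))
      ≈⟨ solve 3 (λ p x w → p :+ x :* (p :* w) := p :* (con 1ℤ :+ x :* w)) refl (Xⁿ−1 g) (XP g) (geometric g t) ⟩
    (Xⁿ−1 g) *P geometric g (suc t)                    ∎

  X^-1-∣ : ∀ g t → Xⁿ−1 g ∣P Xⁿ−1 (t ℕ.* g)
  X^-1-∣ g t = geometric g t , geometric-* g t

  ∣⇒X^-1-∣ : ∀ {g m} → g ∣ m → (Xⁿ−1 g) ∣P (Xⁿ−1 m)
  ∣⇒X^-1-∣ {g} (divides t ≡.refl) = X^-1-∣ g t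

  geometric-mod : ∀ g t → (Xⁿ−1 g) ∣P geometric g t -P constP (+ t)
  geometric-mod g zero    = [] , trans (coeffwise λ { zero → ≡.refl ; (suc _) → ≡.refl }) (sym (zeroʳ (Xⁿ−1 g)))
  geometric-mod g (suc t) = let (w , eq) = geometric-mod g t in (XP g *P w) +P constP (+ t) , (begin
    (oneP +P (x *P G)) -P constP (1ℤ ℤ.+ + t)
      ≈⟨ +-congˡ {oneP +P (x *P G)} (-‿cong (constP-+ 1ℤ (+ t))) ⟩
    (oneP +P (x *P G)) -P (oneP +P T)
      ≈⟨ solve 3 (λ x g t → con 1ℤ :+ x :* g :- (con 1ℤ :+ t) := x :* (g :- t) :+ (x :- con 1ℤ) :* t) refl x G T ⟩
    (x *P (G -P T)) +P ((Xⁿ−1 g) *P T)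
      ≈⟨ +-congʳ {(Xⁿ−1 g) *P T} (*-congˡ {x} eq) ⟩
    (x *P ((Xⁿ−1 g) *P w)) +P ((Xⁿ−1 g) *P T)
      ≈⟨ solve 4 (λ x p w t → x :* (p :* w) :+ p :* t := p :* (x :* w :+ t)) refl x (Xⁿ−1 g) w T ⟩
    (Xⁿ−1 g) *P ((XP g *P w) +P constP (+ t))  ∎)
    where
    x = XP g
    G = geometric g t
    T = constP (+ t)

  -- Coprimality in ℚ[q], with denominators cleared.
  Coprime : Poly → Poly → Set
  Coprime D P = Σ Poly λ U → Σ Poly λ V → Σ ℤ λ c → c ≢ 0ℤ × (U *P D) +P (V *P P) ≋ constP c

  Coprime-sym : ∀ {D P} → Coprime D P → Coprime P D
  Coprime-sym {D} {P} (U , V , c , c≢0 , eq) = V , U , c , c≢0 , trans (+-comm (V *P P) (U *P D)) eq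

  *-≢0 : ∀ {a b} → a ≢ 0ℤ → b ≢ 0ℤ → a ℤ.* b ≢ 0ℤ
  *-≢0 {a} a≢0 b≢0 ab≡0 with ℤₚ.i*j≡0⇒i≡0∨j≡0 a ab≡0
  ... | inj₁ a≡0 = a≢0 a≡0
  ... | inj₂ b≡0 = b≢0 b≡0

  Coprime-* : ∀ {D E P} → Coprime D P → Coprime E P → Coprime (D *P E) P
  Coprime-* {D} {E} {P} (U , V , a , a≢0 , eqa) (U′ , V′ , b , b≢0 , eqb) =
    U *P U′ , (V *P (U′ *P E)) +P (V′ *P constP a) , a ℤ.* b , *-≢0 a≢0 b≢0 , (begin
      (U *P U′ *P (D *P E)) +P (((V *P (U′ *P E)) +P (V′ *P constP a)) *P P)
        ≈⟨ solve 8 (λ u v d p u′ v′ e a → u :* u′ :* (d :* e) :+ (v :* (u′ :* e) :+ v′ :* a) :* p :=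
             (u :* d :+ v :* p) :* (u′ :* e) :+ a :* (v′ :* p)) refl U V D P U′ V′ E (constP a) ⟩
      (((U *P D) +P (V *P P)) *P (U′ *P E)) +P (constP a *P (V′ *P P))
        ≈⟨ +-congʳ {constP a *P (V′ *P P)} (*-congʳ {U′ *P E} eqa) ⟩
      (constP a *P (U′ *P E)) +P (constP a *P (V′ *P P))
        ≈⟨ solve 3 (λ a x y → a :* x :+ a :* y := a :* (x :+ y)) refl (constP a) (U′ *P E) (V′ *P P) ⟩
      constP a *P ((U′ *P E) +P (V′ *P P))
        ≈⟨ *-congˡ {constP a} eqb ⟩
      constP a *P constP b
        ≈⟨ constP-*-hom a b ⟨
      constP (a ℤ.* b)  ∎)

  Coprime-∣ˡ : ∀ {D E P} → D ∣P E → Coprime E P → Coprime D P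
  Coprime-∣ˡ {D} {E} {P} (w , E≋) (U , V , c , c≢0 , eq) = U *P w , V , c , c≢0 , (begin
    (U *P w *P D) +P (V *P P)    ≈⟨ +-congʳ {V *P P} (solve 3 (λ u w d → u :* w :* d := u :* (d :* w)) refl U w D) ⟩
    (U *P (D *P w)) +P (V *P P)  ≈⟨ +-congʳ {V *P P} (*-congˡ {U} E≋) ⟨
    (U *P E) +P (V *P P)         ≈⟨ eq ⟩
    constP c                     ∎)

  Coprime-oneP : ∀ P → Coprime oneP P
  Coprime-oneP P = oneP , [] , 1ℤ , (λ ()) , solve 1 (λ p → con 1ℤ :* con 1ℤ :+ con 0ℤ :* p := con 1ℤ) refl P

  -- Bézout in the exponents: from g + yj = xd follows q^g - 1 = (q^{xd} - 1) - q^g (q^{yj} - 1),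
  -- and the two differences are multiples of q^d - 1 and q^j - 1.
  X^gcd-1 : ∀ d j → ∃ λ α → ∃ λ β → (Xⁿ−1 (gcd d j)) ≋ (α *P (Xⁿ−1 d)) +P (β *P (Xⁿ−1 j))
  X^gcd-1 d j with Bézout.identity (gcd-GCD d j)
  ... | Bézout.+- x y eq = let (v , x≋) = X^-1-∣ d x ; (w , y≋) = X^-1-∣ j y in
    v , negP (XP (gcd d j) *P w) , (begin
      (Xⁿ−1 (gcd d j))
        ≈⟨ solve 2 (λ g y → g :- con 1ℤ := (g :* y :- con 1ℤ) :- g :* (y :- con 1ℤ)) refl (XP (gcd d j)) (XP (y ℕ.* j)) ⟩
      ((XP (gcd d j) *P XP (y ℕ.* j)) -P oneP) -P (XP (gcd d j) *P (Xⁿ−1 (y ℕ.* j)))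
        ≈⟨ +-cong (+-congʳ {negP oneP} (trans (sym (XP-+ (gcd d j) (y ℕ.* j))) (reflexive (≡.cong XP eq)))) (-‿cong (*-congˡ {XP (gcd d j)} y≋)) ⟩
      (Xⁿ−1 (x ℕ.* d)) -P (XP (gcd d j) *P ((Xⁿ−1 j) *P w))
        ≈⟨ +-congʳ {negP (XP (gcd d j) *P ((Xⁿ−1 j) *P w))} x≋ ⟩
      ((Xⁿ−1 d) *P v) -P (XP (gcd d j) *P ((Xⁿ−1 j) *P w))
        ≈⟨ solve 5 (λ d v g j w → d :* v :- g :* (j :* w) := v :* d :+ (:- (g :* w)) :* j) refl (Xⁿ−1 d) v (XP (gcd d j)) (Xⁿ−1 j) w ⟩
      (v *P (Xⁿ−1 d)) +P (negP (XP (gcd d j) *P w) *P (Xⁿ−1 j))  ∎)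
  ... | Bézout.-+ x y eq = let (v , x≋) = X^-1-∣ d x ; (w , y≋) = X^-1-∣ j y in
    negP (XP (gcd d j) *P v) , w , (begin
      (Xⁿ−1 (gcd d j))
        ≈⟨ solve 2 (λ g x → g :- con 1ℤ := (g :* x :- con 1ℤ) :- g :* (x :- con 1ℤ)) refl (XP (gcd d j)) (XP (x ℕ.* d)) ⟩
      ((XP (gcd d j) *P XP (x ℕ.* d)) -P oneP) -P (XP (gcd d j) *P (Xⁿ−1 (x ℕ.* d)))
        ≈⟨ +-cong (+-congʳ {negP oneP} (trans (sym (XP-+ (gcd d j) (x ℕ.* d))) (reflexive (≡.cong XP eq)))) (-‿cong (*-congˡ {XP (gcd d j)} x≋)) ⟩
      (Xⁿ−1 (y ℕ.* j)) -P (XP (gcd d j) *P ((Xⁿ−1 d) *P v))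
        ≈⟨ +-congʳ {negP (XP (gcd d j) *P ((Xⁿ−1 d) *P v))} y≋ ⟩
      ((Xⁿ−1 j) *P w) -P (XP (gcd d j) *P ((Xⁿ−1 d) *P v))
        ≈⟨ solve 5 (λ d v g j w → j :* w :- g :* (d :* v) := (:- (g :* v)) :* d :+ w :* j) refl (Xⁿ−1 d) v (XP (gcd d j)) (Xⁿ−1 j) w ⟩
      (negP (XP (gcd d j) *P v) *P (Xⁿ−1 d)) +P (w *P (Xⁿ−1 j))  ∎)

  private
    divisorStep-∣ : ∀ {m m′} k {p q} → m ∣ m′ → p ∣P q → divisorStep m (entry k) p ∣P divisorStep m′ (entry k) q
    divisorStep-∣ {m} {m′} k {p} {q} m∣m′ (w , eq) with suc k ∣? m | suc k ∣? m′
    ... | yes _  | yes _  = w , trans (*-congˡ {Φ (suc k)} eq) (sym (*-assoc (Φ (suc k)) p w))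
    ... | yes km | no  k∤ = contradiction (∣-trans km m∣m′) k∤
    ... | no  _  | yes _  = Φ (suc k) *P w , trans (*-congˡ {Φ (suc k)} eq)
                              (solve 3 (λ f p w → f :* (p :* w) := p :* (f :* w)) refl (Φ (suc k)) p w)
    ... | no  _  | no  _  = w , eq

    ΦProd-∣ : ∀ {m m′} k → m ∣ m′ → ΦProd m k ∣P ΦProd m′ k
    ΦProd-∣ zero    m∣m′ = oneP , sym (*-identityʳ oneP)
    ΦProd-∣ (suc k) m∣m′ = divisorStep-∣ k m∣m′ (ΦProd-∣ k m∣m′)

    divisorStep-mult : ∀ m k p → p ∣P divisorStep m (entry k) p
    divisorStep-mult m k p with suc k ∣? m
    ... | yes _ = Φ (suc k) , *-comm (Φ (suc k)) p
    ... | no  _ = oneP , sym (*-identityʳ p)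

    ΦProd-mono : ∀ m k i → ΦProd m k ∣P ΦProd m (i ℕ.+ k)
    ΦProd-mono m k zero    = oneP , sym (*-identityʳ _)
    ΦProd-mono m k (suc i) = ∣P-trans {ΦProd m k} {ΦProd m (i ℕ.+ k)} {ΦProd m (suc (i ℕ.+ k))} (ΦProd-mono m k i) (divisorStep-mult m (i ℕ.+ k) _)

    ΦProd-self : ∀ k → ΦProd (suc k) (suc k) ≡ Φ (suc k) *P ΦProd (suc k) k
    ΦProd-self k with suc k ∣? suc k
    ... | yes _  = ≡.refl
    ... | no  k∤ = contradiction ∣-refl k∤

  IsCyclotomic : ℕ → Set
  IsCyclotomic k = Monic (Φ (suc k)) × Φ (suc k) *P ΦProd (suc k) k ≋ (Xⁿ−1 (suc k))

  -- With g = gcd (d, j), Φ_d divides (q^d - 1)/(q^g - 1), which is congruent to d/g modulo q^g - 1,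
  -- and q^g - 1 lies in the ideal generated by q^d - 1 and q^j - 1.
  Φ-coprime : ∀ k → (∀ i → i ℕ.≤ k → IsCyclotomic i) → ∀ j → suc k ∤ j → Coprime (Φ (suc k)) (Xⁿ−1 j)
  Φ-coprime k cyc j d∤j with gcd (suc k) j in eqg
  ... | zero  = contradiction eqg (gcd[m,n]≢0 (suc k) j (inj₁ λ ()))
  ... | suc g = W′ , negP (H *P β) , + t , t≢0 , (begin
      (W′ *P Φd) +P (negP (H *P β) *P Xj)
        ≈⟨ solve 7 (λ w h a p f b x → (w :- h :* (a :* p)) :* f :+ (:- (h :* b)) :* x := f :* w :- h :* (a :* (f :* p) :+ b :* x)) refl
             W H α Π Φd β Xj ⟩
      (Φd *P W) -P (H *P ((α *P (Φd *P Π)) +P (β *P Xj)))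
        ≈⟨ +-cong ΦW≋geo (-‿cong (*-congˡ {H} (trans (+-congʳ {β *P Xj} (*-congˡ {α} ΦΠ≋)) (trans (sym bezout) (reflexive (≡.cong Xⁿ−1 eqg)))))) ⟩
      geometric (suc g) t -P (H *P (Xⁿ−1 (suc g)))
        ≈⟨ +-congˡ {geometric (suc g) t} (-‿cong (trans (*-comm H (Xⁿ−1 (suc g))) (sym (proj₂ (geometric-mod (suc g) t))))) ⟩
      geometric (suc g) t -P (geometric (suc g) t -P constP (+ t))
        ≈⟨ solve 2 (λ g t → g :- (g :- t) := t) refl (geometric (suc g) t) (constP (+ t)) ⟩
      constP (+ t)  ∎)
    where
    d = suc k
    Φd = Φ d
    Π = ΦProd d k
    Xj = (Xⁿ−1 j)
    α = proj₁ (X^gcd-1 d j)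
    β = proj₁ (proj₂ (X^gcd-1 d j))
    bezout = proj₂ (proj₂ (X^gcd-1 d j))
    ΦΠ≋ : Φd *P Π ≋ (Xⁿ−1 d)
    ΦΠ≋ = proj₂ (cyc k ℕₚ.≤-refl)
    g∣d : suc g ∣ d
    g∣d = ≡.subst (_∣ d) eqg (gcd[m,n]∣m d j)
    g∣j : suc g ∣ j
    g∣j = ≡.subst (_∣ j) eqg (gcd[m,n]∣n d j)
    g<d : suc g ℕ.< d
    g<d = ℕₚ.≤∧≢⇒< (∣⇒≤ g∣d) λ g≡d → d∤j (≡.subst (_∣ j) g≡d g∣j)
    t = _∣_.quotient g∣d
    d≡t*g : d ≡ t ℕ.* suc g
    d≡t*g = _∣_.equality g∣d
    t≢0 : + t ≢ 0ℤ
    t≢0 t≡0 with () ← ≡.trans d≡t*g (≡.cong (ℕ._* suc g) (ℤₚ.+-injective t≡0))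
    -- The binomial of the gcd is the product of Φ_i over the divisors i of the gcd. These divide d
    -- and are smaller than d, so all of them occur in `Π`.
    Xg∣Π : (Xⁿ−1 (suc g)) ∣P Π
    Xg∣Π = ∣P-resp {ΦProd (suc g) (suc g)} {Xⁿ−1 (suc g)} {ΦProd d (k ∸ suc g ℕ.+ suc g)} {Π} (trans (reflexive (ΦProd-self g)) (proj₂ (cyc g (ℕₚ.≤-trans (ℕₚ.n≤1+n g) (ℕₚ.≤-pred g<d)))))
      (reflexive (≡.cong (ΦProd d) (ℕₚ.m∸n+n≡m (ℕₚ.≤-pred g<d))))
      (∣P-trans {ΦProd (suc g) (suc g)} {ΦProd d (suc g)} {ΦProd d (k ∸ suc g ℕ.+ suc g)} (ΦProd-∣ (suc g) g∣d) (ΦProd-mono d (suc g) (k ∸ suc g)))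
    W = proj₁ Xg∣Π
    H = proj₁ (geometric-mod (suc g) t)
    W′ = W -P (H *P (α *P Π))
    ΦW≋geo : Φd *P W ≋ geometric (suc g) t
    ΦW≋geo = Monic-cancelʳ (Monic-X^-1 g) _ _ (begin
      Φd *P W *P (Xⁿ−1 (suc g))          ≈⟨ solve 3 (λ f w x → f :* w :* x := f :* (x :* w)) refl Φd W (Xⁿ−1 (suc g)) ⟩
      Φd *P ((Xⁿ−1 (suc g)) *P W)        ≈⟨ *-congˡ {Φd} (proj₂ Xg∣Π) ⟨
      Φd *P Π                         ≈⟨ ΦΠ≋ ⟩
      (Xⁿ−1 d)                         ≡⟨ ≡.cong Xⁿ−1 d≡t*g ⟩
      (Xⁿ−1 (t ℕ.* suc g))               ≈⟨ geometric-* (suc g) t ⟩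
      (Xⁿ−1 (suc g)) *P geometric (suc g) t  ≈⟨ *-comm (Xⁿ−1 (suc g)) _ ⟩
      geometric (suc g) t *P (Xⁿ−1 (suc g))  ∎)

  private
    Φ-∣ : ∀ {k m} → IsCyclotomic k → suc k ∣ m → Φ (suc k) ∣P (Xⁿ−1 m)
    Φ-∣ {k} {m} (_ , eq) k∣m = ∣P-trans {Φ (suc k)} {Xⁿ−1 (suc k)} {Xⁿ−1 m} (ΦProd (suc k) k , sym eq) (∣⇒X^-1-∣ k∣m)

    -- Every index that occurs is positive and at most k, hence no multiple of k + 1. So Φ_{k+1} is
    -- coprime to the corresponding binomial and to the cyclotomic polynomial dividing it.
    ΦProd-Coprime : ∀ m k → (∀ i → i ℕ.≤ k → IsCyclotomic i) → ∀ i → i ℕ.≤ k → Coprime (ΦProd m i) (Φ (suc k))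
    ΦProd-Coprime m k cyc zero    _   = Coprime-oneP (Φ (suc k))
    ΦProd-Coprime m k cyc (suc i) i<k with suc i ∣? m
    ... | yes _ = Coprime-* {Φ (suc i)} {ΦProd m i} (Coprime-∣ˡ {Φ (suc i)} {Xⁿ−1 (suc i)} (Φ-∣ (cyc i (ℕₚ.<⇒≤ i<k)) ∣-refl)
                    (Coprime-sym (Φ-coprime k cyc (suc i) λ k∣i → ℕₚ.<⇒≱ i<k (ℕₚ.≤-pred (∣⇒≤ k∣i)))))
                    (ΦProd-Coprime m k cyc i (ℕₚ.<⇒≤ i<k))
    ... | no  _ = ΦProd-Coprime m k cyc i (ℕₚ.<⇒≤ i<k)

    -- Pairwise coprime divisors of q^m - 1 have a product that divides it, but over ℤ[q] the Bézout
    -- relations hold only up to integers. These accumulate in c, which `divMonicP-exact` removes.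
    ΦProd-divides : ∀ m k → (∀ i → i ℕ.< k → IsCyclotomic i) →
                    ∃ λ K → ∃ λ c → c ≢ 0ℤ × ΦProd m k *P K ≋ constP c *P (Xⁿ−1 m)
    ΦProd-divides m zero    cyc = (Xⁿ−1 m) , 1ℤ , (λ ()) , refl
    ΦProd-divides m (suc k) cyc with suc k ∣? m | ΦProd-divides m k (λ i i<k → cyc i (ℕₚ.m<n⇒m<1+n i<k))
    ... | no  _   | ih = ih
    ... | yes k∣m | K , c , c≢0 , eq =
      let (U , V , b , b≢0 , cop) = ΦProd-Coprime m k (λ i i≤k → cyc i (ℕ.s≤s i≤k)) k ℕₚ.≤-refl
          (K′ , eq′) = Φ-∣ (cyc k ℕₚ.≤-refl) k∣m
          Π = ΦProd m k
          F = Φ (suc k)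
          x = (Xⁿ−1 m)
      in (constP c *P (U *P K′)) +P (V *P K) , b ℤ.* c , *-≢0 b≢0 c≢0 , (begin
        F *P Π *P ((constP c *P (U *P K′)) +P (V *P K))
          ≈⟨ solve 7 (λ f p c u k′ v k → f :* p :* (c :* (u :* k′) :+ v :* k) := u :* p :* (c :* (f :* k′)) :+ v :* f :* (p :* k)) refl
               F Π (constP c) U K′ V K ⟩
        (U *P Π *P (constP c *P (F *P K′))) +P (V *P F *P (Π *P K))
          ≈⟨ +-cong (*-congˡ {U *P Π} (*-congˡ {constP c} (sym eq′))) (*-congˡ {V *P F} eq) ⟩
        (U *P Π *P (constP c *P x)) +P (V *P F *P (constP c *P x))
          ≈⟨ solve 4 (λ a b c x → a :* (c :* x) :+ b :* (c :* x) := (a :+ b) :* c :* x) refl (U *P Π) (V *P F) (constP c) x ⟩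
        ((U *P Π) +P (V *P F)) *P constP c *P x
          ≈⟨ *-congʳ {x} (*-congʳ {constP c} cop) ⟩
        constP b *P constP c *P x
          ≈⟨ *-congʳ {x} (constP-*-hom b c) ⟨
        constP (b ℤ.* c) *P x  ∎)

  -- Monicity is part of the induction: the product of the earlier Φ has to be a monic divisor for
  -- the division defining the next one to be exact, and the quotient is then monic again.
  isCyclotomic : ∀ k → IsCyclotomic k
  isCyclotomic = <-rec IsCyclotomic λ k rec → step k (λ i i<k → rec i<k)
    where
    step : ∀ k → (∀ i → i ℕ.< k → IsCyclotomic i) → IsCyclotomic k
    step k cyc = ≡.subst Monic (≡.sym Φ≡) (proj₁ exact) , (begin
      Φ (suc k) *P ΦProd (suc k) k                                       ≡⟨ ≡.cong (_*P ΦProd (suc k) k) Φ≡ ⟩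
      divMonicP (Xⁿ−1 (suc k)) (fold (suc k) k oneP) *P ΦProd (suc k) k     ≈⟨ *-congˡ {divMonicP (Xⁿ−1 (suc k)) (fold (suc k) k oneP)} fold≋ ⟨
      divMonicP (Xⁿ−1 (suc k)) (fold (suc k) k oneP) *P fold (suc k) k oneP ≈⟨ proj₂ exact ⟩
      (Xⁿ−1 (suc k))                                                        ∎)
      where
      Φ≡ : Φ (suc k) ≡ divMonicP (Xⁿ−1 (suc k)) (fold (suc k) k oneP)
      Φ≡ = ≡.trans (Φ-suc k) (≡.cong (divMonicP (Xⁿ−1 (suc k))) (properDivProd-fold (suc k) k))
      fold≋ : fold (suc k) k oneP ≋ ΦProd (suc k) k
      fold≋ = trans (fold-value (suc k) k oneP) (*-identityʳ (ΦProd (suc k) k))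
      exact = let (K , c , c≢0 , eq) = ΦProd-divides (suc k) k cyc in
        divMonicP-exact (Monic-X^-1 k) (fold-Monic (suc k) k oneP (λ i i<k → proj₁ (cyc i i<k)) ([] , ≡.refl)) c≢0 K
          (trans (*-congʳ {K} fold≋) eq)

open Cyclotomic

-- Localization

-- What is used about the ring S⁻¹R / (p).
record LocalizesAt (R : CommutativeRing 0ℓ 0ℓ) (p : CommutativeRing.Carrier R)
                   (S : CommutativeRing.Carrier R → Set) : Set₁ where
  open CommutativeRing R using (_≈_; _+_; _*_) renaming (Carrier to A; 0# to 0R)
  field
    L     : CommutativeRing 0ℓ 0ℓ
    ι     : A → CommutativeRing.Carrier L
    ι-hom : RingMorphisms.IsRingHomomorphism (CommutativeRing.rawRing R) (CommutativeRing.rawRing L) ι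
  open CommutativeRing L using () renaming (_≈_ to _≈L_; 0# to 0L)
  field
    ι-multiple : ∀ w → ι (p * w) ≈L 0L
    ι-unit     : ∀ {s} → S s → IsUnit L (ι s)
    ι-zero⇒    : ∀ {a} → ι a ≈L 0L → ∃ λ u → S u × ∃ λ w → u * a ≈ p * w
    unit⇒      : ∀ {a} → IsUnit L (ι a) → ∃ λ b → ∃ λ s → S s × ∃ λ w → a * b ≈ s + p * w

module LocalizedQuotient (R : CommutativeRing 0ℓ 0ℓ) (p : CommutativeRing.Carrier R)
  (S : CommutativeRing.Carrier R → Set) (1∈S : S (CommutativeRing.1# R))
  (*∈S : ∀ {s t} → S s → S t → S (CommutativeRing._*_ R s t)) where

  open CommutativeRing R
  open IntegerCoefficients R using (solve; _:=_; _:+_; _:*_; _:-_; :-_; con)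
  open import Relation.Binary.Reasoning.Setoid setoid

  record Fraction : Set where
    constructor frac
    field
      numer denom : Carrier
      denom∈S     : S denom
  open Fraction public

  infix 4 _∼_
  -- The extra factor in S gives transitivity without cancelling denominators modulo p, so no
  -- assumption that they are nonzerodivisors enters.
  record _∼_ (x y : Fraction) : Set where
    constructor equal
    field
      factor cofactor : Carrier
      factor∈S        : S factor
      equation        : factor * (numer x * denom y - numer y * denom x) ≈ p * cofactor

  private
    exact : ∀ {x y} → numer x * denom y ≈ numer y * denom x → x ∼ y
    exact {x} {y} eq = equal 1# 0# 1∈S (trans (*-identityˡ _) (trans (+-congʳ eq) (trans (-‿inverseʳ _) (sym (zeroʳ p)))))

    ∼-trans : ∀ {x y z} → x ∼ y → y ∼ z → x ∼ z
    ∼-trans {frac a s _} {frac b t t∈S} {frac c r _} (equal u w u∈S e₁) (equal v x v∈S e₂) =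
      equal (u * v * t) (v * r * w + u * s * x) (*∈S (*∈S u∈S v∈S) t∈S) (begin
        u * v * t * (a * r - c * s)
          ≈⟨ solve 8 (λ a b c r s t u v → u :* v :* t :* (a :* r :- c :* s) :=
               v :* r :* (u :* (a :* t :- b :* s)) :+ u :* s :* (v :* (b :* r :- c :* t))) refl a b c r s t u v ⟩
        v * r * (u * (a * t - b * s)) + u * s * (v * (b * r - c * t))
          ≈⟨ +-cong (*-congˡ e₁) (*-congˡ e₂) ⟩
        v * r * (p * w) + u * s * (p * x)
          ≈⟨ solve 5 (λ y w z x p → y :* (p :* w) :+ z :* (p :* x) := p :* (y :* w :+ z :* x)) refl (v * r) w (u * s) x p ⟩
        p * (v * r * w + u * s * x)  ∎)

    ∼-sym : ∀ {x y} → x ∼ y → y ∼ x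
    ∼-sym {frac a s _} {frac b t _} (equal u w u∈S e) = equal u (- w) u∈S (begin
      u * (b * s - a * t)      ≈⟨ solve 3 (λ u x y → u :* (y :- x) := :- (u :* (x :- y))) refl u (a * t) (b * s) ⟩
      - (u * (a * t - b * s))  ≈⟨ -‿cong e ⟩
      - (p * w)                ≈⟨ solve 2 (λ p w → :- (p :* w) := p :* (:- w)) refl p w ⟩
      p * - w                  ∎)

  infixl 6 _⊞_
  infixl 7 _⊠_
  _⊞_ _⊠_ : Fraction → Fraction → Fraction
  frac a s s∈S ⊞ frac b t t∈S = frac (a * t + b * s) (s * t) (*∈S s∈S t∈S)
  frac a s s∈S ⊠ frac b t t∈S = frac (a * b) (s * t) (*∈S s∈S t∈S)

  ⊟_ : Fraction → Fraction
  ⊟ frac a s s∈S = frac (- a) s s∈S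

  ι : Carrier → Fraction
  ι a = frac a 1# 1∈S

  private
    ⊞-cong : ∀ {x x′ y y′} → x ∼ x′ → y ∼ y′ → x ⊞ y ∼ x′ ⊞ y′
    ⊞-cong {frac a s _} {frac a′ s′ _} {frac b t _} {frac b′ t′ _} (equal u w u∈S e₁) (equal v x v∈S e₂) =
      equal (u * v) (v * t * t′ * w + u * s * s′ * x) (*∈S u∈S v∈S) (begin
        u * v * ((a * t + b * s) * (s′ * t′) - (a′ * t′ + b′ * s′) * (s * t))
          ≈⟨ solve 10 (λ a a′ b b′ s s′ t t′ u v →
               u :* v :* ((a :* t :+ b :* s) :* (s′ :* t′) :- (a′ :* t′ :+ b′ :* s′) :* (s :* t)) :=
               v :* t :* t′ :* (u :* (a :* s′ :- a′ :* s)) :+ u :* s :* s′ :* (v :* (b :* t′ :- b′ :* t))) refl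
               a a′ b b′ s s′ t t′ u v ⟩
        v * t * t′ * (u * (a * s′ - a′ * s)) + u * s * s′ * (v * (b * t′ - b′ * t))
          ≈⟨ +-cong (*-congˡ e₁) (*-congˡ e₂) ⟩
        v * t * t′ * (p * w) + u * s * s′ * (p * x)
          ≈⟨ solve 5 (λ y w z x p → y :* (p :* w) :+ z :* (p :* x) := p :* (y :* w :+ z :* x)) refl (v * t * t′) w (u * s * s′) x p ⟩
        p * (v * t * t′ * w + u * s * s′ * x)  ∎)

    ⊠-cong : ∀ {x x′ y y′} → x ∼ x′ → y ∼ y′ → x ⊠ y ∼ x′ ⊠ y′
    ⊠-cong {frac a s _} {frac a′ s′ _} {frac b t _} {frac b′ t′ _} (equal u w u∈S e₁) (equal v x v∈S e₂) =
      equal (u * v) (v * b * t′ * w + u * a′ * s * x) (*∈S u∈S v∈S) (begin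
        u * v * (a * b * (s′ * t′) - a′ * b′ * (s * t))
          ≈⟨ solve 10 (λ a a′ b b′ s s′ t t′ u v →
               u :* v :* (a :* b :* (s′ :* t′) :- a′ :* b′ :* (s :* t)) :=
               v :* b :* t′ :* (u :* (a :* s′ :- a′ :* s)) :+ u :* a′ :* s :* (v :* (b :* t′ :- b′ :* t))) refl
               a a′ b b′ s s′ t t′ u v ⟩
        v * b * t′ * (u * (a * s′ - a′ * s)) + u * a′ * s * (v * (b * t′ - b′ * t))
          ≈⟨ +-cong (*-congˡ e₁) (*-congˡ e₂) ⟩
        v * b * t′ * (p * w) + u * a′ * s * (p * x)
          ≈⟨ solve 5 (λ y w z x p → y :* (p :* w) :+ z :* (p :* x) := p :* (y :* w :+ z :* x)) refl (v * b * t′) w (u * a′ * s) x p ⟩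
        p * (v * b * t′ * w + u * a′ * s * x)  ∎)

    ⊟-cong : ∀ {x y} → x ∼ y → ⊟ x ∼ ⊟ y
    ⊟-cong {frac a s _} {frac b t _} (equal u w u∈S e) = equal u (- w) u∈S (begin
      u * (- a * t - - b * s)  ≈⟨ solve 5 (λ u a b s t → u :* (:- a :* t :- (:- b) :* s) := :- (u :* (a :* t :- b :* s))) refl u a b s t ⟩
      - (u * (a * t - b * s))  ≈⟨ -‿cong e ⟩
      - (p * w)                ≈⟨ solve 2 (λ p w → :- (p :* w) := p :* (:- w)) refl p w ⟩
      p * - w                  ∎)

    ⊞-assoc : ∀ x y z → (x ⊞ y) ⊞ z ∼ x ⊞ (y ⊞ z)
    ⊞-assoc (frac a s _) (frac b t _) (frac c r _) = exact (solve 6 (λ a b c s t r →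
      ((a :* t :+ b :* s) :* r :+ c :* (s :* t)) :* (s :* (t :* r)) := (a :* (t :* r) :+ (b :* r :+ c :* t) :* s) :* (s :* t :* r)) refl a b c s t r)

    ⊞-comm : ∀ x y → x ⊞ y ∼ y ⊞ x
    ⊞-comm (frac a s _) (frac b t _) = exact (solve 4 (λ a b s t →
      (a :* t :+ b :* s) :* (t :* s) := (b :* s :+ a :* t) :* (s :* t)) refl a b s t)

    ⊞-identityˡ : ∀ x → ι 0# ⊞ x ∼ x
    ⊞-identityˡ (frac a s _) = exact (solve 2 (λ a s → (con 0ℤ :* s :+ a :* con 1ℤ) :* s := a :* (con 1ℤ :* s)) refl a s)

    ⊟-inverseˡ : ∀ x → ⊟ x ⊞ x ∼ ι 0#
    ⊟-inverseˡ (frac a s _) = exact (solve 2 (λ a s → (:- a :* s :+ a :* s) :* con 1ℤ := con 0ℤ :* (s :* s)) refl a s)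

    ⊠-assoc : ∀ x y z → (x ⊠ y) ⊠ z ∼ x ⊠ (y ⊠ z)
    ⊠-assoc (frac a s _) (frac b t _) (frac c r _) = exact (solve 6 (λ a b c s t r →
      (a :* b :* c) :* (s :* (t :* r)) := (a :* (b :* c)) :* (s :* t :* r)) refl a b c s t r)

    ⊠-comm : ∀ x y → x ⊠ y ∼ y ⊠ x
    ⊠-comm (frac a s _) (frac b t _) = exact (solve 4 (λ a b s t →
      (a :* b) :* (t :* s) := (b :* a) :* (s :* t)) refl a b s t)

    ⊠-identityˡ : ∀ x → ι 1# ⊠ x ∼ x
    ⊠-identityˡ (frac a s _) = exact (solve 2 (λ a s → con 1ℤ :* a :* s := a :* (con 1ℤ :* s)) refl a s)

    ⊠-distribʳ-⊞ : ∀ x y z → (y ⊞ z) ⊠ x ∼ (y ⊠ x) ⊞ (z ⊠ x)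
    ⊠-distribʳ-⊞ (frac a s _) (frac b t _) (frac c r _) = exact (solve 6 (λ a b c s t r →
      (b :* r :+ c :* t) :* a :* (t :* s :* (r :* s)) := (b :* a :* (r :* s) :+ c :* a :* (t :* s)) :* (t :* r :* s)) refl a b c s t r)

  fractionRing : CommutativeRing 0ℓ 0ℓ
  fractionRing = record
    { Carrier = Fraction ; _≈_ = _∼_ ; _+_ = _⊞_ ; _*_ = _⊠_ ; -_ = ⊟_ ; 0# = ι 0# ; 1# = ι 1#
    ; isCommutativeRing = record
      { isRing = record
        { +-isAbelianGroup = record
          { isGroup = record
            { isMonoid = record
              { isSemigroup = record
                { isMagma = record
                  { isEquivalence = record { refl = exact refl ; sym = ∼-sym ; trans = ∼-trans }
                  ; ∙-cong = ⊞-cong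
                  }
                ; assoc = ⊞-assoc
                }
              ; identity = ⊞-identityˡ , λ x → ∼-trans (⊞-comm x (ι 0#)) (⊞-identityˡ x)
              }
            ; inverse = ⊟-inverseˡ , λ x → ∼-trans (⊞-comm x (⊟ x)) (⊟-inverseˡ x)
            ; ⁻¹-cong = ⊟-cong
            }
          ; comm = ⊞-comm
          }
        ; *-cong = ⊠-cong
        ; *-assoc = ⊠-assoc
        ; *-identity = ⊠-identityˡ , λ x → ∼-trans (⊠-comm x (ι 1#)) (⊠-identityˡ x)
        ; distrib = (λ x y z → ∼-trans (⊠-comm x (y ⊞ z)) (∼-trans (⊠-distribʳ-⊞ x y z) (⊞-cong (⊠-comm y x) (⊠-comm z x))))
                  , ⊠-distribʳ-⊞
        }
      ; *-comm = ⊠-comm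
      }
    }

  open RingMorphisms rawRing (CommutativeRing.rawRing fractionRing) using (IsRingHomomorphism)

  ι-isRingHomomorphism : IsRingHomomorphism ι
  ι-isRingHomomorphism = record
    { isSemiringHomomorphism = record
      { isNearSemiringHomomorphism = record
        { +-isMonoidHomomorphism = record
          { isMagmaHomomorphism = record
            { isRelHomomorphism = record { cong = λ a≈b → exact (*-congʳ a≈b) }
            ; homo = λ a b → exact (solve 2 (λ a b →
                (a :+ b) :* (con 1ℤ :* con 1ℤ) := (a :* con 1ℤ :+ b :* con 1ℤ) :* con 1ℤ) refl a b)
            }
          ; ε-homo = exact refl
          }
        ; *-homo = λ a b → exact (solve 2 (λ a b → (a :* b) :* (con 1ℤ :* con 1ℤ) := a :* b :* con 1ℤ) refl a b)
        }
      ; 1#-homo = exact refl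
      }
    ; -‿homo = λ _ → exact refl
    }

  ι-multiple : ∀ w → ι (p * w) ∼ ι 0#
  ι-multiple w = equal 1# w 1∈S (solve 2 (λ p w → con 1ℤ :* (p :* w :* con 1ℤ :- con 0ℤ :* con 1ℤ) := p :* w) refl p w)

  ι-unit : ∀ {s} → S s → IsUnit fractionRing (ι s)
  ι-unit {s} s∈S = frac 1# s s∈S , exact (solve 1 (λ s → s :* con 1ℤ :* con 1ℤ := con 1ℤ :* (con 1ℤ :* s)) refl s)

  ι-zero⇒ : ∀ {a} → ι a ∼ ι 0# → ∃ λ u → S u × ∃ λ w → u * a ≈ p * w
  ι-zero⇒ {a} (equal u w u∈S e) = u , u∈S , w , trans
    (solve 2 (λ u a → u :* a := u :* (a :* con 1ℤ :- con 0ℤ :* con 1ℤ)) refl u a) e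

  unit⇒ : ∀ {a} → IsUnit fractionRing (ι a) → ∃ λ b → ∃ λ s → S s × ∃ λ w → a * b ≈ s + p * w
  unit⇒ {a} (frac b t t∈S , equal u w u∈S e) = u * b , u * t , *∈S u∈S t∈S , w , (begin
    a * (u * b)
      ≈⟨ solve 4 (λ a u b t → a :* (u :* b) := u :* t :+ u :* (a :* b :* con 1ℤ :- con 1ℤ :* (con 1ℤ :* t))) refl a u b t ⟩
    u * t + u * (a * b * 1# - 1# * (1# * t))  ≈⟨ +-congˡ e ⟩
    u * t + p * w  ∎)

  localization : LocalizesAt R p S
  localization = record
    { L = fractionRing ; ι = ι ; ι-hom = ι-isRingHomomorphism
    ; ι-multiple = ι-multiple ; ι-unit = ι-unit ; ι-zero⇒ = ι-zero⇒ ; unit⇒ = unit⇒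
    }

n+1≡2m : ∀ m′ → suc (m′ ℕ.+ (2 ℕ.+ m′)) ℕ.+ 1 ≡ (2 ℕ.+ m′) ℕ.* 2
n+1≡2m = solve 1 (λ m → con 1 :+ (m :+ (con 2 :+ m)) :+ con 1 := (con 2 :+ m) :* con 2) ≡.refl
  where open ℕ-Solver

-- Rational functions evaluated in a ring

module Evaluation (L : CommutativeRing 0ℓ 0ℓ) (ι : Poly → CommutativeRing.Carrier L)
  (ι-hom : RingMorphisms.IsRingHomomorphism (CommutativeRing.rawRing polyRing) (CommutativeRing.rawRing L) ι)
  (q-unit : IsUnit L (ι (XP 1))) where

  open CommutativeRing L hiding (zero)
  open QPowers L (ι (XP 1)) q-unit
  open RingMorphisms.IsRingHomomorphism ι-hom
  open import Relation.Binary.Reasoning.Setoid setoid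

  ι-XP : ∀ m → ι (XP m) ≈ ι (XP 1) ^ m
  ι-XP zero    = 1#-homo
  ι-XP (suc m) = trans (⟦⟧-cong (XP-+ 1 m)) (trans (*-homo (XP 1) (XP m)) (*-congˡ (ι-XP m)))

  -- y is the value of x in L. An unreduced fraction has a value only if its denominator becomes
  -- invertible; that condition is carried along, and it later yields coprimality of the
  -- denominators of both sides to the modulus.
  record Represents (x : RatF) (y : Carrier) : Set where
    constructor represents
    field
      den-unit : IsUnit L (ι (den x))
      num≈     : ι (num x) ≈ y * ι (den x)
  open Represents public

  Represents-resp : ∀ {x y y′} → y ≈ y′ → Represents x y → Represents x y′
  Represents-resp y≈y′ (represents u eq) = represents u (trans eq (*-congʳ y≈y′))

  Represents-poly : ∀ p → Represents (polyR p) (ι p)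
  Represents-poly p = represents (1# , trans (*-identityʳ _) 1#-homo) (sym (trans (*-congˡ 1#-homo) (*-identityʳ _)))

  Represents-+ : ∀ {x x′ y y′} → Represents x y → Represents x′ y′ → Represents (x +R x′) (y + y′)
  Represents-+ {a // b} {c // f} {y} {y′} (represents u eq) (represents u′ eq′) =
    represents (IsUnit-resp (sym (*-homo b f)) (IsUnit-* u u′)) (begin
      ι ((a *P f) +P (c *P b))                   ≈⟨ trans (+-homo _ _) (+-cong (*-homo a f) (*-homo c b)) ⟩
      ι a * ι f + ι c * ι b                      ≈⟨ +-cong (*-congʳ eq) (*-congʳ eq′) ⟩
      y * ι b * ι f + y′ * ι f * ι b
        ≈⟨ solve 4 (λ y z b f → y :* b :* f :+ z :* f :* b := (y :+ z) :* (b :* f)) refl y y′ (ι b) (ι f) ⟩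
      (y + y′) * (ι b * ι f)                     ≈⟨ *-congˡ (*-homo b f) ⟨
      (y + y′) * ι (b *P f)                      ∎)

  Represents-* : ∀ {x x′ y y′} → Represents x y → Represents x′ y′ → Represents (x *R x′) (y * y′)
  Represents-* {a // b} {c // f} {y} {y′} (represents u eq) (represents u′ eq′) =
    represents (IsUnit-resp (sym (*-homo b f)) (IsUnit-* u u′)) (begin
      ι (a *P c)                                 ≈⟨ *-homo a c ⟩
      ι a * ι c                                  ≈⟨ *-cong eq eq′ ⟩
      y * ι b * (y′ * ι f)
        ≈⟨ solve 4 (λ y z b f → y :* b :* (z :* f) := y :* z :* (b :* f)) refl y y′ (ι b) (ι f) ⟩
      y * y′ * (ι b * ι f)                       ≈⟨ *-congˡ (*-homo b f) ⟨
      y * y′ * ι (b *P f)                        ∎)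

  Represents-neg : ∀ {x y} → Represents x y → Represents (negR x) (- y)
  Represents-neg {a // b} {y} (represents u eq) = represents u (begin
    ι (negP a)     ≈⟨ -‿homo a ⟩
    - ι a          ≈⟨ -‿cong eq ⟩
    - (y * ι b)    ≈⟨ solve 2 (λ y b → :- (y :* b) := :- y :* b) refl y (ι b) ⟩
    - y * ι b      ∎)

  Represents-inv : ∀ {x y y′} → y * y′ ≈ 1# → Represents x y → Represents (invR x) y′
  Represents-inv {a // b} {y} {y′} yy′≈1 (represents u eq) = represents
    (IsUnit-resp (sym eq) (IsUnit-* (y′ , yy′≈1) u)) (begin
      ι b              ≈⟨ *-identityˡ _ ⟨
      1# * ι b         ≈⟨ *-congʳ yy′≈1 ⟨
      y * y′ * ι b     ≈⟨ solve 3 (λ y z b → y :* z :* b := z :* (y :* b)) refl y y′ (ι b) ⟩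
      y′ * (y * ι b)   ≈⟨ *-congˡ eq ⟨
      y′ * ι a         ∎)

  Represents-1 : Represents oneR 1#
  Represents-1 = Represents-resp 1#-homo (Represents-poly oneP)

  Represents-pow : ∀ {x y} j → Represents x y → Represents (powR x j) (y ^ j)
  Represents-pow zero    r = Represents-1
  Represents-pow (suc j) r = Represents-* r (Represents-pow j r)

  Represents-qPow : ∀ z → Represents (qPow z) (e z)
  Represents-qPow (+ m)      = Represents-resp (ι-XP m) (Represents-poly (XP m))
  Represents-qPow z@(-[1+ m ]) = Represents-inv {polyR (XP (suc m))}
    (trans (sym (e-+ (+ suc m) -[1+ m ])) (e-cong (ℤₚ.+-inverseʳ (+ suc m)))) (Represents-qPow (+ suc m))

  Represents-[] : ∀ z → Represents (oneR -R qPow z) [ z ]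
  Represents-[] z = Represents-+ Represents-1 (Represents-neg (Represents-qPow z))

  Represents-sum : ∀ n {f g} → (∀ k → k ℕ.< n → Represents (f k) (g k)) → Represents (sumR n f) (Σ< n g)
  Represents-sum n {f} = go n (λ k → k)
    where
    go : ∀ n h {g} → (∀ k → k ℕ.< n → Represents (f (h k)) (g k)) →
         Represents (foldr (λ k acc → f k +R acc) zeroR (applyUpTo h n)) (Σ< n g)
    go zero    h r = Represents-resp (trans (⟦⟧-cong (coeffwise λ { zero → ≡.refl ; (suc _) → ≡.refl })) 0#-homo) (Represents-poly (constP 0ℤ))
    go (suc n) h r = Represents-+ (r 0 ℕ.z<s) (go n (h ∘ suc) (λ k k<n → r (suc k) (ℕ.s<s k<n)))

  module _ (d : ℤ) where
    open QPochhammer L (ι (XP 1)) q-unit d using (P)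

    Represents-poch : ∀ a k → Represents (poch a d k) (P a k)
    Represents-poch a zero    = Represents-1
    Represents-poch a (suc k) = Represents-* (Represents-poch a k) (Represents-[] (a ℤ.+ d ℤ.* + k))

  [+]≈ : ∀ j → [ + j ] ≈ - 1# * ι (Xⁿ−1 j)
  [+]≈ j = begin
    1# - ι (XP 1) ^ j         ≈⟨ +-congˡ (-‿cong (ι-XP j)) ⟨
    1# - ι (XP j)             ≈⟨ solve 1 (λ x → con 1ℤ :- x := :- con 1ℤ :* (x :+ :- con 1ℤ)) refl (ι (XP j)) ⟩
    - 1# * (ι (XP j) + - 1#)  ≈⟨ *-congˡ (trans (+-homo (XP j) (negP oneP)) (+-cong refl (trans (-‿homo oneP) (-‿cong 1#-homo)))) ⟨
    - 1# * ι (Xⁿ−1 j)         ∎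

  []-unit : ∀ j → IsUnit L (ι (Xⁿ−1 j)) → IsUnit L [ + j ]
  []-unit j u = IsUnit-resp (sym ([+]≈ j)) (IsUnit-* (- 1# , solve 0 ((:- con 1ℤ) :* (:- con 1ℤ) := con 1ℤ) refl) u)

  []²≈0 : ∀ n → ι (Xⁿ−1 n *P Xⁿ−1 n) ≈ 0# → [ + n ] * [ + n ] ≈ 0#
  []²≈0 n eq = begin
    [ + n ] * [ + n ]                               ≈⟨ *-cong ([+]≈ n) ([+]≈ n) ⟩
    - 1# * ι (Xⁿ−1 n) * (- 1# * ι (Xⁿ−1 n))         ≈⟨ solve 1 (λ x → :- con 1ℤ :* x :* (:- con 1ℤ :* x) := x :* x) refl (ι (Xⁿ−1 n)) ⟩
    ι (Xⁿ−1 n) * ι (Xⁿ−1 n)                         ≈⟨ *-homo (Xⁿ−1 n) (Xⁿ−1 n) ⟨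
    ι (Xⁿ−1 n *P Xⁿ−1 n)                            ≈⟨ eq ⟩
    0#                                              ∎

  2-unit : IsUnit L (ι (constP (+ 2))) → IsUnit L (fromℤ (+ 2))
  2-unit = IsUnit-resp (trans (+-homo oneP oneP) (+-cong 1#-homo 1#-homo))

  Represents-unique : ∀ {a b c f y} → Represents (a // b) y → Represents (c // f) y → ι ((a *P f) -P (c *P b)) ≈ 0#
  Represents-unique {a} {b} {c} {f} {y} (represents ub eqa) (represents uf eqc) = begin
      ι ((a *P f) -P (c *P b))
        ≈⟨ trans (+-homo _ _) (+-cong (*-homo a f) (trans (-‿homo (c *P b)) (-‿cong (*-homo c b)))) ⟩
      ι a * ι f - ι c * ι b
        ≈⟨ +-cong (*-congʳ eqa) (-‿cong (*-congʳ eqc)) ⟩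
      y * ι b * ι f - y * ι f * ι b
        ≈⟨ solve 3 (λ y b f → y :* b :* f :- y :* f :* b := con 0ℤ) refl y (ι b) (ι f) ⟩
      0#  ∎

  module Sums (d r n : ℕ) (P-unit : ∀ k → k ℕ.< n → IsUnit L (QPochhammer.P L (ι (XP 1)) q-unit (+ d) (+ d) k)) where
    open QPochhammer L (ι (XP 1)) q-unit (+ d) using (P)

    numerator : ℕ → Carrier
    numerator k = P (+ (d ℕ.+ r)) k ^ (d ∸ r) * P (+ r) k ^ (r ∸ 1) * P (+ r ℤ.- + d) k * e (+ (d ℕ.* k))

    -- From k = n on, (q^d;q^d)_k contains 1 - q^{dn}, a multiple of 1 - q^n, and cannot be inverted
    -- in general; the default 0 is never summed.
    t : ℕ → Carrier
    t k with k ℕ.<? n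
    ... | yes k<n = numerator k * proj₁ (IsUnit-^ d (P-unit k k<n))
    ... | no  _   = 0#

    t-def : ∀ k → k ℕ.< n → t k * P (+ d) k ^ d ≈ numerator k
    t-def k k<n with k ℕ.<? n
    ... | no k≮n = contradiction k<n k≮n
    ... | yes k<n′ = let (v , uv≈1) = IsUnit-^ d (P-unit k k<n′) in begin
      numerator k * v * P (+ d) k ^ d      ≈⟨ solve 3 (λ x v u → x :* v :* u := x :* (u :* v)) refl (numerator k) v (P (+ d) k ^ d) ⟩
      numerator k * (P (+ d) k ^ d * v)    ≈⟨ *-congˡ uv≈1 ⟩
      numerator k * 1#                     ≈⟨ *-identityʳ _ ⟩
      numerator k                          ∎

    Represents-lhsTerm : ∀ k → k ℕ.< n → Represents (lhsTerm d r k) (t k)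
    Represents-lhsTerm k k<n with k ℕ.<? n
    ... | no k≮n = contradiction k<n k≮n
    ... | yes k<n′ = Represents-*
      (Represents-* (Represents-* (Represents-* (Represents-pow (d ∸ r) (Represents-poch (+ d) (+ (d ℕ.+ r)) k))
        (Represents-pow (r ∸ 1) (Represents-poch (+ d) (+ r) k))) (Represents-poch (+ d) (+ r ℤ.- + d) k)) (Represents-qPow (+ (d ℕ.* k))))
      (Represents-inv {powR (poch (+ d) (+ d) k) d} (proj₂ (IsUnit-^ d (P-unit k k<n′))) (Represents-pow d (Represents-poch (+ d) (+ d) k)))

    -- Passes from the division-free identity to the right-hand side of the theorem. The relation
    -- -(1 - q^{r-d}) = (1 - q^{d-r}) q^{r-d} accounts for the minus sign in the denominator and for
    -- the summand r - d of A, and the sign (-1)^N moves to the denominator because its square is 1.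
    congruence : ∀ m N z → m ℕ.< n → quotNR d n r ≡ m → n ∸ 1 ∸ m ≡ N → Aexp d n r ≡ z ℤ.+ (+ r ℤ.- + d) →
      Σ< n t * P (+ d) m ^ (d ∸ 1) ≈ (- 1#) ^ N * ([ + r ] ^ r * [ + r ℤ.- + d ] * P (+ d) N) * e z →
      ∃ λ y → Represents (sumR n (lhsTerm d r)) y × Represents (rhs d n r) y
    congruence m N z m<n quot≡m N≡ A≡ Σ≈ = Σ< n t ,
      Represents-sum n Represents-lhsTerm , represents-rhs
      where
      rhsWith : ℕ → ℕ → ℤ → RatF
      rhsWith m N A = (powR (oneR -R qPow (+ r)) r *R (oneR -R qPow (+ d ℤ.- + r)) *R poch (+ d) (+ d) N)
        /R (negR (powR (constR -1ℤ) N) *R powR (poch (+ d) (+ d) m) (d ∸ 1)) *R qPow A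

      ε U : Carrier
      ε = (- 1#) ^ N
      U = P (+ d) m ^ (d ∸ 1)

      ε*ε≈1 : ∀ N → (- 1#) ^ N * (- 1#) ^ N ≈ 1#
      ε*ε≈1 zero    = *-identityˡ 1#
      ε*ε≈1 (suc N) = trans (solve 1 (λ x → :- con 1ℤ :* x :* (:- con 1ℤ :* x) := x :* x) refl ((- 1#) ^ N)) (ε*ε≈1 N)

      D-unit : IsUnit L (- ε * U)
      D-unit = IsUnit-* (- ε , trans (solve 1 (λ x → (:- x) :* (:- x) := x :* x) refl ε) (ε*ε≈1 N)) (IsUnit-^ (d ∸ 1) (P-unit m m<n))

      V : Carrier
      V = proj₁ D-unit

      value : Carrier
      value = [ + r ] ^ r * [ + d ℤ.- + r ] * P (+ d) N * V * e (z ℤ.+ (+ r ℤ.- + d))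

      [r-d]≈ : - [ + r ℤ.- + d ] ≈ [ + d ℤ.- + r ] * e (+ r ℤ.- + d)
      [r-d]≈ = begin
        - (1# - x)          ≈⟨ solve 1 (λ x → :- (con 1ℤ :- x) := x :- con 1ℤ) refl x ⟩
        x - 1#              ≈⟨ +-congˡ (-‿cong (trans (e-cong (≡.sym (ℤsolve 2 (λ r d → d ⊝ r ⊕ (r ⊝ d) ≜ κ 0ℤ) ≡.refl (+ r) (+ d)))) (e-+ (+ d ℤ.- + r) (+ r ℤ.- + d)))) ⟩
        x - y′ * x          ≈⟨ solve 2 (λ x y → x :- y :* x := (con 1ℤ :- y) :* x) refl x y′ ⟩
        (1# - y′) * x       ∎
        where
        x = e (+ r ℤ.- + d)
        y′ = e (+ d ℤ.- + r)

      value≈ : value ≈ Σ< n t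
      value≈ = begin
        R * [ + d ℤ.- + r ] * PN * V * e (z ℤ.+ (+ r ℤ.- + d))
          ≈⟨ *-congˡ (e-+ z _) ⟩
        R * [ + d ℤ.- + r ] * PN * V * (e z * e (+ r ℤ.- + d))
          ≈⟨ solve 6 (λ r a p v z b → r :* a :* p :* v :* (z :* b) := (r :* (a :* b) :* p :* z) :* v) refl R [ + d ℤ.- + r ] PN V (e z) (e (+ r ℤ.- + d)) ⟩
        R * ([ + d ℤ.- + r ] * e (+ r ℤ.- + d)) * PN * e z * V
          ≈⟨ *-congʳ (*-congʳ (*-congʳ (*-congˡ [r-d]≈))) ⟨
        R * - [ + r ℤ.- + d ] * PN * e z * V
          ≈⟨ solve 5 (λ r x p z v → r :* (:- x) :* p :* z :* v := con 1ℤ :* (:- (r :* x :* p :* z)) :* v) refl R [ + r ℤ.- + d ] PN (e z) V ⟩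
        1# * - (R * [ + r ℤ.- + d ] * PN * e z) * V
          ≈⟨ *-congʳ (*-congʳ (ε*ε≈1 N)) ⟨
        ε * ε * - (R * [ + r ℤ.- + d ] * PN * e z) * V
          ≈⟨ solve 6 (λ s r x p z v → s :* s :* (:- (r :* x :* p :* z)) :* v := (:- s) :* (s :* (r :* x :* p) :* z) :* v) refl ε R [ + r ℤ.- + d ] PN (e z) V ⟩
        - ε * (ε * (R * [ + r ℤ.- + d ] * PN) * e z) * V
          ≈⟨ *-congʳ (*-congˡ Σ≈) ⟨
        - ε * (Σ< n t * U) * V
          ≈⟨ solve 4 (λ s x u v → (:- s) :* (x :* u) :* v := x :* ((:- s) :* u :* v)) refl ε (Σ< n t) U V ⟩
        Σ< n t * (- ε * U * V)
          ≈⟨ *-congˡ (proj₂ D-unit) ⟩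
        Σ< n t * 1#
          ≈⟨ *-identityʳ _ ⟩
        Σ< n t  ∎
        where
        R = [ + r ] ^ r
        PN = P (+ d) N

      represents-rhsWith : Represents (rhsWith m N (z ℤ.+ (+ r ℤ.- + d))) value
      represents-rhsWith = Represents-* (Represents-* (Represents-* (Represents-* (Represents-pow r (Represents-[] (+ r))) (Represents-[] (+ d ℤ.- + r)))
          (Represents-poch (+ d) (+ d) N))
        (Represents-inv {negR (powR (constR -1ℤ) N) *R powR (poch (+ d) (+ d) m) (d ∸ 1)} (proj₂ D-unit)
          (Represents-* (Represents-neg (Represents-pow N (Represents-resp (trans (-‿homo oneP) (-‿cong 1#-homo)) (Represents-poly (constP -1ℤ)))))
            (Represents-pow (d ∸ 1) (Represents-poch (+ d) (+ d) m)))))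
        (Represents-qPow (z ℤ.+ (+ r ℤ.- + d)))

      rhs≡ : rhs d n r ≡ rhsWith m N (z ℤ.+ (+ r ℤ.- + d))
      rhs≡ = ≡.trans (≡.cong₂ (λ m A → rhsWith m (n ∸ 1 ∸ m) A) quot≡m A≡) (≡.cong (λ N → rhsWith m N (z ℤ.+ (+ r ℤ.- + d))) N≡)

      represents-rhs : Represents (rhs d n r) (Σ< n t)
      represents-rhs = ≡.subst (λ x → Represents x (Σ< n t)) (≡.sym rhs≡) (Represents-resp value≈ represents-rhsWith)

  module _ (n : ℕ) (unit : ∀ j → n ∤ j → IsUnit L (ι (Xⁿ−1 j))) where

    -- The factors are 1 - q^{dj} with 0 < j < n. Since n is prime to d, n ∣ dj would force n ∣ j.
    P-unit : ∀ d → ℕ.Coprime n d → ∀ k → k ℕ.< n → IsUnit L (QPochhammer.P L (ι (XP 1)) q-unit (+ d) (+ d) k)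
    P-unit d cop zero    _     = 1# , *-identityˡ 1#
    P-unit d cop (suc k) 1+k<n = IsUnit-* (P-unit d cop k (ℕₚ.<⇒≤ 1+k<n))
      (IsUnit-resp ([]-cong exponent) ([]-unit (d ℕ.* suc k) (unit (d ℕ.* suc k) λ n∣ →
        ℕₚ.<⇒≱ 1+k<n (∣⇒≤ (ℕ.coprime-divisor cop n∣)))))
      where
      exponent : + (d ℕ.* suc k) ≡ + d ℤ.+ + d ℤ.* + k
      exponent = ≡.trans (≡.cong +_ (ℕₚ.*-suc d k)) (≡.cong (λ x → + d ℤ.+ x) (ℤₚ.pos-* d k))

  Congruent : ℕ → ℕ → ℕ → Set
  Congruent d r n = ∃ λ y → Represents (sumR n (lhsTerm d r)) y × Represents (rhs d n r) y

  module _ (r′ s m′ : ℕ) where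
    open GenericParameters r′ s m′

    generic : (∀ j → n ∤ j → IsUnit L (ι (Xⁿ−1 j))) → ι (Xⁿ−1 n *P Xⁿ−1 n) ≈ 0# →
              ℕ.Coprime n d → Congruent d r n
    generic unit square cop = congruence m N z m<n
      (≡.trans (≡.cong (ℕ._/ d) (≡.trans n+r≡d*m (ℕₚ.*-comm d m))) (ℕ.m*n/n≡m m d))
      (ℕₚ.m+n∸n≡m N m) (Aexp-generic r′ s m′)
      (GenericCase.generic-congruence L (ι (XP 1)) q-unit r′ s m′ ([]²≈0 n square) (P-unit n unit d cop) t
        λ k k<n → trans (t-def k k<n) (*-cong (*-congʳ (*-congʳ (^-congʳ (P (+ (d ℕ.+ r)) k) d∸r≡))) (e-cong (ℤₚ.pos-* d k))))
      where
      open Sums d r n (P-unit n unit d cop)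
      open QPochhammer L (ι (XP 1)) q-unit (+ d) using (P)
      m<n : m ℕ.< n
      m<n = ℕ.s≤s (ℕₚ.m≤n+m m N)
      d∸r≡ : d ∸ r ≡ 2 ℕ.+ s
      d∸r≡ = ≡.trans (≡.cong (_∸ r′) (≡.trans (≡.cong (2 ℕ.+_) (ℕₚ.+-comm r′ s)) (≡.sym (ℕₚ.+-assoc 2 s r′)))) (ℕₚ.m+n∸n≡m (2 ℕ.+ s) r′)

  quadratic : ∀ m′ → let n = suc (m′ ℕ.+ (2 ℕ.+ m′)) in
    (∀ j → n ∤ j → IsUnit L (ι (Xⁿ−1 j))) → ι (Xⁿ−1 n *P Xⁿ−1 n) ≈ 0# → IsUnit L (ι (constP (+ 2))) →
    ℕ.Coprime n 2 → Congruent 2 1 n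
  quadratic m′ unit square two cop = congruence (2 ℕ.+ m′) m′ (arithSum (+ 2) (+ 2) m′ ℤ.+ + n ℤ.+ + n) (ℕ.s≤s (ℕₚ.m≤n+m (2 ℕ.+ m′) m′))
    (≡.trans (≡.cong (ℕ._/ 2) (n+1≡2m m′)) (ℕ.m*n/n≡m (2 ℕ.+ m′) 2))
    (ℕₚ.m+n∸n≡m m′ (2 ℕ.+ m′)) (Aexp-quadratic m′)
    (QuadraticCase.quadratic-congruence L (ι (XP 1)) q-unit m′ ([]²≈0 n square) (2-unit two) (P-unit n unit 2 cop) t
      λ k k<n → trans (*-congˡ (*-congˡ (sym (*-identityʳ _)))) (trans (t-def k k<n)
        (*-cong (*-congʳ (trans (*-identityʳ _) (*-identityʳ _))) (e-cong (ℤₚ.pos-* 2 k)))))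
    where
    n = suc (m′ ℕ.+ (2 ℕ.+ m′))
    open Sums 2 1 n (P-unit n unit 2 cop)

-- The congruence modulo F²

-- Φ_n enters only through two properties: it divides q^n - 1, and it is coprime to q^j - 1 whenever
-- n ∤ j. The first makes (1 - q^n)² vanish, the second makes the denominators invertible.
module ModSquare (n′ : ℕ) (F Π : Poly) (FΠ≋ : F *P Π ≋ Xⁿ−1 (suc n′))
                 (F-coprime : ∀ j → suc n′ ∤ j → Coprime F (Xⁿ−1 j))
                 (loc : LocalizesAt polyRing (powP F 2) (λ D → Coprime D (powP F 2))) where
  private
    n : ℕ
    n = suc n′

    p : Poly
    p = powP F 2

    Coprime-p : ∀ {D} → Coprime D F → Coprime D p
    Coprime-p {D} c = Coprime-sym {p} {D} (Coprime-* {F} {F *P oneP} (Coprime-sym {D} c)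
      (Coprime-* {F} {oneP} (Coprime-sym {D} c) (Coprime-oneP D)))

    -- The Bézout relation is q^{n-1} · q - (q^n - 1) = 1.
    X-coprime : Coprime (XP 1) F
    X-coprime = XP n′ , negP Π , 1ℤ , (λ ()) , (begin
      (XP n′ *P XP 1) +P (negP Π *P F)
        ≈⟨ solve 4 (λ x y f g → x :* y :+ (:- g) :* f := y :* x :- f :* g) refl (XP n′) (XP 1) F Π ⟩
      (XP 1 *P XP n′) -P (F *P Π)
        ≈⟨ +-cong (sym (XP-+ 1 n′)) (-‿cong FΠ≋) ⟩
      XP n -P (XP n -P oneP)
        ≈⟨ solve 1 (λ x → x :- (x :- con 1ℤ) := con 1ℤ) refl (XP n) ⟩
      oneP  ∎)
      where
      open Polys
      open import Relation.Binary.Reasoning.Setoid setoid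

  open LocalizesAt loc

  private
    q-unit : IsUnit L (ι (XP 1))
    q-unit = ι-unit (Coprime-p X-coprime)

  open Evaluation L ι ι-hom q-unit public
    using (Represents; den-unit; Represents-unique; generic; quadratic)
  open Polys

  unit : ∀ j → n ∤ j → IsUnit L (ι (Xⁿ−1 j))
  unit j n∤j = ι-unit (Coprime-p (Coprime-sym {F} {Xⁿ−1 j} (F-coprime j n∤j)))

  square : CommutativeRing._≈_ L (ι (Xⁿ−1 n *P Xⁿ−1 n)) (CommutativeRing.0# L)
  square = CommutativeRing.trans L (RingMorphisms.IsRingHomomorphism.⟦⟧-cong ι-hom
    (trans (*-cong (sym FΠ≋) (sym FΠ≋)) (solve 2 (λ f g → f :* g :* (f :* g) := f :* (f :* con 1ℤ) :* (g :* g)) refl F Π)))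
    (ι-multiple (Π *P Π))

  two : IsUnit L (ι (constP (+ 2)))
  two = ι-unit (oneP , [] , + 2 , (λ ()) , trans (+-identityʳ _) (*-identityˡ (constP (+ 2))))

  private
    -- Recovers coprimality from invertibility in the localization, so the unreduced denominators of
    -- the two sides never have to be examined as polynomials.
    unit⇒Coprime : ∀ {D} → IsUnit L (ι D) → Coprime D p
    unit⇒Coprime {D} u = let (b , s , (U , V , c , c≢0 , eq) , w , Db≋) = unit⇒ u in
      U *P b , V -P (U *P w) , c , c≢0 , trans
        (solve 6 (λ u b d v w p → u :* b :* d :+ (v :- u :* w) :* p := u :* (d :* b :- p :* w) :+ v :* p) refl U b D V w p)
        (trans (+-congʳ {V *P p} (*-congˡ {U} (trans (+-congʳ {negP (p *P w)} Db≋)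
            (solve 2 (λ s x → s :+ x :- x := s) refl s (p *P w))))) eq)

  Represents⇒≡R : ∀ A B → (∃ λ y → Represents A y × Represents B y) → A ≡R B [mod p ]
  Represents⇒≡R (a // b) (c // f) (y , rA , rB) =
    let (u , u∈S , w , eq) = ι-zero⇒ (Represents-unique rA rB)
        (U , V , k , k≢0 , cop) = Coprime-* {u} {b *P f} u∈S (Coprime-* {b} {f} (unit⇒Coprime (den-unit rA)) (unit⇒Coprime (den-unit rB)))
    -- From u (a f - c b) = p w. In `_≡R_[mod_]` the numerator N is multiplied by both denominators,
    -- so D has to contain b f besides u.
    in w , u *P (b *P f) , (U , V , k , k≢0 , ≋⇒≈P cop) , ≋⇒≈P (trans
      (solve 4 (λ x u b f → x :* (u :* (b :* f)) := u :* x :* (b :* f)) refl ((a *P f) -P (c *P b)) u b f)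
      (trans (*-congʳ {b *P f} eq)
        (solve 4 (λ p w b f → p :* w :* (b :* f) := w :* b :* f :* p) refl p w b f)))

AllCoprime : ℕ → Poly → Set
AllCoprime n F = ∀ j → n ∤ j → Coprime F (Xⁿ−1 j)

LocalizesModSquare : Poly → Set₁
LocalizesModSquare F = LocalizesAt polyRing (powP F 2) (λ D → Coprime D (powP F 2))

generic-case : ∀ r′ s m′ → let open GenericParameters r′ s m′ in
  ∀ F Π → F *P Π ≋ Xⁿ−1 n → AllCoprime n F → LocalizesModSquare F → ℕ.Coprime n d →
  sumR n (lhsTerm d r) ≡R rhs d n r [mod powP F 2 ]
generic-case r′ s m′ F Π FΠ≋ F-coprime loc cop = Represents⇒≡R (sumR n (lhsTerm d r)) (rhs d n r) (generic r′ s m′ unit square cop)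
  where
  open GenericParameters r′ s m′
  open ModSquare (N ℕ.+ m) F Π FΠ≋ F-coprime loc

quadratic-case : ∀ m′ → let n = suc (m′ ℕ.+ (2 ℕ.+ m′)) in
  ∀ F Π → F *P Π ≋ Xⁿ−1 n → AllCoprime n F → LocalizesModSquare F → ℕ.Coprime n 2 →
  sumR n (lhsTerm 2 1) ≡R rhs 2 n 1 [mod powP F 2 ]
quadratic-case m′ F Π FΠ≋ F-coprime loc cop = Represents⇒≡R (sumR n (lhsTerm 2 1)) (rhs 2 n 1) (quadratic m′ unit square two cop)
  where
  n = suc (m′ ℕ.+ (2 ℕ.+ m′))
  open ModSquare (m′ ℕ.+ (2 ℕ.+ m′)) F Π FΠ≋ F-coprime loc

localization-Coprime : ∀ P → LocalizesAt polyRing P (λ D → Coprime D P)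
localization-Coprime P = LocalizedQuotient.localization polyRing P (λ D → Coprime D P) (Coprime-oneP P) Coprime-*

-- Reduction of the hypotheses to the two cases

data Parameters (d r n : ℕ) : Set where
  generic   : ∀ r′ s m′ → d ≡ 3 ℕ.+ (r′ ℕ.+ s) → r ≡ suc r′ → n ≡ GenericParameters.n r′ s m′ → Parameters d r n
  quadratic : ∀ m′ → d ≡ 2 → r ≡ 1 → n ≡ suc (m′ ℕ.+ (2 ℕ.+ m′)) → Parameters d r n

private
  -- The hypothesis n ≥ 2d - r says that m = (n + r)/d is at least 2, which the blocks of length m -
  -- 2 require.
  multiplier : ∀ {d r n} → 1 ℕ.≤ d → d ∣ n ℕ.+ r → 2 ℕ.* d ∸ r ℕ.≤ n → ∃ λ m′ → n ℕ.+ r ≡ (2 ℕ.+ m′) ℕ.* d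
  multiplier {d@(suc _)} {r} {n} _ (divides m eq) le = m ∸ 2 , ≡.trans eq (≡.cong (ℕ._* d) (≡.sym (ℕₚ.m+[n∸m]≡n 2≤m)))
    where
    2≤m : 2 ℕ.≤ m
    2≤m = ℕₚ.*-cancelʳ-≤ 2 m d (ℕₚ.≤-trans (ℕₚ.m≤n+m∸n (2 ℕ.* d) r)
      (ℕₚ.≤-trans (ℕₚ.+-monoʳ-≤ r le) (ℕₚ.≤-reflexive (≡.trans (ℕₚ.+-comm r n) eq))))

parameters : ∀ d r n → 1 ℕ.≤ d → 1 ℕ.≤ r → (3 ℕ.+ r ℕ.≤ d ⊎ (r ≡ 1 × (d ≡ 2 ⊎ d ≡ 3))) →
             d ∣ n ℕ.+ r → 2 ℕ.* d ∸ r ℕ.≤ n → Parameters d r n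
parameters d (suc r′) n 1≤d _ cases d∣ le with multiplier 1≤d d∣ le | cases
... | m′ , eq | inj₁ 3+r≤d = generic r′ s m′ d≡ ≡.refl (ℕₚ.+-cancelʳ-≡ (suc r′) n _ (≡.trans eq
        (≡.trans (ℕₚ.*-comm (2 ℕ.+ m′) d) (≡.trans (≡.cong (ℕ._* (2 ℕ.+ m′)) d≡) (≡.sym (GenericParameters.n+r≡d*m r′ s m′))))))
  where
  -- This is d - r - 2, at least 1 when d ≥ r + 3. The value 0 occurs only for d = 3, r = 1, in the
  -- last clause.
  s = suc (d ∸ (3 ℕ.+ suc r′))
  d≡ : d ≡ 3 ℕ.+ (r′ ℕ.+ s)
  d≡ = ≡.trans (≡.sym (ℕₚ.m+[n∸m]≡n 3+r≤d)) (≡.cong (3 ℕ.+_) (≡.sym (ℕₚ.+-suc r′ (d ∸ (3 ℕ.+ suc r′)))))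
... | m′ , eq | inj₂ (≡.refl , inj₁ ≡.refl) = quadratic m′ ≡.refl ≡.refl (ℕₚ.+-cancelʳ-≡ 1 n _ (≡.trans eq (≡.sym (n+1≡2m m′))))
... | m′ , eq | inj₂ (≡.refl , inj₂ ≡.refl) = generic 0 0 m′ ≡.refl ≡.refl (ℕₚ.+-cancelʳ-≡ 1 n _ (≡.trans eq
        (≡.trans (ℕₚ.*-comm (2 ℕ.+ m′) 3) (≡.sym (GenericParameters.n+r≡d*m 0 0 m′)))))

open import Data.Nat using (_+_; _*_; _≤_)

theorem4p1 : (d r n : ℕ) → 1 ≤ d → 1 ≤ r → gcd d r ≡ 1 →
  (3 + r ≤ d ⊎ (r ≡ 1 × (d ≡ 2 ⊎ d ≡ 3))) →
  d ∣ n + r → 2 * d ∸ r ≤ n →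
  sumR n (lhsTerm d r) ≡R rhs d n r [mod powP (Φ n) 2 ]
theorem4p1 d r n 1≤d 1≤r gcd≡1 cases d∣n+r le = conclude (parameters d r n 1≤d 1≤r cases d∣n+r le)
  where
  -- A common divisor of n and d divides n + r, hence r, and gcd(d, r) = 1.
  n-coprime-d : ℕ.Coprime n d
  n-coprime-d (i∣n , i∣d) = ℕ.gcd≡1⇒coprime gcd≡1 (i∣d , ∣m+n∣m⇒∣n (∣-trans i∣d d∣n+r) i∣n)

  conclude : Parameters d r n → sumR n (lhsTerm d r) ≡R rhs d n r [mod powP (Φ n) 2 ]
  conclude (generic r′ s m′ ≡.refl ≡.refl ≡.refl) = generic-case r′ s m′ (Φ n) (ΦProd n (ℕ.pred n))
    (proj₂ (isCyclotomic (ℕ.pred n))) (Φ-coprime (ℕ.pred n) (λ i _ → isCyclotomic i)) (localization-Coprime (powP (Φ n) 2)) n-coprime-d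
  conclude (quadratic m′ ≡.refl ≡.refl ≡.refl) = quadratic-case m′ (Φ n) (ΦProd n (ℕ.pred n))
    (proj₂ (isCyclotomic (ℕ.pred n))) (Φ-coprime (ℕ.pred n) (λ i _ → isCyclotomic i)) (localization-Coprime (powP (Φ n) 2)) n-coprime-d
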